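{- Let $\lambda=\langle 1^{m_1},2^{m_2},\dots,k^{m_k}\rangle$ be a partition of $k\ge 4$, and let $c_\lambda$ be the coefficient of $e_\lambda z^{|\lambda|}$ in $\frac12\mathcal{X}_{C_v}(z)=\frac12\sum_{n\ge 3}X_{C_{n,v}}z^{n+1}$. Then: (a) $c_{(k)}=k(2k-5)$. (b) If $m_1>1$, then $c_\lambda=0$. (c) If $m_1=1$ and $\lambda=\mu\cup 1$ (so that $m_1(\mu)=0$), then $$c_\lambda=\sum_{\substack{i\ge 4\\ i\in\mathrm{supp}(\mu)}}(i-1)(i-3)\,\varepsilon(\mu-i)$$ (which is $0$ unless $\lambda$ has a part of size at least $4$). (d) If $m_1=m_2=0$, then $$c_\lambda=\sum_{a\in\mathrm{supp}(\lambda)}(2a^2-5a)\,\varepsilon(\lambda-a).$$ (e) If $m_1=0$ and $m_2=\ell(\lambda)$, then $c_\lambda=0$. (f) If $m_1=0$ and $1\le m_2<\ell(\lambda)$, then $$c_\lambda=\sum_{\substack{a,b\ge 3\\ (a,b)\in\mathrm{supp}(\lambda)}}\varepsilon(\lambda-a-b)(2a^2-5a)(b-1)+\sum_{\substack{c\ge 3\\ c\in\mathrm{supp}(\lambda)}}\varepsilon(\lambda-c-2)(2c^2-6c+2),$$ where the first sum is over ordered pairs $(a,b)$, and $(a,b)\in\mathrm{supp}(\lambda)$ means that both $a$ and $b$ are in $\mathrm{supp}(\lambda)$ if $a\ne b$, and that $m_a\ge 2$ if $a=b$.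
   Context: The chromatic symmetric function of a finite simple graph $H=(V,E)$ is $X_H=\sum_\kappa\prod_{u\in V}x_{\kappa(u)}$, the sum over all proper colorings $\kappa:V\to\mathbb{Z}_{>0}$. $C_n$ is the cycle on $n$ vertices. The twin of a graph at a vertex $v$ is obtained by adding a new vertex $v'$ joined to $v$ and to all neighbors of $v$; $C_{n,v}$ denotes $C_n$ twinned at a vertex $v$. $e_\lambda$ are the elementary symmetric functions. For a partition $\lambda$: $\ell(\lambda)$ is its number of parts, $m_j=m_j(\lambda)$ the multiplicity of $j$, $\mathrm{supp}(\lambda)=\{j:m_j(\lambda)\ge 1\}$, $\mu\cup 1$ is $\mu$ with an extra part $1$. Define $$\varepsilon(\lambda)=\ell(\lambda)!\prod_{j\in\mathrm{supp}(\lambda)}\frac{(j-1)^{m_j(\lambda)}}{m_j(\lambda)!},\qquad\varepsilon(\emptyset)=1.$$ For a part $a$ of $\lambda$, $\lambda-a$ is $\lambda$ with one part equal to $a$ removed ($\lambda-a-b$ means $(\lambda-a)-b$); if $a$ is not a part of $\lambda$, $\varepsilon(\lambda-a)=0$ by convention. -}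

module Defs where

open import Data.Bool using (if_then_else_)
open import Data.Empty using (⊥)
open import Data.Fin using (Fin; zero; suc; toℕ)
open import Data.Fin.Properties using (all?) renaming (_≟_ to _≟ᶠ_)
open import Data.Integer using (ℤ; +_; 1ℤ) renaming (_-_ to _-ℤ_; _^_ to _^ℤ_)
open import Data.List using (List; []; _∷_; _++_; map; foldr; filter; length; lookup; replicate; concatMap; cartesianProduct; cartesianProductWith; upTo; allFin)
open import Data.List.Relation.Unary.All using (All) renaming (all? to allList?)
open import Data.List.Relation.Unary.Linked using (Linked)
open import Data.Maybe using (Maybe; just; nothing; _>>=_) renaming (map to mapMaybe)
open import Data.Nat using (ℕ; zero; suc; _!; _∸_; _≥_; _≤?_; NonZero) renaming (_+_ to _+ℕ_; _*_ to _*ℕ_)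
open import Data.Nat.ListAction using (sum)
open import Data.Nat.Properties using (_≟_; 1+n≢n; _!≢0)
open import Data.Product using (_×_; _,_)
open import Data.Rational using (ℚ; 0ℚ; 1ℚ; ½; _+_; _*_; _/_)
open import Data.Sum using (_⊎_; inj₁; inj₂; swap)
open import Data.Vec using (Vec; []; _∷_; count) renaming (lookup to lookupᵛ)
open import Level using (0ℓ)
open import Relation.Binary using (Rel; Decidable; Symmetric)
open import Relation.Binary.PropositionalEquality using (_≡_; _≢_; sym)
open import Relation.Nullary using (¬_; Dec; no; does; ¬?; _×-dec_; _⊎-dec_; _→-dec_)

ι : ℤ → ℚ
ι z = z / 1

∑ : {A : Set} → List A → (A → ℚ) → ℚ
∑ xs f = foldr (λ x s → f x + s) 0ℚ xs

∏ : {A : Set} → List A → (A → ℚ) → ℚ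
∏ xs f = foldr (λ x s → f x * s) 1ℚ xs

record SimpleGraph (n : ℕ) : Set₁ where
  field
    _~_      : Rel (Fin n) 0ℓ
    _~?_     : Decidable _~_
    ~-sym    : Symmetric _~_
    ~-irrefl : ∀ u → ¬ (u ~ u)

-- Next n i j : j is the cyclic successor of i in {0, …, n-1}.
Next : (n : ℕ) → Rel (Fin n) 0ℓ
Next n i j = (toℕ j ≡ suc (toℕ i)) ⊎ (suc (toℕ i) ≡ n × toℕ j ≡ 0)

next? : (n : ℕ) → Decidable (Next n)
next? n i j = (toℕ j ≟ suc (toℕ i)) ⊎-dec ((suc (toℕ i) ≟ n) ×-dec (toℕ j ≟ 0))

-- cycle m is the cycle C_n with n = 3 + m, so that m ranges over all n ≥ 3.
cycle : (m : ℕ) → SimpleGraph (3 +ℕ m)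
cycle m = record
  { _~_      = λ i j → Next n i j ⊎ Next n j i
  ; _~?_     = λ i j → next? n i j ⊎-dec next? n j i
  ; ~-sym    = swap
  ; ~-irrefl = λ { u (inj₁ p) → irr u p ; u (inj₂ p) → irr u p }
  }
  where
  n = 3 +ℕ m
  irr : ∀ u → ¬ Next n u u
  irr u       (inj₁ p)        = 1+n≢n (sym p)
  irr zero    (inj₂ (() , _))
  irr (suc u) (inj₂ (_ , ()))

-- The new vertex v′ is zero; an old vertex u becomes suc u.
twin : ∀ {n} → SimpleGraph n → Fin n → SimpleGraph (suc n)
twin {n} G v = record
  { _~_      = Adj
  ; _~?_     = adj?
  ; ~-sym    = λ {x} {y} → adj-sym x y
  ; ~-irrefl = adj-irrefl
  }
  where
  open SimpleGraph G
  Adj : Rel (Fin (suc n)) 0ℓ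
  Adj zero    zero    = ⊥
  Adj zero    (suc u) = (u ≡ v) ⊎ (v ~ u)
  Adj (suc u) zero    = (u ≡ v) ⊎ (v ~ u)
  Adj (suc u) (suc w) = u ~ w
  adj? : Decidable Adj
  adj? zero    zero    = no λ ()
  adj? zero    (suc u) = (u ≟ᶠ v) ⊎-dec (v ~? u)
  adj? (suc u) zero    = (u ≟ᶠ v) ⊎-dec (v ~? u)
  adj? (suc u) (suc w) = u ~? w
  adj-sym : ∀ x y → Adj x y → Adj y x
  adj-sym zero    (suc u) p = p
  adj-sym (suc u) zero    p = p
  adj-sym (suc u) (suc w) p = ~-sym p
  adj-irrefl : ∀ x → ¬ Adj x x
  adj-irrefl zero    ()
  adj-irrefl (suc u) p = ~-irrefl u p

-- Power series are over ℚ in variables x₁, x₂, x₃, …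
-- The list a₁ ∷ … ∷ a_N ∷ [] stands for the monomial x₁^a₁ ⋯ x_N^a_N.
-- Trailing zeros do not change the monomial; the series built below take
-- the same value on all lists representing one monomial.
Monomial : Set
Monomial = List ℕ

PowerSeries : Set
PowerSeries = Monomial → ℚ

0ₛ : PowerSeries
0ₛ _ = 0ℚ

1ₛ : PowerSeries
1ₛ α = if does (allList? (_≟ 0) α) then 1ℚ else 0ℚ

infixl 7 _*ₛ_ _·ₛ_

_·ₛ_ : ℚ → PowerSeries → PowerSeries
(q ·ₛ f) α = q * f α

-- All factorisations x^α = x^β x^γ, each listed once.
splits : Monomial → List (Monomial × Monomial)
splits []      = ([] , []) ∷ []
splits (a ∷ α) =
  cartesianProductWith (λ b (β , γ) → b ∷ β , (a ∸ b) ∷ γ) (upTo (suc a)) (splits α)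

_*ₛ_ : PowerSeries → PowerSeries → PowerSeries
(f *ₛ g) α = ∑ (splits α) λ (β , γ) → f β * g γ

-- e k = Σ_{i₁ < ⋯ < i_k} x_{i₁} ⋯ x_{i_k}, the sum of all squarefree
-- monomials of degree k.
e : ℕ → PowerSeries
e k α = if does (allList? (_≤? 1) α ×-dec (sum α ≟ k)) then 1ℚ else 0ℚ

e[_] : List ℕ → PowerSeries
e[ ν ] = foldr (λ i f → e i *ₛ f) 1ₛ ν

colorings : (n N : ℕ) → List (Vec (Fin N) n)
colorings zero    N = [] ∷ []
colorings (suc n) N = cartesianProductWith _∷_ (allFin N) (colorings n N)

Proper : ∀ {n N} → SimpleGraph n → Vec (Fin N) n → Set
Proper G κ = ∀ u w → u ~ w → lookupᵛ κ u ≢ lookupᵛ κ w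
  where open SimpleGraph G

proper? : ∀ {n N} (G : SimpleGraph n) (κ : Vec (Fin N) n) → Dec (Proper G κ)
proper? G κ = all? λ u → all? λ w → (u ~? w) →-dec ¬? (lookupᵛ κ u ≟ᶠ lookupᵛ κ w)
  where open SimpleGraph G

-- ∏_u x_{κ(u)} is the monomial α: each color i is used α_i times.
HasContent : ∀ {n} (α : Monomial) → Vec (Fin (length α)) n → Set
HasContent α κ = ∀ i → count (_≟ᶠ i) κ ≡ lookup α i

hasContent? : ∀ {n} (α : Monomial) (κ : Vec (Fin (length α)) n) → Dec (HasContent α κ)
hasContent? α κ = all? λ i → count (_≟ᶠ i) κ ≟ lookup α i

-- The coefficient of x^α is the number of proper colorings κ : V → ℤ_{>0}
-- with ∏_u x_{κ(u)} = x^α.  Such a κ only uses colors 1, …, length α, so it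
-- is enough to count colorings by Fin (length α).
X : ∀ {n} → SimpleGraph n → PowerSeries
X {n} G α =
  ι (+ length (filter (λ κ → proper? G κ ×-dec hasContent? α κ) (colorings n (length α))))

-- A power series in z over the power series in the x_i, given by its
-- coefficients: 𝒳Cv v = Σ_{n ≥ 3} X_{C_{n,v}} z^{n+1}, where v m is the
-- vertex at which C_{3+m} is twinned.
𝒳Cv : (v : ∀ m → Fin (3 +ℕ m)) → ℕ → PowerSeries
𝒳Cv v (suc (suc (suc (suc m)))) = X (twin (cycle m) (v m))
𝒳Cv v _                         = 0ₛ

½𝒳Cv : (v : ∀ m → Fin (3 +ℕ m)) → ℕ → PowerSeries
½𝒳Cv v N = ½ ·ₛ 𝒳Cv v N

infix 4 _⊢_
record _⊢_ (ν : List ℕ) (k : ℕ) : Set where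
  field
    decreasing : Linked _≥_ ν
    positive   : All NonZero ν
    size       : sum ν ≡ k

-- The partitions of n with all parts ≤ m, each listed once; i is the
-- multiplicity of the part suc m.
partitions≤ : (m n : ℕ) → List (List ℕ)
partitions≤ zero    zero    = [] ∷ []
partitions≤ zero    (suc n) = []
partitions≤ (suc m) n       =
  concatMap (λ i → map (replicate i (suc m) ++_) (partitions≤ m (n ∸ i *ℕ suc m)))
            (filter (λ i → i *ℕ suc m ≤? n) (upTo (suc n)))

partitions : ℕ → List (List ℕ)
partitions n = partitions≤ n n

-- f = Σ_ν c_ν e_ν as formal power series, the sum being over all partitions.
-- As e_ν is homogeneous of degree |ν|, only the partitions of the degree of
-- x^α contribute to the coefficient of x^α.
infix 4 _IsEExpansionOf_
_IsEExpansionOf_ : (List ℕ → ℚ) → PowerSeries → Set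
c IsEExpansionOf f = ∀ α → f α ≡ ∑ (partitions (sum α)) λ ν → c ν * e[ ν ] α

mult : ℕ → List ℕ → ℕ
mult j ν = length (filter (_≟ j) ν)

supp : List ℕ → List ℕ
supp ν = filter (λ j → 1 ≤? mult j ν) (upTo (suc (sum ν)))

-- The ordered pairs (a , b) "in supp ν": a = b additionally requires m_a ≥ 2.
suppPairs : List ℕ → List (ℕ × ℕ)
suppPairs ν =
  filter (λ (a , b) → (a ≟ b) →-dec (2 ≤? mult a ν)) (cartesianProduct (supp ν) (supp ν))

-- Correct for weakly decreasing lists of positive integers.
_∪1 : List ℕ → List ℕ
μ ∪1 = μ ++ (1 ∷ [])

-- nothing if a is not a part.
remove : ℕ → List ℕ → Maybe (List ℕ)
remove a []      = nothing
remove a (x ∷ ν) = if does (x ≟ a) then just ν else mapMaybe (x ∷_) (remove a ν)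

ε : List ℕ → ℚ
ε ν = ι (+ (length ν !)) * ∏ (supp ν) λ j →
  _/_ ((+ j -ℤ 1ℤ) ^ℤ mult j ν) (mult j ν !) {{mult j ν !≢0}}

-- ε extended by the convention that it vanishes if a removed part is absent.
ε? : Maybe (List ℕ) → ℚ
ε? nothing  = 0ℚ
ε? (just ν) = ε ν

ε[_-_] : List ℕ → ℕ → ℚ
ε[ ν - a ] = ε? (remove a ν)

ε[_-_-_] : List ℕ → ℕ → ℕ → ℚ
ε[ ν - a - b ] = ε? (remove a ν >>= remove b)

{-# OPTIONS --safe #-}

-- Write T for the sum of ½X over all twinned cycles.  Choosing the colours a ≠ b of the two twins and
-- then colouring the remaining path by a Smirnov word from i to j gives 2T = Σ W_ij V_ij, where W_ij
-- enumerates the Smirnov words from i to j and V_ij is the sum of x_a x_b over a ≠ b outside {i, j}.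
-- With y_i = x_i / (1 + x_i), s = Σ y_i and B = Σ y_i² the transfer matrix equations have the solution
-- W_ij = δ_ij y_i + P y_i y_j, where P (1 - s) = 1, and expanding yields
--   T = (2 + e₁) C + (e₂ - 3) P + (e₂ + 3 e₁ + 3),   C = P (s² - B).
-- Let E = Σ e_k and let D multiply by the degree.  Since D is a derivation, E s = D E and
-- E (s² - B) = D² E - D E, so P = E F and C = (D² E - D E) F with F = 1 / (E - D E).
-- The recursion ε(ν) = Σ_a (a - 1) ε(ν - a) says that F = Σ ε(ν) e_ν, and multiplication by e_j shifts
-- coefficients from ν - j to ν; so the coefficients of T are sums of ε(ν - a), ε(ν - 1 - a), ε(ν - 2 - a).
-- They are the only ones because the e_ν are linearly independent.
module Submission where

open import Defs
open import Algebra.Bundles using (CommutativeRing)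
open import Algebra.Structures using (IsCommutativeRing)
import Algebra.Solver.Ring.AlmostCommutativeRing as ACR
open import Data.Bool using (true; false; if_then_else_)
open import Data.Bool.Properties using (∧-zeroʳ)
open import Data.Empty using (⊥-elim)
import Data.Fin
open import Data.Fin using (Fin; zero; suc; toℕ; inject₁) renaming (fromℕ to maxFin)
open import Data.Fin.Properties using (all?; toℕ-injective; toℕ-fromℕ; toℕ-inject₁; toℕ<n; toℕ-fromℕ<) renaming (_≟_ to _≟ᶠ_)
import Data.Integer
open import Data.Integer using (ℤ; +_; 1ℤ) renaming (-_ to -ℤ_; _+_ to _+ℤ_; _*_ to _*ℤ_; _-_ to _-ℤ_; _^_ to _^ℤ_)
open import Data.List using (List; []; _∷_; _++_; map; foldr; filter; length; lookup; replicate; cartesianProduct; cartesianProductWith; upTo; applyUpTo; allFin)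
open import Data.List.Properties using (map-upTo; map-tabulate; ++-cancelˡ; ∷-injectiveʳ; filter-accept; filter-reject)
open import Data.List.Membership.Propositional using (_∈_; find; lose)
open import Data.List.Membership.Propositional.Properties using (∈-cartesianProductWith⁻; ∈-cartesianProductWith⁺; ∈-upTo⁻; ∈-upTo⁺; ∈-filter⁺; ∈-filter⁻; ∈-allFin; ∈-map⁺; ∈-map⁻; ∈-concatMap⁺; ∈-concatMap⁻)
open import Data.List.Relation.Unary.Any using (here; there)
open import Data.List.Relation.Unary.All as All using (All; []; _∷_) renaming (all? to allList?)
import Data.List.Relation.Unary.All.Properties as All
open import Data.List.Relation.Unary.AllPairs as AllPairs using (AllPairs; []; _∷_)
import Data.List.Relation.Unary.AllPairs.Properties as AllPairs
open import Data.List.Relation.Unary.Linked.Properties using (Linked⇒AllPairs)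
open import Data.List.Relation.Unary.Unique.Propositional using (Unique)
import Data.List.Relation.Unary.Unique.Propositional.Properties as Unique
open import Data.List.Relation.Binary.BagAndSetEquality using (∼bag⇒↭)
open import Data.List.Membership.Propositional.Properties.WithK using (unique∧set⇒bag)
open import Data.List.Relation.Binary.Permutation.Propositional.Properties using (↭-length; filter-↭; All-resp-↭; drop-∷)
open import Data.Nat.ListAction.Properties using (sum-↭)
open import Data.List.Relation.Binary.Permutation.Propositional as Perm using (_↭_)
import Data.Nat
open import Data.Nat using (ℕ; zero; suc; _∸_; _≤_; _<_; _≥_; _≤?_; z≤n; s≤s; NonZero; _!) renaming (_+_ to _+ℕ_; _*_ to _*ℕ_)
open import Data.Nat.ListAction using (sum)
open import Data.Maybe.Properties using (just-injective)
open import Data.Sum using (_⊎_; inj₁; inj₂)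
open import Data.Maybe using (Maybe; just; nothing; _>>=_) renaming (map to mapMaybe)
open import Data.Product using (_×_; _,_; ∃; proj₁; proj₂)
open import Data.Rational using (ℚ; 0ℚ; 1ℚ; ½; toℚᵘ; 1/_; _/_; _+_; _*_; -_) renaming (_-_ to _-ℚ_)
import Data.Integer.Properties as ℤ
import Data.Nat.Properties as ℕ
open import Data.Unit using (⊤; tt)
open import Data.Vec using (Vec; []; _∷_; _∷ʳ_; count) renaming (lookup to lookupᵛ)
import Data.Vec as Vec
import Data.Vec.Properties as Vec
import Data.Rational.Properties as ℚ
import Data.Rational.Solver
import Data.Rational.Unnormalised as ℚᵘ
import Data.Rational.Unnormalised.Properties as ℚᵘ
open import Function using (_∘_; id)
open import Function.Bundles using (_⇔_; mk⇔; Equivalence)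
open import Relation.Binary.PropositionalEquality using (_≡_; _≢_; refl; sym; trans; cong; cong₂; subst; module ≡-Reasoning)
open import Relation.Nullary using (¬_; Dec; yes; no; does; ¬?; _×-dec_; _→-dec_)
open import Relation.Binary using (tri<; tri≈; tri>)
open import Relation.Nullary.Decidable using (decidable-stable; dec⇒maybe; dec-true; dec-false; does-⇔)

-- The only inverse that is computed is that of `E`, whose coefficients are signs. The inverse of
-- `1 - s` is supplied as `E F` and used solely through `P = 1 + P s`, so the solution of the
-- transfer matrix is checked by polynomial identities with explicit cofactors. Sums over colours
-- need a fixed number N of variables, so series are compared on exponent lists of length N; the
-- coefficients found do not depend on N. The twinned vertex is arbitrary in the statement; rotating
-- colourings moves it to the vertex 0, where deleting both twins leaves a path that they see only
-- through its two end colours. The cases of the statement come from two facts: `ε` vanishes as soon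
-- as there is a part 1, and the terms with `e₁` and `e₂` need a part 1 or 2. Where such parts
-- occur, the other terms are expanded once more by the recursion for `ε`, so that equally many
-- parts are removed everywhere. Independence rests on the first variable: its top power in `e_ν` is
-- the number of parts of ν, with the product belonging to all parts lowered by 1 as coefficient.
-- Repeating this reads off the conjugate partition.

module ListSum {c ℓ} (R : CommutativeRing c ℓ) where

  open CommutativeRing R hiding (zero) renaming (_+_ to _⊕_; _*_ to _⊛_; refl to ≈-refl; sym to ≈-sym; trans to ≈-trans)
  open import Algebra.Properties.CommutativeSemigroup +-commutativeSemigroup using (interchange; x∙yz≈y∙xz)

  ∑ᴿ : {A : Set} → List A → (A → Carrier) → Carrier
  ∑ᴿ xs f = foldr (λ x s → f x ⊕ s) 0# xs

  ∑-cong-∈ : {A : Set} (xs : List A) {f g : A → Carrier} → (∀ {x} → x ∈ xs → f x ≈ g x) → ∑ᴿ xs f ≈ ∑ᴿ xs g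
  ∑-cong-∈ []       h = ≈-refl
  ∑-cong-∈ (x ∷ xs) h = +-cong (h (here refl)) (∑-cong-∈ xs (h ∘ there))

  ∑-cong : {A : Set} (xs : List A) {f g : A → Carrier} → (∀ x → f x ≈ g x) → ∑ᴿ xs f ≈ ∑ᴿ xs g
  ∑-cong xs h = ∑-cong-∈ xs (λ {x} _ → h x)

  ∑-zero : {A : Set} (xs : List A) {f : A → Carrier} → (∀ {x} → x ∈ xs → f x ≈ 0#) → ∑ᴿ xs f ≈ 0#
  ∑-zero []       h = ≈-refl
  ∑-zero (x ∷ xs) h = ≈-trans (+-cong (h (here refl)) (∑-zero xs (h ∘ there))) (+-identityˡ 0#)

  ∑-distrib-+ : {A : Set} (xs : List A) (f g : A → Carrier) → ∑ᴿ xs (λ x → f x ⊕ g x) ≈ ∑ᴿ xs f ⊕ ∑ᴿ xs g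
  ∑-distrib-+ []       f g = ≈-sym (+-identityˡ 0#)
  ∑-distrib-+ (x ∷ xs) f g = ≈-trans (+-congˡ (∑-distrib-+ xs f g)) (interchange (f x) (g x) _ _)

  *-distribˡ-∑ : {A : Set} (xs : List A) (q : Carrier) (f : A → Carrier) → q ⊛ ∑ᴿ xs f ≈ ∑ᴿ xs (λ x → q ⊛ f x)
  *-distribˡ-∑ []       q f = zeroʳ q
  *-distribˡ-∑ (x ∷ xs) q f = ≈-trans (distribˡ q (f x) _) (+-congˡ (*-distribˡ-∑ xs q f))

  *-distribʳ-∑ : {A : Set} (xs : List A) (q : Carrier) (f : A → Carrier) → ∑ᴿ xs f ⊛ q ≈ ∑ᴿ xs (λ x → f x ⊛ q)
  *-distribʳ-∑ xs q f = ≈-trans (*-comm _ q) (≈-trans (*-distribˡ-∑ xs q f) (∑-cong xs λ x → *-comm q (f x)))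

  ∑-swap : {A B : Set} (xs : List A) (ys : List B) (f : A → B → Carrier) →
    ∑ᴿ xs (λ x → ∑ᴿ ys (f x)) ≈ ∑ᴿ ys (λ y → ∑ᴿ xs (λ x → f x y))
  ∑-swap []       ys f = ≈-sym (∑-zero ys (λ _ → ≈-refl))
  ∑-swap (x ∷ xs) ys f = ≈-trans (+-congˡ (∑-swap xs ys f)) (≈-sym (∑-distrib-+ ys (f x) _))

  ∑-++ : {A : Set} (xs ys : List A) (f : A → Carrier) → ∑ᴿ (xs ++ ys) f ≈ ∑ᴿ xs f ⊕ ∑ᴿ ys f
  ∑-++ []       ys f = ≈-sym (+-identityˡ _)
  ∑-++ (x ∷ xs) ys f = ≈-trans (+-congˡ (∑-++ xs ys f)) (≈-sym (+-assoc (f x) _ _))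

  ∑-map : {A B : Set} (xs : List A) (h : A → B) (f : B → Carrier) → ∑ᴿ (map h xs) f ≈ ∑ᴿ xs (f ∘ h)
  ∑-map []       h f = ≈-refl
  ∑-map (x ∷ xs) h f = +-congˡ (∑-map xs h f)

  ∑-cartesianProductWith : {A B C : Set} (h : A → B → C) (xs : List A) (ys : List B) (f : C → Carrier) →
    ∑ᴿ (cartesianProductWith h xs ys) f ≈ ∑ᴿ xs (λ x → ∑ᴿ ys (λ y → f (h x y)))
  ∑-cartesianProductWith h []       ys f = ≈-refl
  ∑-cartesianProductWith h (x ∷ xs) ys f =
    ≈-trans (∑-++ (map (h x) ys) _ f) (+-cong (∑-map ys (h x) f) (∑-cartesianProductWith h xs ys f))

  ∑-filter-∈ : {A : Set} {P : A → Set} (P? : ∀ x → Dec (P x)) (xs : List A) (f : A → Carrier) →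
    (∀ {x} → x ∈ xs → ¬ P x → f x ≈ 0#) → ∑ᴿ (filter P? xs) f ≈ ∑ᴿ xs f
  ∑-filter-∈ P? []       f h = ≈-refl
  ∑-filter-∈ P? (x ∷ xs) f h with P? x
  ... | yes _ = +-congˡ (∑-filter-∈ P? xs f (h ∘ there))
  ... | no ¬p = ≈-trans (∑-filter-∈ P? xs f (h ∘ there)) (≈-sym (≈-trans (+-congʳ (h (here refl) ¬p)) (+-identityˡ _)))

  ∑-filter : {A : Set} {P : A → Set} (P? : ∀ x → Dec (P x)) (xs : List A) (f : A → Carrier) →
    (∀ x → ¬ P x → f x ≈ 0#) → ∑ᴿ (filter P? xs) f ≈ ∑ᴿ xs f
  ∑-filter P? xs f h = ∑-filter-∈ P? xs f (λ {x} _ → h x)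

  ∑-↭ : {A : Set} {xs ys : List A} (f : A → Carrier) → xs ↭ ys → ∑ᴿ xs f ≈ ∑ᴿ ys f
  ∑-↭ f Perm.refl         = ≈-refl
  ∑-↭ f (Perm.prep x p)   = +-congˡ (∑-↭ f p)
  ∑-↭ f (Perm.swap x y p) = ≈-trans (+-congˡ (+-congˡ (∑-↭ f p))) (x∙yz≈y∙xz (f x) (f y) _)
  ∑-↭ f (Perm.trans p q)  = ≈-trans (∑-↭ f p) (∑-↭ f q)

  ∑-allFin-suc : ∀ n (f : Fin (suc n) → Carrier) → ∑ᴿ (allFin (suc n)) f ≈ f zero ⊕ ∑ᴿ (allFin n) (f ∘ suc)
  ∑-allFin-suc n f = +-congˡ (≈-trans (reflexive (cong (λ xs → ∑ᴿ xs f) (sym (map-tabulate id suc)))) (∑-map (allFin n) suc f))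

open ListSum ℚ.+-*-commutativeRing

-- The ring of power series

-- Sum over the antidiagonal `i + j = a`. Passing both indices to `u` avoids truncated subtraction,
-- so Cauchy products can be treated by recursion on `a`.
anti : (ℕ → ℕ → ℚ) → ℕ → ℚ
anti u zero    = u 0 0
anti u (suc a) = u 0 (suc a) + anti (u ∘ suc) a

anti-cong : ∀ a {u v : ℕ → ℕ → ℚ} → (∀ i j → u i j ≡ v i j) → anti u a ≡ anti v a
anti-cong zero    h = h 0 0
anti-cong (suc a) h = cong₂ _+_ (h 0 (suc a)) (anti-cong a (λ i j → h (suc i) j))

anti-zero : ∀ a {u : ℕ → ℕ → ℚ} → (∀ i j → u i j ≡ 0ℚ) → anti u a ≡ 0ℚ
anti-zero zero    h = h 0 0
anti-zero (suc a) h = trans (cong₂ _+_ (h 0 (suc a)) (anti-zero a (λ i j → h (suc i) j))) (ℚ.+-identityˡ 0ℚ)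

anti-+ : ∀ a (u v : ℕ → ℕ → ℚ) → anti (λ i j → u i j + v i j) a ≡ anti u a + anti v a
anti-+ zero    u v = refl
anti-+ (suc a) u v = trans (cong (λ r → (u 0 (suc a) + v 0 (suc a)) + r) (anti-+ a (u ∘ suc) (v ∘ suc)))
                           (interchange (u 0 (suc a)) (v 0 (suc a)) _ _)
  where open import Algebra.Properties.CommutativeSemigroup (CommutativeRing.+-commutativeSemigroup ℚ.+-*-commutativeRing)

anti-snoc : ∀ a (u : ℕ → ℕ → ℚ) → anti u (suc a) ≡ anti (λ i j → u i (suc j)) a + u (suc a) 0
anti-snoc zero    u = refl
anti-snoc (suc a) u = trans (cong (λ r → u 0 (suc (suc a)) + r) (anti-snoc a (u ∘ suc))) (sym (ℚ.+-assoc (u 0 (suc (suc a))) _ _))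

anti-comm : ∀ a (u : ℕ → ℕ → ℚ) → anti u a ≡ anti (λ i j → u j i) a
anti-comm zero    u = refl
anti-comm (suc a) u = trans (anti-snoc a u)
  (trans (ℚ.+-comm _ (u (suc a) 0)) (cong (λ r → u (suc a) 0 + r) (anti-comm a (λ i j → u i (suc j)))))

-- Both sides run over the triples with `i + j + k = a`, grouped by `i + j` or by `j + k`; splitting
-- off the terms with `i = 0` gives the induction.
anti-assoc : ∀ a (t : ℕ → ℕ → ℕ → ℚ) →
  anti (λ b k → anti (λ i j → t i j k) b) a ≡ anti (λ i d → anti (λ j k → t i j k) d) a
anti-assoc zero    t = refl
anti-assoc (suc a) t = begin
  t 0 0 (suc a) + anti (λ b k → t 0 (suc b) k + anti (λ i j → t (suc i) j k) b) a
    ≡⟨ cong (λ r → t 0 0 (suc a) + r) (anti-+ a (λ b k → t 0 (suc b) k) (λ b k → anti (λ i j → t (suc i) j k) b)) ⟩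
  t 0 0 (suc a) + (anti (λ b k → t 0 (suc b) k) a + anti (λ b k → anti (λ i j → t (suc i) j k) b) a)
    ≡⟨ ℚ.+-assoc (t 0 0 (suc a)) _ _ ⟨
  anti (t 0) (suc a) + anti (λ b k → anti (λ i j → t (suc i) j k) b) a
    ≡⟨ cong (λ r → anti (t 0) (suc a) + r) (anti-assoc a (t ∘ suc)) ⟩
  anti (t 0) (suc a) + anti (λ i d → anti (λ j k → t (suc i) j k) d) a ∎
  where open ≡-Reasoning

∑-applyUpTo : ∀ (h : ℕ → ℕ) n (f : ℕ → ℚ) → ∑ (applyUpTo h n) f ≡ ∑ (upTo n) (f ∘ h)
∑-applyUpTo h n f = trans (cong (λ xs → ∑ xs f) (sym (map-upTo h n))) (∑-map (upTo n) h f)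

∑-upTo-suc : ∀ n (f : ℕ → ℚ) → ∑ (upTo (suc n)) f ≡ f 0 + ∑ (upTo n) (f ∘ suc)
∑-upTo-suc n f = cong (λ r → f 0 + r) (∑-applyUpTo suc n f)

∑≡anti : ∀ a (u : ℕ → ℕ → ℚ) → ∑ (upTo (suc a)) (λ b → u b (a ∸ b)) ≡ anti u a
∑≡anti zero    u = ℚ.+-identityʳ _
∑≡anti (suc a) u = trans (∑-upTo-suc (suc a) (λ b → u b (suc a ∸ b))) (cong (λ r → u 0 (suc a) + r) (∑≡anti a (u ∘ suc)))

*ₛ-[] : ∀ f g → (f *ₛ g) [] ≡ f [] * g []
*ₛ-[] f g = ℚ.+-identityʳ _

-- A series is read as a series in the first variable whose coefficients are series in the remaining
-- ones; the product becomes a Cauchy product. Commutativity, associativity and the unit law are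
-- inductions along this equation.
*ₛ-∷ : ∀ f g a α → (f *ₛ g) (a ∷ α) ≡ anti (λ i j → ((f ∘ (i ∷_)) *ₛ (g ∘ (j ∷_))) α) a
*ₛ-∷ f g a α = trans
  (∑-cartesianProductWith (λ b (β , γ) → b ∷ β , (a ∸ b) ∷ γ) (upTo (suc a)) (splits α) (λ (β , γ) → f β * g γ))
  (∑≡anti a (λ i j → ((f ∘ (i ∷_)) *ₛ (g ∘ (j ∷_))) α))

-- Both halves of a split of `α` have the length of `α`. This is what makes `_≈[_]_` a congruence.
*ₛ-cong : ∀ α {f f′ g g′ : PowerSeries} → (∀ β → length β ≡ length α → f β ≡ f′ β) →
  (∀ β → length β ≡ length α → g β ≡ g′ β) → (f *ₛ g) α ≡ (f′ *ₛ g′) α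
*ₛ-cong [] {f} {f′} {g} {g′} p q = trans (*ₛ-[] f g) (trans (cong₂ _*_ (p [] refl) (q [] refl)) (sym (*ₛ-[] f′ g′)))
*ₛ-cong (a ∷ α) {f} {f′} {g} {g′} p q = trans (*ₛ-∷ f g a α)
  (trans (anti-cong a (λ i j → *ₛ-cong α (λ β l → p (i ∷ β) (cong suc l)) (λ β l → q (j ∷ β) (cong suc l))))
         (sym (*ₛ-∷ f′ g′ a α)))

*ₛ-congʳ : ∀ α {f f′ : PowerSeries} (g : PowerSeries) → (∀ β → f β ≡ f′ β) → (f *ₛ g) α ≡ (f′ *ₛ g) α
*ₛ-congʳ α g p = *ₛ-cong α {g = g} {g} (λ β _ → p β) (λ _ _ → refl)

*ₛ-congˡ : ∀ α (f : PowerSeries) {g g′ : PowerSeries} → (∀ β → g β ≡ g′ β) → (f *ₛ g) α ≡ (f *ₛ g′) α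
*ₛ-congˡ α f q = *ₛ-cong α {f} {f} (λ _ _ → refl) (λ β _ → q β)

*ₛ-zeroˡ : ∀ α {f : PowerSeries} (g : PowerSeries) → (∀ β → f β ≡ 0ℚ) → (f *ₛ g) α ≡ 0ℚ
*ₛ-zeroˡ α g p = ∑-zero (splits α) λ {(β , γ)} _ → trans (cong (_* g γ) (p β)) (ℚ.*-zeroˡ (g γ))

*ₛ-zeroʳ : ∀ α (f : PowerSeries) {g : PowerSeries} → (∀ β → g β ≡ 0ℚ) → (f *ₛ g) α ≡ 0ℚ
*ₛ-zeroʳ α f p = ∑-zero (splits α) λ {(β , γ)} _ → trans (cong (f β *_) (p γ)) (ℚ.*-zeroʳ (f β))

*ₛ-comm : ∀ α f g → (f *ₛ g) α ≡ (g *ₛ f) α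
*ₛ-comm [] f g = cong (_+ 0ℚ) (ℚ.*-comm (f []) (g []))
*ₛ-comm (a ∷ α) f g = trans (*ₛ-∷ f g a α)
  (trans (anti-cong a λ i j → *ₛ-comm α (f ∘ (i ∷_)) (g ∘ (j ∷_)))
  (trans (anti-comm a (λ i j → ((g ∘ (j ∷_)) *ₛ (f ∘ (i ∷_))) α)) (sym (*ₛ-∷ g f a α))))

infixl 6 _+ₛ_
_+ₛ_ : PowerSeries → PowerSeries → PowerSeries
(f +ₛ g) α = f α + g α

*ₛ-distribʳ : ∀ α f g h → ((g +ₛ h) *ₛ f) α ≡ (g *ₛ f) α + (h *ₛ f) α
*ₛ-distribʳ α f g h = trans (∑-cong (splits α) (λ (β , γ) → ℚ.*-distribʳ-+ (f γ) (g β) (h β)))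
  (∑-distrib-+ (splits α) (λ (β , γ) → g β * f γ) (λ (β , γ) → h β * f γ))

*ₛ-anti : ∀ b α (u : ℕ → ℕ → PowerSeries) h →
  ((λ β → anti (λ i j → u i j β) b) *ₛ h) α ≡ anti (λ i j → (u i j *ₛ h) α) b
*ₛ-anti zero    α u h = refl
*ₛ-anti (suc b) α u h = trans (*ₛ-distribʳ α h (u 0 (suc b)) (λ β → anti (λ i j → u (suc i) j β) b))
  (cong (λ r → (u 0 (suc b) *ₛ h) α + r) (*ₛ-anti b α (u ∘ suc) h))

*ₛ-antiʳ : ∀ b α h (u : ℕ → ℕ → PowerSeries) →
  (h *ₛ (λ β → anti (λ i j → u i j β) b)) α ≡ anti (λ i j → (h *ₛ u i j) α) b
*ₛ-antiʳ b α h u = trans (*ₛ-comm α h _) (trans (*ₛ-anti b α u h) (anti-cong b λ i j → *ₛ-comm α (u i j) h))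

*ₛ-assoc : ∀ α f g h → ((f *ₛ g) *ₛ h) α ≡ (f *ₛ (g *ₛ h)) α
*ₛ-assoc [] f g h = trans (*ₛ-[] (f *ₛ g) h) (trans (cong (_* h []) (*ₛ-[] f g)) (trans (ℚ.*-assoc (f []) (g []) (h []))
  (sym (trans (*ₛ-[] f (g *ₛ h)) (cong (f [] *_) (*ₛ-[] g h))))))
*ₛ-assoc (a ∷ α) f g h = begin
  ((f *ₛ g) *ₛ h) (a ∷ α)
    ≡⟨ *ₛ-∷ (f *ₛ g) h a α ⟩
  anti (λ b k → (((f *ₛ g) ∘ (b ∷_)) *ₛ (h ∘ (k ∷_))) α) a
    ≡⟨ anti-cong a (λ b k → *ₛ-congʳ α (h ∘ (k ∷_)) (*ₛ-∷ f g b)) ⟩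
  anti (λ b k → ((λ β → anti (λ i j → ((f ∘ (i ∷_)) *ₛ (g ∘ (j ∷_))) β) b) *ₛ (h ∘ (k ∷_))) α) a
    ≡⟨ anti-cong a (λ b k → *ₛ-anti b α (λ i j → (f ∘ (i ∷_)) *ₛ (g ∘ (j ∷_))) (h ∘ (k ∷_))) ⟩
  anti (λ b k → anti (λ i j → (((f ∘ (i ∷_)) *ₛ (g ∘ (j ∷_))) *ₛ (h ∘ (k ∷_))) α) b) a
    ≡⟨ anti-assoc a _ ⟩
  anti (λ i d → anti (λ j k → (((f ∘ (i ∷_)) *ₛ (g ∘ (j ∷_))) *ₛ (h ∘ (k ∷_))) α) d) a
    ≡⟨ anti-cong a (λ i d → anti-cong d (λ j k → *ₛ-assoc α (f ∘ (i ∷_)) (g ∘ (j ∷_)) (h ∘ (k ∷_)))) ⟩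
  anti (λ i d → anti (λ j k → ((f ∘ (i ∷_)) *ₛ ((g ∘ (j ∷_)) *ₛ (h ∘ (k ∷_)))) α) d) a
    ≡⟨ anti-cong a (λ i d → *ₛ-antiʳ d α (f ∘ (i ∷_)) (λ j k → (g ∘ (j ∷_)) *ₛ (h ∘ (k ∷_)))) ⟨
  anti (λ i d → ((f ∘ (i ∷_)) *ₛ (λ β → anti (λ j k → ((g ∘ (j ∷_)) *ₛ (h ∘ (k ∷_))) β) d)) α) a
    ≡⟨ anti-cong a (λ i d → *ₛ-congˡ α (f ∘ (i ∷_)) (*ₛ-∷ g h d)) ⟨
  anti (λ i d → ((f ∘ (i ∷_)) *ₛ ((g *ₛ h) ∘ (d ∷_))) α) a
    ≡⟨ *ₛ-∷ f (g *ₛ h) a α ⟨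
  (f *ₛ (g *ₛ h)) (a ∷ α) ∎
  where open ≡-Reasoning

*ₛ-identityˡ : ∀ α f → (1ₛ *ₛ f) α ≡ f α
*ₛ-identityˡ []      f = trans (*ₛ-[] 1ₛ f) (ℚ.*-identityˡ (f []))
*ₛ-identityˡ (a ∷ α) f = trans (*ₛ-∷ 1ₛ f a α) (head a)
  where
  head : ∀ a → anti (λ i j → ((1ₛ ∘ (i ∷_)) *ₛ (f ∘ (j ∷_))) α) a ≡ f (a ∷ α)
  head zero    = *ₛ-identityˡ α (f ∘ (0 ∷_))
  head (suc a) = trans (cong₂ _+_ (*ₛ-identityˡ α (f ∘ (suc a ∷_)))
    (anti-zero a (λ i j → *ₛ-zeroˡ α {1ₛ ∘ (suc i ∷_)} (f ∘ (j ∷_)) (λ _ → refl)))) (ℚ.+-identityʳ _)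

*ₛ-distribˡ : ∀ α f g h → (f *ₛ (g +ₛ h)) α ≡ (f *ₛ g) α + (f *ₛ h) α
*ₛ-distribˡ α f g h = trans (*ₛ-comm α f (g +ₛ h)) (trans (*ₛ-distribʳ α f g h) (cong₂ _+_ (*ₛ-comm α g f) (*ₛ-comm α h f)))

infix 4 _≈[_]_
-- Fixing the number of variables makes sums over all colours finite, and identities such as `∑x≈e₁`
-- hold only on lists of that length. For each `N` the result is the power series ring in `N`
-- variables.
_≈[_]_ : PowerSeries → ℕ → PowerSeries → Set
f ≈[ N ] g = ∀ α → length α ≡ N → f α ≡ g α

-- The operations are abstract so that the arguments of a sum or a product can be inferred.
abstract

  infix  8 ⊖_
  infixl 7 _⊛_
  infixl 6 _⊕_

  _⊕_ _⊛_ : PowerSeries → PowerSeries → PowerSeries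
  f ⊕ g = f +ₛ g
  f ⊛ g = f *ₛ g

  ⊖_ : PowerSeries → PowerSeries
  (⊖ f) α = - f α

  ⊕-eval : ∀ f g α → (f ⊕ g) α ≡ f α + g α
  ⊕-eval f g α = refl

  ⊛-eval : ∀ f g α → (f ⊛ g) α ≡ (f *ₛ g) α
  ⊛-eval f g α = refl

  ⊖-eval : ∀ f α → (⊖ f) α ≡ - f α
  ⊖-eval f α = refl

  isCommutativeRing : ∀ N → IsCommutativeRing (λ f g → f ≈[ N ] g) _⊕_ _⊛_ ⊖_ 0ₛ 1ₛ
  isCommutativeRing N = record
    { isRing = record
      { +-isAbelianGroup = record
        { isGroup = record
          { isMonoid = record
            { isSemigroup = record
              { isMagma = record
                { isEquivalence = record
                  { refl  = λ _ _ → refl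
                  ; sym   = λ p α l → sym (p α l)
                  ; trans = λ p q α l → trans (p α l) (q α l)
                  }
                ; ∙-cong = λ p q α l → cong₂ _+_ (p α l) (q α l)
                }
              ; assoc = λ f g h α _ → ℚ.+-assoc (f α) (g α) (h α)
              }
            ; identity = (λ f α _ → ℚ.+-identityˡ (f α)) , (λ f α _ → ℚ.+-identityʳ (f α))
            }
          ; inverse = (λ f α _ → ℚ.+-inverseˡ (f α)) , (λ f α _ → ℚ.+-inverseʳ (f α))
          ; ⁻¹-cong = λ p α l → cong -_ (p α l)
          }
        ; comm = λ f g α _ → ℚ.+-comm (f α) (g α)
        }
      ; *-cong = λ p q α l → *ₛ-cong α (λ β l′ → p β (trans l′ l)) (λ β l′ → q β (trans l′ l))
      ; *-assoc = λ f g h α _ → *ₛ-assoc α f g h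
      ; *-identity = (λ f α _ → *ₛ-identityˡ α f) , (λ f α _ → trans (*ₛ-comm α f 1ₛ) (*ₛ-identityˡ α f))
      ; distrib = (λ f g h α _ → *ₛ-distribˡ α f g h) , (λ f g h α _ → *ₛ-distribʳ α f g h)
      }
    ; *-comm = λ f g α _ → *ₛ-comm α f g
    }

seriesRing : ℕ → CommutativeRing _ _
seriesRing N = record { isCommutativeRing = isCommutativeRing N }

-- Arithmetic of integers inside the rationals

ι-+ : ∀ a b → ι (a +ℤ b) ≡ ι a + ι b
-- `_/_` reduces its result to lowest terms, so the identity is checked on unnormalised fractions.
ι-+ a b = ℚ.toℚᵘ-injective (begin
  toℚᵘ (ι (a +ℤ b))           ≈⟨ ℚ.toℚᵘ-fromℚᵘ (ℚᵘ.mkℚᵘ (a +ℤ b) 0) ⟩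
  ℚᵘ.mkℚᵘ (a +ℤ b) 0            ≈⟨ ℚᵘ.*≡* (cong (_*ℤ 1ℤ) (cong₂ _+ℤ_ (ℤ.*-identityʳ a) (ℤ.*-identityʳ b))) ⟨
  ℚᵘ.mkℚᵘ a 0 ℚᵘ.+ ℚᵘ.mkℚᵘ b 0  ≈⟨ ℚᵘ.+-cong (ℚ.toℚᵘ-fromℚᵘ (ℚᵘ.mkℚᵘ a 0)) (ℚ.toℚᵘ-fromℚᵘ (ℚᵘ.mkℚᵘ b 0)) ⟨
  toℚᵘ (ι a) ℚᵘ.+ toℚᵘ (ι b) ≈⟨ ℚ.toℚᵘ-homo-+ (ι a) (ι b) ⟨
  toℚᵘ (ι a + ι b)            ∎)
  where open import Relation.Binary.Reasoning.Setoid ℚᵘ.≃-setoid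

ι-* : ∀ a b → ι (a *ℤ b) ≡ ι a * ι b
ι-* a b = ℚ.toℚᵘ-injective (begin
  toℚᵘ (ι (a *ℤ b))           ≈⟨ ℚ.toℚᵘ-fromℚᵘ (ℚᵘ.mkℚᵘ (a *ℤ b) 0) ⟩
  ℚᵘ.mkℚᵘ a 0 ℚᵘ.* ℚᵘ.mkℚᵘ b 0  ≈⟨ ℚᵘ.*-cong (ℚ.toℚᵘ-fromℚᵘ (ℚᵘ.mkℚᵘ a 0)) (ℚ.toℚᵘ-fromℚᵘ (ℚᵘ.mkℚᵘ b 0)) ⟨
  toℚᵘ (ι a) ℚᵘ.* toℚᵘ (ι b) ≈⟨ ℚ.toℚᵘ-homo-* (ι a) (ι b) ⟨
  toℚᵘ (ι a * ι b)            ∎)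
  where open import Relation.Binary.Reasoning.Setoid ℚᵘ.≃-setoid

fromℕ : ℕ → ℚ
fromℕ n = ι (+ n)

fromℕ-+ : ∀ m n → fromℕ (m +ℕ n) ≡ fromℕ m + fromℕ n
fromℕ-+ m n = ι-+ (+ m) (+ n)

-- Homogeneous series

splits-sum : ∀ α {β γ} → (β , γ) ∈ splits α → sum β +ℕ sum γ ≡ sum α
splits-sum [] (here refl) = refl
splits-sum (a ∷ α) p
  with b , (β , γ) , b∈ , q , refl ← ∈-cartesianProductWith⁻ (λ b (β , γ) → b ∷ β , (a ∸ b) ∷ γ) (upTo (suc a)) (splits α) p = begin
    (b +ℕ sum β) +ℕ ((a ∸ b) +ℕ sum γ) ≡⟨ interchange b (sum β) (a ∸ b) (sum γ) ⟩
    (b +ℕ (a ∸ b)) +ℕ (sum β +ℕ sum γ) ≡⟨ cong₂ _+ℕ_ (ℕ.m+[n∸m]≡n (ℕ.≤-pred (∈-upTo⁻ b∈))) (splits-sum α q) ⟩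
    a +ℕ sum α                         ∎
  where
  open ≡-Reasoning
  open import Algebra.Properties.CommutativeSemigroup ℕ.+-commutativeSemigroup using (interchange)

Homogeneous : ℕ → PowerSeries → Set
Homogeneous d f = ∀ α → sum α ≢ d → f α ≡ 0ℚ

-- A homogeneous factor of degree `d` meets only those coefficients of the other factor that lie in
-- degree `sum α` minus `d`.
homogeneous-*-cong : ∀ {d g} α (f f′ : PowerSeries) → Homogeneous d g → (∀ γ → d +ℕ sum γ ≡ sum α → f γ ≡ f′ γ) →
  (g *ₛ f) α ≡ (g *ₛ f′) α
homogeneous-*-cong {d} {g} α f f′ hom h = ∑-cong-∈ (splits α) step
  where
  step : ∀ {p} → p ∈ splits α → g (proj₁ p) * f (proj₂ p) ≡ g (proj₁ p) * f′ (proj₂ p)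
  step {β , γ} p with sum β ℕ.≟ d
  ... | yes refl = cong (g β *_) (h γ (splits-sum α p))
  ... | no ≢d    = trans (cong (_* f γ) (hom β ≢d))
    (trans (ℚ.*-zeroˡ (f γ)) (sym (trans (cong (_* f′ γ) (hom β ≢d)) (ℚ.*-zeroˡ (f′ γ)))))

homogeneous-*-zero : ∀ {d g} α (f : PowerSeries) → Homogeneous d g → (∀ γ → d +ℕ sum γ ≡ sum α → f γ ≡ 0ℚ) → (g *ₛ f) α ≡ 0ℚ
homogeneous-*-zero {d} {g} α f hom h = trans (homogeneous-*-cong α f 0ₛ hom h) (*ₛ-zeroʳ α g (λ _ → refl))

homogeneous-* : ∀ {p q f g} → Homogeneous p f → Homogeneous q g → Homogeneous (p +ℕ q) (f *ₛ g)
homogeneous-* {p} {q} {f} {g} hf hg α ≢pq =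
  homogeneous-*-zero α g hf (λ γ eq → hg γ (λ eq′ → ≢pq (trans (sym eq) (cong (p +ℕ_) eq′))))

eval-∑ : ∀ {A : Set} N (xs : List A) (f : A → PowerSeries) α → ListSum.∑ᴿ (seriesRing N) xs f α ≡ ∑ xs (λ x → f x α)
eval-∑ N []       f α = refl
eval-∑ N (x ∷ xs) f α = trans (⊕-eval (f x) _ α) (cong (λ r → f x α + r) (eval-∑ N xs f α))

homogeneous-∑ : ∀ {A : Set} N d (xs : List A) (f : A → PowerSeries) → (∀ x → Homogeneous d (f x)) →
  Homogeneous d (ListSum.∑ᴿ (seriesRing N) xs f)
homogeneous-∑ N d xs f h α ≢d = trans (eval-∑ N xs f α) (∑-zero xs (λ {x} _ → h x α ≢d))

homogeneous-1 : Homogeneous 0 1ₛ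
homogeneous-1 []          ≢0 = ⊥-elim (≢0 refl)
homogeneous-1 (zero ∷ α)  ≢0 = homogeneous-1 α ≢0
homogeneous-1 (suc a ∷ α) ≢0 = refl

homogeneous-e : ∀ k → Homogeneous k (e k)
homogeneous-e k α ≢k = cong (λ b → if b then 1ℚ else 0ℚ)
  (dec-false (allList? (_≤? 1) α ×-dec (sum α ℕ.≟ k)) (λ (_ , eq) → ≢k eq))

-- The variables and the series Σ eₖ

var : ℕ → PowerSeries
var i       []                = 0ℚ
var zero    (zero ∷ α)        = 0ℚ
var zero    (suc zero ∷ α)    = 1ₛ α
var zero    (suc (suc a) ∷ α) = 0ℚ
var (suc i) (zero ∷ α)        = var i α
var (suc i) (suc a ∷ α)       = 0ℚ

-- The coefficient of the `i`-th variable times `f`, written without a sum over splits.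
lower : ℕ → PowerSeries → PowerSeries
lower i       f []          = 0ℚ
lower zero    f (zero ∷ α)  = 0ℚ
lower zero    f (suc a ∷ α) = f (a ∷ α)
lower (suc i) f (a ∷ α)     = lower i (f ∘ (a ∷_)) α

var-* : ∀ i f α → (var i *ₛ f) α ≡ lower i f α
var-* i       f []      = trans (*ₛ-[] (var i) f) (ℚ.*-zeroˡ (f []))
var-* zero    f (a ∷ α) = trans (*ₛ-∷ (var 0) f a α) (go a)
  where
  go : ∀ a → anti (λ i j → ((var 0 ∘ (i ∷_)) *ₛ (f ∘ (j ∷_))) α) a ≡ lower zero f (a ∷ α)
  go zero          = *ₛ-zeroˡ α (f ∘ (0 ∷_)) (λ _ → refl)
  go (suc zero)    = trans (cong₂ _+_ (*ₛ-zeroˡ α (f ∘ (1 ∷_)) (λ _ → refl)) (*ₛ-identityˡ α (f ∘ (0 ∷_)))) (ℚ.+-identityˡ _)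
  go (suc (suc a)) = trans (cong₂ _+_ (*ₛ-zeroˡ α (f ∘ (suc (suc a) ∷_)) (λ _ → refl))
    (cong₂ _+_ (*ₛ-identityˡ α (f ∘ (suc a ∷_))) (anti-zero a (λ i j → *ₛ-zeroˡ α (f ∘ (j ∷_)) (λ _ → refl)))))
    (trans (ℚ.+-identityˡ _) (ℚ.+-identityʳ _))
var-* (suc i) f (a ∷ α) = trans (*ₛ-∷ (var (suc i)) f a α) (go a)
  where
  go : ∀ a → anti (λ k j → ((var (suc i) ∘ (k ∷_)) *ₛ (f ∘ (j ∷_))) α) a ≡ lower i (f ∘ (a ∷_)) α
  go zero    = var-* i (f ∘ (0 ∷_)) α
  go (suc a) = trans (cong₂ _+_ (var-* i (f ∘ (suc a ∷_)) α) (anti-zero a (λ k j → *ₛ-zeroˡ α (f ∘ (j ∷_)) (λ _ → refl))))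
                     (ℚ.+-identityʳ _)

homogeneous-var : ∀ i → Homogeneous 1 (var i)
homogeneous-var i       []                ≢1 = refl
homogeneous-var zero    (zero ∷ α)        ≢1 = refl
homogeneous-var zero    (suc zero ∷ α)    ≢1 = homogeneous-1 α (≢1 ∘ cong suc)
homogeneous-var zero    (suc (suc a) ∷ α) ≢1 = refl
homogeneous-var (suc i) (zero ∷ α)        ≢1 = homogeneous-var i α ≢1
homogeneous-var (suc i) (suc a ∷ α)       ≢1 = refl

E : PowerSeries
E α = if does (allList? (_≤? 1) α) then 1ℚ else 0ℚ

sign : ℕ → ℚ
sign zero    = 1ℚ
sign (suc n) = - sign n

-- The product of all `1 / (1 + x_i)`: a variable with exponent `a` contributes the sign `(-1)^a`.
E⁻¹ : PowerSeries
E⁻¹ α = sign (sum α)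

E-inverse : ∀ α → (E *ₛ E⁻¹) α ≡ 1ₛ α
E-inverse []      = refl
E-inverse (a ∷ α) = trans (*ₛ-∷ E E⁻¹ a α) (go a)
  where
  -- `E` contains the first variable with exponents 0 and 1 only, and the two contributions carry
  -- opposite signs.
  cancel : ∀ a → (E *ₛ (E⁻¹ ∘ (suc a ∷_))) α + (E *ₛ (E⁻¹ ∘ (a ∷_))) α ≡ 0ℚ
  cancel a = trans (sym (*ₛ-distribˡ α E (E⁻¹ ∘ (suc a ∷_)) (E⁻¹ ∘ (a ∷_))))
    (*ₛ-zeroʳ α E (λ β → ℚ.+-inverseˡ (sign (a +ℕ sum β))))
  go : ∀ a → anti (λ i j → ((E ∘ (i ∷_)) *ₛ (E⁻¹ ∘ (j ∷_))) α) a ≡ 1ₛ (a ∷ α)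
  go zero          = E-inverse α
  go (suc zero)    = cancel 0
  go (suc (suc a)) = trans (cong (λ r → (E *ₛ (E⁻¹ ∘ (suc (suc a) ∷_))) α + ((E *ₛ (E⁻¹ ∘ (suc a ∷_))) α + r))
    (anti-zero a (λ i j → *ₛ-zeroˡ α (E⁻¹ ∘ (j ∷_)) (λ _ → refl))))
    (trans (cong (λ r → (E *ₛ (E⁻¹ ∘ (suc (suc a) ∷_))) α + r) (ℚ.+-identityʳ _)) (cancel (suc a)))

-- The terms of E that are divisible by the i-th variable.
E∋ : ℕ → PowerSeries
E∋ i       []                = 0ℚ
E∋ zero    (zero ∷ α)        = 0ℚ
E∋ zero    (suc zero ∷ α)    = E α
E∋ zero    (suc (suc a) ∷ α) = 0ℚ
E∋ (suc i) (zero ∷ α)        = E∋ i α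
E∋ (suc i) (suc zero ∷ α)    = E∋ i α
E∋ (suc i) (suc (suc a) ∷ α) = 0ℚ

lower-zero : ∀ i α {f : PowerSeries} → (∀ β → f β ≡ 0ℚ) → lower i f α ≡ 0ℚ
lower-zero i       []          h = refl
lower-zero zero    (zero ∷ α)  h = refl
lower-zero zero    (suc a ∷ α) h = h (a ∷ α)
lower-zero (suc i) (a ∷ α)     h = lower-zero i α (h ∘ (a ∷_))

-- `E∋ i` is `x_i` times the product of the other factors `1 + x_j`, hence `(1 + x_i) E∋ i = x_i E`.
E∋-var : ∀ i α → E∋ i α + lower i (E∋ i) α ≡ lower i E α
E∋-var i       []                      = refl
E∋-var zero    (zero ∷ α)              = refl
E∋-var zero    (suc zero ∷ α)          = ℚ.+-identityʳ _
E∋-var zero    (suc (suc zero) ∷ α)    = ℚ.+-identityˡ _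
E∋-var zero    (suc (suc (suc a)) ∷ α) = refl
E∋-var (suc i) (zero ∷ α)              = E∋-var i α
E∋-var (suc i) (suc zero ∷ α)          = E∋-var i α
E∋-var (suc i) (suc (suc a) ∷ α)       = trans (ℚ.+-identityˡ _)
  (trans (lower-zero i α {E∋ (suc i) ∘ (suc (suc a) ∷_)} (λ _ → refl)) (sym (lower-zero i α {E ∘ (suc (suc a) ∷_)} (λ _ → refl))))

D : PowerSeries → PowerSeries
D f α = fromℕ (sum α) * f α

-- The degrees of the two halves of a split add up to the degree of `α`, which gives the Leibniz
-- rule term by term.
D-* : ∀ α f g → D (f *ₛ g) α ≡ (D f *ₛ g) α + (f *ₛ D g) α
D-* α f g = begin
  fromℕ (sum α) * ∑ (splits α) (λ (β , γ) → f β * g γ)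
    ≡⟨ *-distribˡ-∑ (splits α) (fromℕ (sum α)) (λ (β , γ) → f β * g γ) ⟩
  ∑ (splits α) (λ (β , γ) → fromℕ (sum α) * (f β * g γ))
    ≡⟨ ∑-cong-∈ (splits α) (λ {(β , γ)} p → trans
         (cong (λ n → n * (f β * g γ)) (trans (cong fromℕ (sym (splits-sum α p))) (fromℕ-+ (sum β) (sum γ))))
         (leibniz (fromℕ (sum β)) (fromℕ (sum γ)) (f β) (g γ))) ⟩
  ∑ (splits α) (λ (β , γ) → D f β * g γ + f β * D g γ)
    ≡⟨ ∑-distrib-+ (splits α) (λ (β , γ) → D f β * g γ) (λ (β , γ) → f β * D g γ) ⟩
  (D f *ₛ g) α + (f *ₛ D g) α ∎
  where
  open ≡-Reasoning
  open Data.Rational.Solver.+-*-Solver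
  leibniz : ∀ m n p q → (m + n) * (p * q) ≡ m * p * q + p * (n * q)
  leibniz = solve 4 (λ m n p q → (m :+ n) :* (p :* q) := m :* p :* q :+ p :* (n :* q)) refl

-- A squarefree monomial of degree d is divisible by exactly d variables, so the sum counts it d
-- times.
∑-E∋ : ∀ α → ∑ (allFin (length α)) (λ i → E∋ (toℕ i) α) ≡ D E α
∑-E∋ []                = refl
∑-E∋ (zero ∷ α)        = trans (∑-allFin-suc (length α) (λ i → E∋ (toℕ i) (zero ∷ α))) (trans (ℚ.+-identityˡ _) (∑-E∋ α))
∑-E∋ (suc zero ∷ α)    = trans (∑-allFin-suc (length α) (λ i → E∋ (toℕ i) (1 ∷ α))) (begin
  E α + ∑ (allFin (length α)) (λ i → E∋ (toℕ i) α) ≡⟨ cong (λ r → E α + r) (∑-E∋ α) ⟩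
  E α + fromℕ (sum α) * E α                        ≡⟨ cong (λ r → r + fromℕ (sum α) * E α) (sym (ℚ.*-identityˡ (E α))) ⟩
  1ℚ * E α + fromℕ (sum α) * E α                   ≡⟨ sym (ℚ.*-distribʳ-+ (E α) 1ℚ (fromℕ (sum α))) ⟩
  (1ℚ + fromℕ (sum α)) * E α                       ≡⟨ cong (_* E α) (sym (fromℕ-+ 1 (sum α))) ⟩
  fromℕ (suc (sum α)) * E α                        ∎)
  where open ≡-Reasoning
∑-E∋ (suc (suc a) ∷ α) = trans (∑-allFin-suc (length α) (λ i → E∋ (toℕ i) (suc (suc a) ∷ α)))
  (trans (ℚ.+-identityˡ _) (trans (∑-zero (allFin (length α)) (λ _ → refl)) (sym (ℚ.*-zeroʳ (fromℕ (suc (suc a) +ℕ sum α))))))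

D-var : ∀ i α → D (var i) α ≡ var i α
D-var i α = go (sum α ℕ.≟ 1)
  where
  go : Dec (sum α ≡ 1) → D (var i) α ≡ var i α
  go (yes eq) = trans (cong (λ n → fromℕ n * var i α) eq) (ℚ.*-identityˡ (var i α))
  go (no ≢1)  = trans (cong (fromℕ (sum α) *_) (homogeneous-var i α ≢1))
    (trans (ℚ.*-zeroʳ (fromℕ (sum α))) (sym (homogeneous-var i α ≢1)))

e-suc-1 : ∀ α → e 0 (1 ∷ α) ≡ 0ℚ
e-suc-1 α = cong (λ b → if b then 1ℚ else 0ℚ) (∧-zeroʳ (does (allList? (_≤? 1) α)))

e₀ : ∀ α → e 0 α ≡ 1ₛ α
e₀ []                = refl
e₀ (zero ∷ α)        = e₀ α
e₀ (suc zero ∷ α)    = e-suc-1 α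
e₀ (suc (suc a) ∷ α) = refl

e₁ : ∀ α → e 1 α ≡ ∑ (allFin (length α)) (λ i → var (toℕ i) α)
e₁ []                = refl
e₁ (zero ∷ α)        = trans (e₁ α) (sym (trans (∑-allFin-suc (length α) (λ i → var (toℕ i) (0 ∷ α))) (ℚ.+-identityˡ _)))
e₁ (suc zero ∷ α)    = trans (e₀ α) (sym (trans (∑-allFin-suc (length α) (λ i → var (toℕ i) (1 ∷ α)))
  (trans (cong (λ r → 1ₛ α + r) (∑-zero (allFin (length α)) (λ _ → refl))) (ℚ.+-identityʳ _))))
e₁ (suc (suc a) ∷ α) = sym (trans (∑-allFin-suc (length α) (λ i → var (toℕ i) (suc (suc a) ∷ α)))
  (trans (ℚ.+-identityˡ _) (∑-zero (allFin (length α)) (λ _ → refl))))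

-- Exponent 0 of the first variable leaves the identity for the other variables, exponent 1 gives
-- two mixed products, exponent 2 only the square of the first variable, and larger exponents give
-- nothing.
e₁*e₁ : ∀ α → (e 1 *ₛ e 1) α ≡ ∑ (allFin (length α)) (λ i → (var (toℕ i) *ₛ var (toℕ i)) α) + (e 2 α + e 2 α)
e₁*e₁ []      = refl
e₁*e₁ (a ∷ α) = trans (*ₛ-∷ (e 1) (e 1) a α) (trans (left a) (sym (cong (λ r → r + (e 2 (a ∷ α) + e 2 (a ∷ α))) (squares a))))
  where
  firstSquare : ℕ → ℚ
  firstSquare 2 = 1ₛ α
  firstSquare _ = 0ℚ
  otherSquares : ℕ → ℚ
  otherSquares 0       = ∑ (allFin (length α)) (λ i → (var (toℕ i) *ₛ var (toℕ i)) α)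
  otherSquares (suc _) = 0ℚ
  squares : ∀ a → ∑ (allFin (length (a ∷ α))) (λ i → (var (toℕ i) *ₛ var (toℕ i)) (a ∷ α)) ≡ firstSquare a + otherSquares a
  squares a = trans (∑-allFin-suc (length α) (λ i → (var (toℕ i) *ₛ var (toℕ i)) (a ∷ α)))
    (cong₂ _+_ (trans (var-* 0 (var 0) (a ∷ α)) (first a)) (others a))
    where
    first : ∀ a → lower 0 (var 0) (a ∷ α) ≡ firstSquare a
    first 0                   = refl
    first 1                   = refl
    first 2                   = refl
    first (suc (suc (suc a))) = refl
    others : ∀ a → ∑ (allFin (length α)) (λ i → (var (suc (toℕ i)) *ₛ var (suc (toℕ i))) (a ∷ α)) ≡ otherSquares a
    others 0       = ∑-cong (allFin (length α)) λ i →
      trans (var-* (suc (toℕ i)) (var (suc (toℕ i))) (0 ∷ α)) (sym (var-* (toℕ i) (var (toℕ i)) α))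
    others (suc a) = ∑-zero (allFin (length α)) λ {i} _ →
      trans (var-* (suc (toℕ i)) (var (suc (toℕ i))) (suc a ∷ α)) (lower-zero (toℕ i) α (λ _ → refl))
  e₀* : ∀ f → ((e 1 ∘ (1 ∷_)) *ₛ f) α ≡ f α
  e₀* f = trans (*ₛ-congʳ α f e₀) (*ₛ-identityˡ α f)
  left : ∀ a → anti (λ i j → ((e 1 ∘ (i ∷_)) *ₛ (e 1 ∘ (j ∷_))) α) a ≡ (firstSquare a + otherSquares a) + (e 2 (a ∷ α) + e 2 (a ∷ α))
  left 0 = trans (e₁*e₁ α) (cong (λ r → r + (e 2 α + e 2 α)) (sym (ℚ.+-identityˡ (otherSquares 0))))
  left 1 = trans (cong₂ _+_ (trans (*ₛ-comm α (e 1) (e 1 ∘ (1 ∷_))) (e₀* (e 1))) (e₀* (e 1))) (sym (ℚ.+-identityˡ _))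
  left 2 = trans (cong₂ _+_ (*ₛ-zeroʳ α (e 1) (λ _ → refl)) (cong₂ _+_ (trans (e₀* (e 1 ∘ (1 ∷_))) (e₀ α))
    (*ₛ-zeroˡ α {e 1 ∘ (2 ∷_)} (e 1) (λ _ → refl))))
    (trans (ℚ.+-identityˡ (1ₛ α + 0ℚ)) (sym (ℚ.+-identityʳ (1ₛ α + 0ℚ))))
  left (suc (suc (suc a))) = trans (cong₂ _+_ (*ₛ-zeroʳ α (e 1) (λ _ → refl))
    (cong₂ _+_ (*ₛ-zeroʳ α (e 1 ∘ (1 ∷_)) (λ _ → refl))
      (anti-zero (suc a) (λ i j → *ₛ-zeroˡ α {e 1 ∘ (suc (suc i) ∷_)} (e 1 ∘ (j ∷_)) (λ _ → refl))))) refl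

-- Integer scalars and a ring solver for series

⟪_⟫ : ℤ → PowerSeries
⟪ z ⟫ α = ι z * 1ₛ α

·ₛ-* : ∀ α q f g → ((q ·ₛ f) *ₛ g) α ≡ q * (f *ₛ g) α
·ₛ-* α q f g = trans (∑-cong (splits α) (λ (β , γ) → ℚ.*-assoc q (f β) (g γ)))
  (sym (*-distribˡ-∑ (splits α) q (λ (β , γ) → f β * g γ)))

⟪⟫-⊛ : ∀ α z f → (⟪ z ⟫ ⊛ f) α ≡ ι z * f α
⟪⟫-⊛ α z f = trans (trans (⊛-eval ⟪ z ⟫ f α) (·ₛ-* α (ι z) 1ₛ f)) (cong (ι z *_) (*ₛ-identityˡ α f))

ι-neg : ∀ a → ι (-ℤ a) ≡ - ι a
ι-neg a = uniqueʳ-⁻¹ (ι a) (ι (-ℤ a)) (trans (sym (ι-+ a (-ℤ a))) (cong ι (ℤ.+-inverseʳ a)))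
  where
  open CommutativeRing ℚ.+-*-commutativeRing using (+-group)
  open import Algebra.Properties.Group +-group renaming (inverseʳ-unique to uniqueʳ-⁻¹)

weakEq : ∀ N (a b : ℤ) → Maybe (⟪ a ⟫ ≈[ N ] ⟪ b ⟫)
weakEq N a b = mapMaybe (λ eq α _ → cong (λ z → ⟪ z ⟫ α) eq) (dec⇒maybe (a ℤ.≟ b))

-- Coefficients in the integers have decidable equality, so the solver can collect constants such as
-- 2 or 8 and cancel terms.
scalars : ∀ N → Data.Integer.+-*-rawRing ACR.-Raw-AlmostCommutative⟶ ACR.fromCommutativeRing (seriesRing N)
scalars N = record
  { ⟦_⟧    = ⟪_⟫
  ; +-homo = λ a b α _ → trans (cong (_* 1ₛ α) (ι-+ a b)) (trans (ℚ.*-distribʳ-+ (1ₛ α) (ι a) (ι b)) (sym (⊕-eval ⟪ a ⟫ ⟪ b ⟫ α)))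
  ; *-homo = λ a b α _ → trans (cong (_* 1ₛ α) (ι-* a b)) (trans (ℚ.*-assoc (ι a) (ι b) (1ₛ α)) (sym (⟪⟫-⊛ α a ⟪ b ⟫)))
  ; -‿homo = λ a α _ → trans (cong (_* 1ₛ α) (ι-neg a)) (trans (sym (ℚ.neg-distribˡ-* (ι a) (1ₛ α))) (sym (⊖-eval ⟪ a ⟫ α)))
  ; 0-homo = λ α _ → ℚ.*-zeroˡ (1ₛ α)
  ; 1-homo = λ α _ → ℚ.*-identityˡ (1ₛ α)
  }

module SeriesSolver (N : ℕ) where
  open import Algebra.Solver.Ring Data.Integer.+-*-rawRing (ACR.fromCommutativeRing (seriesRing N)) (scalars N) (weakEq N) public

-- Indicators, the series `y` and their sums

module Words (N : ℕ) where

  module R = CommutativeRing (seriesRing N)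
  module S = ListSum (seriesRing N)
  open R using (_≈_)
  open SeriesSolver N using (solve; _:=_; _:+_; _:*_; :-_; con)
  open import Relation.Binary.Reasoning.Setoid R.setoid

  Colour : Set
  Colour = Fin N

  ∑ₛ : (Colour → PowerSeries) → PowerSeries
  ∑ₛ = S.∑ᴿ (allFin N)

  ∑ₛ-cong : {f g : Colour → PowerSeries} → (∀ i → f i ≈ g i) → ∑ₛ f ≈ ∑ₛ g
  ∑ₛ-cong = S.∑-cong (allFin N)

  ∑ₛ-+ : (f g : Colour → PowerSeries) → ∑ₛ (λ i → f i ⊕ g i) ≈ ∑ₛ f ⊕ ∑ₛ g
  ∑ₛ-+ = S.∑-distrib-+ (allFin N)

  *-∑ₛ : (c : PowerSeries) (f : Colour → PowerSeries) → c ⊛ ∑ₛ f ≈ ∑ₛ (λ i → c ⊛ f i)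
  *-∑ₛ = S.*-distribˡ-∑ (allFin N)

  ∑ₛ-linear₂ : ∀ c d (f g : Colour → PowerSeries) → ∑ₛ (λ i → c ⊛ f i ⊕ d ⊛ g i) ≈ c ⊛ ∑ₛ f ⊕ d ⊛ ∑ₛ g
  ∑ₛ-linear₂ c d f g = R.trans (∑ₛ-+ (λ i → c ⊛ f i) (λ i → d ⊛ g i)) (R.+-cong (R.sym (*-∑ₛ c f)) (R.sym (*-∑ₛ d g)))

  ∑ₛ-linear₃ : ∀ b c d (f g h : Colour → PowerSeries) →
    ∑ₛ (λ i → b ⊛ f i ⊕ (c ⊛ g i ⊕ d ⊛ h i)) ≈ b ⊛ ∑ₛ f ⊕ (c ⊛ ∑ₛ g ⊕ d ⊛ ∑ₛ h)
  ∑ₛ-linear₃ b c d f g h = R.trans (∑ₛ-+ (λ i → b ⊛ f i) (λ i → c ⊛ g i ⊕ d ⊛ h i)) (R.+-cong (R.sym (*-∑ₛ b f)) (∑ₛ-linear₂ c d g h))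

  ∑ₛ-linear₄ : ∀ a b c d (f g h k : Colour → PowerSeries) →
    ∑ₛ (λ i → a ⊛ f i ⊕ (b ⊛ g i ⊕ (c ⊛ h i ⊕ d ⊛ k i))) ≈ a ⊛ ∑ₛ f ⊕ (b ⊛ ∑ₛ g ⊕ (c ⊛ ∑ₛ h ⊕ d ⊛ ∑ₛ k))
  ∑ₛ-linear₄ a b c d f g h k = R.trans (∑ₛ-+ (λ i → a ⊛ f i) (λ i → b ⊛ g i ⊕ (c ⊛ h i ⊕ d ⊛ k i)))
    (R.+-cong (R.sym (*-∑ₛ a f)) (∑ₛ-linear₃ b c d g h k))

  -- An identity f ≈ g modulo a relation z ≈ 0 is proved by the solver with an explicit cofactor m.
  modulo : ∀ m {f g z : PowerSeries} → z ≈ 0ₛ → f ≈ g ⊕ m ⊛ z → f ≈ g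
  modulo m {f} {g} z≈0 eq = R.trans eq (R.trans (R.+-congˡ (R.trans (R.*-congˡ z≈0) (R.zeroʳ m))) (R.+-identityʳ g))

  ≈⇒-≈0 : ∀ {f g : PowerSeries} → f ≈ g → f ⊕ ⊖ g ≈ 0ₛ
  ≈⇒-≈0 {f} {g} eq = R.trans (R.+-congʳ eq) (R.-‿inverseʳ g)

  𝟙 : {A : Set} → Dec A → PowerSeries
  𝟙 d = if does d then 1ₛ else 0ₛ

  𝟙-idem : {A : Set} (d : Dec A) → 𝟙 d ⊛ 𝟙 d ≈ 𝟙 d
  𝟙-idem d with does d
  ... | true  = R.*-identityˡ 1ₛ
  ... | false = R.zeroˡ 0ₛ

  𝟙-compl : {A : Set} (d : Dec A) → 𝟙 d ⊕ 𝟙 (¬? d) ≈ 1ₛ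
  𝟙-compl d with does d
  ... | true  = R.+-identityʳ 1ₛ
  ... | false = R.+-identityˡ 1ₛ

  𝟙-disjoint : {A : Set} (d : Dec A) → 𝟙 d ⊛ 𝟙 (¬? d) ≈ 0ₛ
  𝟙-disjoint d with does d
  ... | true  = R.zeroʳ 1ₛ
  ... | false = R.zeroˡ 1ₛ

  δ η : ∀ {n} → Fin n → Fin n → PowerSeries
  δ i j = 𝟙 (i ≟ᶠ j)
  η i j = 𝟙 (¬? (i ≟ᶠ j))

  -- With the omitted term added rather than subtracted, the identity inducts on the number of
  -- colours and later serves as a relation for `modulo`.
  ∑-η : ∀ {n} (i : Fin n) (f : Fin n → PowerSeries) → S.∑ᴿ (allFin n) (λ k → η i k ⊛ f k) ⊕ f i ≈ S.∑ᴿ (allFin n) f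
  ∑-η {suc n} zero f = begin
    S.∑ᴿ (allFin (suc n)) (λ k → η zero k ⊛ f k) ⊕ f zero
      ≈⟨ R.+-congʳ (S.∑-allFin-suc n (λ k → η zero k ⊛ f k)) ⟩
    (0ₛ ⊛ f zero ⊕ S.∑ᴿ (allFin n) (λ k → 1ₛ ⊛ f (suc k))) ⊕ f zero
      ≈⟨ R.+-congʳ (R.+-cong (R.zeroˡ (f zero)) (S.∑-cong (allFin n) (λ k → R.*-identityˡ (f (suc k))))) ⟩
    (0ₛ ⊕ S.∑ᴿ (allFin n) (f ∘ suc)) ⊕ f zero
      ≈⟨ R.+-congʳ (R.+-identityˡ _) ⟩
    S.∑ᴿ (allFin n) (f ∘ suc) ⊕ f zero
      ≈⟨ R.+-comm _ (f zero) ⟩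
    f zero ⊕ S.∑ᴿ (allFin n) (f ∘ suc)
      ≈⟨ S.∑-allFin-suc n f ⟨
    S.∑ᴿ (allFin (suc n)) f ∎
  ∑-η {suc n} (suc i) f = begin
    S.∑ᴿ (allFin (suc n)) (λ k → η (suc i) k ⊛ f k) ⊕ f (suc i)
      ≈⟨ R.+-congʳ (S.∑-allFin-suc n (λ k → η (suc i) k ⊛ f k)) ⟩
    (1ₛ ⊛ f zero ⊕ S.∑ᴿ (allFin n) (λ k → η i k ⊛ f (suc k))) ⊕ f (suc i)
      ≈⟨ R.+-assoc (1ₛ ⊛ f zero) _ (f (suc i)) ⟩
    1ₛ ⊛ f zero ⊕ (S.∑ᴿ (allFin n) (λ k → η i k ⊛ f (suc k)) ⊕ f (suc i))
      ≈⟨ R.+-cong (R.*-identityˡ (f zero)) (∑-η i (f ∘ suc)) ⟩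
    f zero ⊕ S.∑ᴿ (allFin n) (f ∘ suc)
      ≈⟨ S.∑-allFin-suc n f ⟨
    S.∑ᴿ (allFin (suc n)) f ∎

  ∑-δ : ∀ (i : Colour) (f : Colour → PowerSeries) → ∑ₛ (λ k → δ i k ⊛ f k) ≈ f i
  ∑-δ i f = R.trans (R.sym (cancelled (∑ₛ λ k → δ i k ⊛ f k) (∑ₛ λ k → η i k ⊛ f k)))
    (R.trans (R.+-congʳ (R.trans (R.sym (∑ₛ-+ (λ k → δ i k ⊛ f k) (λ k → η i k ⊛ f k)))
      (∑ₛ-cong λ k → R.trans (R.sym (R.distribʳ (f k) (δ i k) (η i k))) (R.trans (R.*-congʳ (𝟙-compl (i ≟ᶠ k))) (R.*-identityˡ (f k))))))
    (R.trans (R.+-congʳ (R.sym (∑-η i f))) (rest (∑ₛ λ k → η i k ⊛ f k) (f i))))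
    where
    cancelled : ∀ a b → (a ⊕ b) ⊕ ⊖ b ≈ a
    cancelled = solve 2 (λ a b → (a :+ b) :+ :- b := a) R.refl
    rest : ∀ b c → (b ⊕ c) ⊕ ⊖ b ≈ c
    rest = solve 2 (λ b c → (b :+ c) :+ :- b := c) R.refl

  var-⊛ : ∀ i f α → (var i ⊛ f) α ≡ lower i f α
  var-⊛ i f α = trans (⊛-eval (var i) f α) (var-* i f α)

  -- Since `E∋ i / E = x i / (1 + x i)`, the inverse of the single series `E` provides all the
  -- `y i`.
  x y : Colour → PowerSeries
  x i = var (toℕ i)
  y i = E∋ (toℕ i) ⊛ E⁻¹

  E*E⁻¹ : E ⊛ E⁻¹ ≈ 1ₛ
  E*E⁻¹ α _ = trans (⊛-eval E E⁻¹ α) (E-inverse α)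

  y-relation : ∀ i → y i ⊕ x i ⊛ y i ≈ x i
  y-relation i = begin
    E∋ (toℕ i) ⊛ E⁻¹ ⊕ x i ⊛ (E∋ (toℕ i) ⊛ E⁻¹) ≈⟨ solve 3 (λ m u v → m :* v :+ u :* (m :* v) := (m :+ u :* m) :* v) R.refl (E∋ (toℕ i)) (x i) E⁻¹ ⟩
    (E∋ (toℕ i) ⊕ x i ⊛ E∋ (toℕ i)) ⊛ E⁻¹        ≈⟨ R.*-congʳ (λ α _ → trans (trans (⊕-eval (E∋ (toℕ i)) (x i ⊛ E∋ (toℕ i)) α) (cong (λ r → E∋ (toℕ i) α + r) (var-⊛ (toℕ i) (E∋ (toℕ i)) α)))
                                                        (trans (E∋-var (toℕ i) α) (sym (var-⊛ (toℕ i) E α)))) ⟩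
    (x i ⊛ E) ⊛ E⁻¹                               ≈⟨ R.*-assoc (x i) E E⁻¹ ⟩
    x i ⊛ (E ⊛ E⁻¹)                               ≈⟨ R.*-congˡ E*E⁻¹ ⟩
    x i ⊛ 1ₛ                                       ≈⟨ R.*-identityʳ (x i) ⟩
    x i                                             ∎

  s B p₂ : PowerSeries
  s  = ∑ₛ y
  B  = ∑ₛ λ i → y i ⊛ y i
  p₂ = ∑ₛ λ i → x i ⊛ x i

  E*y : ∀ i → E ⊛ y i ≈ E∋ (toℕ i)
  E*y i = begin
    E ⊛ (E∋ (toℕ i) ⊛ E⁻¹) ≈⟨ solve 3 (λ m u v → u :* (m :* v) := m :* (u :* v)) R.refl (E∋ (toℕ i)) E E⁻¹ ⟩
    E∋ (toℕ i) ⊛ (E ⊛ E⁻¹) ≈⟨ R.*-congˡ E*E⁻¹ ⟩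
    E∋ (toℕ i) ⊛ 1ₛ         ≈⟨ R.*-identityʳ (E∋ (toℕ i)) ⟩
    E∋ (toℕ i)               ∎

  E*s : E ⊛ s ≈ D E
  E*s = R.trans (*-∑ₛ E y) (R.trans (∑ₛ-cong E*y) (λ { α refl → trans (eval-∑ N (allFin N) (λ i → E∋ (toℕ i)) α) (∑-E∋ α) }))

  ∑x≈e₁ : ∑ₛ x ≈ e 1
  ∑x≈e₁ α refl = trans (eval-∑ N (allFin N) x α) (sym (e₁ α))

  e₁²≈p₂+2e₂ : e 1 ⊛ e 1 ≈ p₂ ⊕ (e 2 ⊕ e 2)
  e₁²≈p₂+2e₂ α refl = trans (⊛-eval (e 1) (e 1) α) (trans (e₁*e₁ α) (sym (trans (⊕-eval p₂ (e 2 ⊕ e 2) α)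
    (cong₂ _+_ (trans (eval-∑ N (allFin N) (λ i → x i ⊛ x i) α) (∑-cong (allFin N) (λ i → ⊛-eval (x i) (x i) α))) (⊕-eval (e 2) (e 2) α)))))

  D-cong : ∀ {f g : PowerSeries} → f ≈ g → D f ≈ D g
  D-cong eq α l = cong (fromℕ (sum α) *_) (eq α l)

  D-⊛ : ∀ f g → D (f ⊛ g) ≈ D f ⊛ g ⊕ f ⊛ D g
  D-⊛ f g α _ = trans (cong (fromℕ (sum α) *_) (⊛-eval f g α)) (trans (D-* α f g)
    (sym (trans (⊕-eval (D f ⊛ g) (f ⊛ D g) α) (cong₂ _+_ (⊛-eval (D f) g α) (⊛-eval f (D g) α)))))

  D-⊕ : ∀ f g → D (f ⊕ g) ≈ D f ⊕ D g
  D-⊕ f g α _ = trans (cong (fromℕ (sum α) *_) (⊕-eval f g α))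
    (trans (ℚ.*-distribˡ-+ (fromℕ (sum α)) (f α) (g α)) (sym (⊕-eval (D f) (D g) α)))

  D-∑ : (f : Colour → PowerSeries) → D (∑ₛ f) ≈ ∑ₛ (D ∘ f)
  D-∑ f α _ = trans (cong (fromℕ (sum α) *_) (eval-∑ N (allFin N) f α))
    (trans (*-distribˡ-∑ (allFin N) (fromℕ (sum α)) (λ i → f i α)) (sym (eval-∑ N (allFin N) (D ∘ f) α)))

  -- Differentiating y + x y = x gives (1 + x) Dy = x (1 - y), and (1 + x)(1 - y) = 1.
  D-y : ∀ i → D (y i) ⊕ y i ⊛ y i ≈ y i
  D-y i = modulo (⟪ 1ℤ ⟫ ⊕ ⊖ D (y i) ⊕ ⊖ y i) (≈⇒-≈0 (R.sym (y-relation i)))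
    (modulo (⟪ 1ℤ ⟫ ⊕ ⊖ y i) (≈⇒-≈0 relation)
      (solve 3 (λ x y d → d :+ y :* y := y :+ (con 1ℤ :+ :- d :+ :- y) :* (x :+ :- (y :+ x :* y))
                    :+ (con 1ℤ :+ :- y) :* (d :+ (x :* y :+ x :* d) :+ :- x)) R.refl (x i) (y i) (D (y i))))
    where
    relation : D (y i) ⊕ (x i ⊛ y i ⊕ x i ⊛ D (y i)) ≈ x i
    relation = begin
      D (y i) ⊕ (x i ⊛ y i ⊕ x i ⊛ D (y i))     ≈⟨ R.+-congˡ {D (y i)} (R.+-congʳ {x i ⊛ D (y i)} (R.*-congʳ {y i} (λ α _ → D-var (toℕ i) α))) ⟨
      D (y i) ⊕ (D (x i) ⊛ y i ⊕ x i ⊛ D (y i)) ≈⟨ R.+-congˡ {D (y i)} (D-⊛ (x i) (y i)) ⟨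
      D (y i) ⊕ D (x i ⊛ y i)                     ≈⟨ D-⊕ (y i) (x i ⊛ y i) ⟨
      D (y i ⊕ x i ⊛ y i)                         ≈⟨ D-cong (y-relation i) ⟩
      D (x i)                                       ≈⟨ (λ α _ → D-var (toℕ i) α) ⟩
      x i                                           ∎

  -- `D y = y - y²` sums to `D s = s - B`. Applying `D` to `D E = E s` therefore gives
  -- `D (D E) = E s² + E (s - B)`, and subtracting `D E = E s` leaves the claim.
  E*[s²-B] : E ⊛ (s ⊛ s ⊕ ⊖ B) ≈ D (D E) ⊕ ⊖ D E
  E*[s²-B] = R.sym (begin
    D (D E) ⊕ ⊖ D E                         ≈⟨ R.+-cong (D-cong (R.sym E*s)) (R.-‿cong (R.sym E*s)) ⟩
    D (E ⊛ s) ⊕ ⊖ (E ⊛ s)                 ≈⟨ R.+-congʳ (D-⊛ E s) ⟩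
    (D E ⊛ s ⊕ E ⊛ D s) ⊕ ⊖ (E ⊛ s)     ≈⟨ R.+-congʳ (R.+-congʳ (R.*-congʳ E*s)) ⟨
    ((E ⊛ s) ⊛ s ⊕ E ⊛ D s) ⊕ ⊖ (E ⊛ s) ≈⟨ modulo E (≈⇒-≈0 D-s)
                                                  (solve 4 (λ E s d b → E :* s :* s :+ E :* d :+ :- (E :* s) :=
                                                     E :* (s :* s :+ :- b) :+ E :* (d :+ b :+ :- s)) R.refl E s (D s) B) ⟩
    E ⊛ (s ⊛ s ⊕ ⊖ B)                     ∎)
    where
    D-s : D s ⊕ B ≈ s
    D-s = R.trans (R.+-congʳ (D-∑ y)) (R.trans (R.sym (∑ₛ-+ (D ∘ y) (λ i → y i ⊛ y i))) (∑ₛ-cong D-y))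

-- Transfer matrix equations for Smirnov words

total : (ℕ → PowerSeries) → PowerSeries
total f α = f (sum α) α

module SmirnovWords (N : ℕ) where

  open Words N
  open R using (_≈_)
  open SeriesSolver N using (solve; _:=_; _:+_; _:*_; :-_; con)
  open import Relation.Binary.Reasoning.Setoid R.setoid

  -- word n i j enumerates the Smirnov words of length n from i to j by content.
  word : ℕ → Colour → Colour → PowerSeries
  word 0             i j = 0ₛ
  word 1             i j = δ i j ⊛ x i
  word (suc (suc n)) i j = x i ⊛ ∑ₛ λ k → η i k ⊛ word (suc n) k j

  -- `total` takes the part of degree n from the n-th series. As `word n` is homogeneous of degree
  -- n, this is the sum over all word lengths.
  W : Colour → Colour → PowerSeries
  W i j = total λ n → word n i j

  δ-sym : ∀ (i j : Colour) → δ i j ≈ δ j i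
  δ-sym i j = R.reflexive (cong (λ b → if b then 1ₛ else 0ₛ) (does-⇔ (mk⇔ sym sym) (i ≟ᶠ j) (j ≟ᶠ i)))

  η-sym : ∀ (i j : Colour) → η i j ≈ η j i
  η-sym i j = R.reflexive (cong (λ b → if b then 1ₛ else 0ₛ)
    (does-⇔ (mk⇔ (λ ≢ eq → ≢ (sym eq)) (λ ≢ eq → ≢ (sym eq))) (¬? (i ≟ᶠ j)) (¬? (j ≟ᶠ i))))

  𝟙-⊛-cong : {A : Set} (d : Dec A) {f g : PowerSeries} (α : Monomial) → f α ≡ g α → (𝟙 d ⊛ f) α ≡ (𝟙 d ⊛ g) α
  𝟙-⊛-cong d {f} {g} α eq = trans (⊛-eval (𝟙 d) f α) (trans (go (does d)) (sym (⊛-eval (𝟙 d) g α)))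
    where
    go : ∀ b → ((if b then 1ₛ else 0ₛ) *ₛ f) α ≡ ((if b then 1ₛ else 0ₛ) *ₛ g) α
    go true  = trans (*ₛ-identityˡ α f) (trans eq (sym (*ₛ-identityˡ α g)))
    go false = trans (*ₛ-zeroˡ α f (λ _ → refl)) (sym (*ₛ-zeroˡ α g (λ _ → refl)))

  homogeneous-𝟙 : {A : Set} (d : Dec A) → Homogeneous 0 (𝟙 d)
  homogeneous-𝟙 d α ≢0 with does d
  ... | true  = homogeneous-1 α ≢0
  ... | false = refl

  -- Split off the first letter. The equation is compared degree by degree: inside the bracket
  -- `δ i j` lives in degree 0 and the sum over `k` in positive degrees.
  W-recursion : ∀ i j → W i j ≈ x i ⊛ (δ i j ⊕ ∑ₛ λ k → η i k ⊛ W k j)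
  W-recursion i j α l = trans (go (sum α) refl) (sym (⊛-eval (x i) (δ i j ⊕ rest) α))
    where
    rest : PowerSeries
    rest = ∑ₛ λ k → η i k ⊛ W k j
    rest-eval : ∀ n γ → sum γ ≡ n → rest γ ≡ (∑ₛ λ k → η i k ⊛ word n k j) γ
    rest-eval n γ refl = trans (eval-∑ N (allFin N) (λ k → η i k ⊛ W k j) γ)
      (trans (∑-cong (allFin N) λ k → 𝟙-⊛-cong (¬? (i ≟ᶠ k)) {W k j} {word n k j} γ refl) (sym (eval-∑ N (allFin N) (λ k → η i k ⊛ word n k j) γ)))
    rest-zero : ∀ γ → sum γ ≡ 0 → rest γ ≡ 0ℚ
    rest-zero γ eq = trans (rest-eval 0 γ eq) (trans (eval-∑ N (allFin N) (λ k → η i k ⊛ 0ₛ) γ)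
      (∑-zero (allFin N) λ {k} _ → trans (⊛-eval (η i k) 0ₛ γ) (*ₛ-zeroʳ γ (η i k) (λ _ → refl))))
    go : ∀ n → sum α ≡ n → word n i j α ≡ (x i *ₛ (δ i j ⊕ rest)) α
    go 0 eq = sym (homogeneous-*-zero α (δ i j ⊕ rest) (homogeneous-var (toℕ i)) (λ γ eq′ → ⊥-elim (ℕ.1+n≢0 (trans eq′ eq))))
    go 1 eq = trans (trans (R.*-comm (δ i j) (x i) α l) (⊛-eval (x i) (δ i j) α))
      (homogeneous-*-cong α (δ i j) (δ i j ⊕ rest) (homogeneous-var (toℕ i)) λ γ eq′ → sym (trans (⊕-eval (δ i j) rest γ)
        (trans (cong (λ r → δ i j γ + r) (rest-zero γ (ℕ.suc-injective (trans eq′ eq)))) (ℚ.+-identityʳ (δ i j γ)))))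
    go (suc (suc n)) eq = trans (⊛-eval (x i) (∑ₛ λ k → η i k ⊛ word (suc n) k j) α)
      (homogeneous-*-cong α (∑ₛ λ k → η i k ⊛ word (suc n) k j) (δ i j ⊕ rest) (homogeneous-var (toℕ i)) λ γ eq′ →
        let γ≡1+n = ℕ.suc-injective (trans eq′ eq) in sym (trans (⊕-eval (δ i j) rest γ)
          (trans (cong₂ _+_ (homogeneous-𝟙 (i ≟ᶠ j) γ (λ γ≡0 → ℕ.1+n≢0 (trans (sym γ≡1+n) γ≡0))) (rest-eval (suc n) γ γ≡1+n))
                 (ℚ.+-identityˡ _))))

  Q : Colour → PowerSeries
  Q j = ∑ₛ λ k → W k j

  -- The sum over `k ≠ i` is `Q j - W i j`, so `(1 + x i) W i j = x i (δ i j + Q j)`; dividing by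
  -- `1 + x i` turns `x i` into `y i`.
  W-Q : ∀ i j → W i j ≈ y i ⊛ (δ i j ⊕ Q j)
  W-Q i j = modulo (W i j ⊕ ⊖ δ i j ⊕ ⊖ Q j) (≈⇒-≈0 (y-relation i))
    (modulo (⟪ 1ℤ ⟫ ⊕ ⊖ y i) (≈⇒-≈0 {W i j} (W-recursion i j))
      (modulo (x i ⊛ (⟪ 1ℤ ⟫ ⊕ ⊖ y i)) (≈⇒-≈0 (∑-η i (λ k → W k j)))
        (solve 6 (λ x y w d r q → w := y :* (d :+ q) :+ (w :+ :- d :+ :- q) :* (y :+ x :* y :+ :- x)
           :+ (con 1ℤ :+ :- y) :* (w :+ :- (x :* (d :+ r)))
           :+ (x :* (con 1ℤ :+ :- y)) :* (r :+ w :+ :- q))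
          R.refl (x i) (y i) (W i j) (δ i j) (∑ₛ λ k → η i k ⊛ W k j) (Q j))))

  module _ (P : PowerSeries) (P-relation : P ≈ ⟪ 1ℤ ⟫ ⊕ P ⊛ s) where

    -- Summing `W-Q` over its first index gives `(1 - s) Q j = y j`, and `P` is the inverse of
    -- `1 - s`.
    Q≈P*y : ∀ j → Q j ≈ P ⊛ y j
    Q≈P*y j = modulo P (≈⇒-≈0 {Q j} relation)
      (modulo (⊖ Q j) (≈⇒-≈0 {P} P-relation)
        (solve 4 (λ p q s y → q := p :* y :+ p :* (q :+ :- (y :+ s :* q)) :+ (:- q) :* (p :+ :- (con 1ℤ :+ p :* s)))
          R.refl P (Q j) s (y j)))
      where
      relation : Q j ≈ y j ⊕ s ⊛ Q j
      relation = begin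
        (∑ₛ λ i → W i j)                          ≈⟨ ∑ₛ-cong (λ i → R.trans (W-Q i j)
                                                       (solve 3 (λ y d q → y :* (d :+ q) := d :* y :+ q :* y) R.refl (y i) (δ i j) (Q j))) ⟩
        (∑ₛ λ i → δ i j ⊛ y i ⊕ Q j ⊛ y i)         ≈⟨ ∑ₛ-+ (λ i → δ i j ⊛ y i) (λ i → Q j ⊛ y i) ⟩
        (∑ₛ λ i → δ i j ⊛ y i) ⊕ (∑ₛ λ i → Q j ⊛ y i) ≈⟨ R.+-cong (R.trans (∑ₛ-cong (λ i → R.*-congʳ (δ-sym i j))) (∑-δ j y))
                                                          (R.trans (R.sym (*-∑ₛ (Q j) y)) (R.*-comm (Q j) s)) ⟩
        y j ⊕ s ⊛ Q j                             ∎

    W-formula : ∀ i j → W i j ≈ δ i j ⊛ y i ⊕ P ⊛ (y i ⊛ y j)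
    W-formula i j = R.trans (W-Q i j) (R.trans (R.*-congˡ (R.+-congˡ (Q≈P*y j)))
      (solve 4 (λ p a b d → a :* (d :+ p :* b) := d :* a :+ p :* (a :* b)) R.refl P (y i) (y j) (δ i j)))

  u : Colour → Colour → Colour → PowerSeries
  u i j a = η i a ⊛ (η j a ⊛ x a)

  V : Colour → Colour → PowerSeries
  V i j = ∑ₛ λ a → ∑ₛ λ b → η a b ⊛ (u i j a ⊛ u i j b)

  -- The factor `η i j` prevents `f i` from being subtracted twice when `i = j`.
  ∑-ηη : ∀ i j (f : Colour → PowerSeries) → (∑ₛ λ a → η i a ⊛ (η j a ⊛ f a)) ≈ ∑ₛ f ⊕ ⊖ (f j ⊕ η i j ⊛ f i)
  ∑-ηη i j f = modulo ⟪ 1ℤ ⟫ (≈⇒-≈0 (∑-η i (λ a → η j a ⊛ f a)))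
    (modulo ⟪ 1ℤ ⟫ (≈⇒-≈0 (∑-η j f))
      (modulo (f i) (≈⇒-≈0 (η-sym i j))
        (solve 7 (λ m k t fi fj h h′ → m := t :+ :- (fj :+ h :* fi) :+ con 1ℤ :* (m :+ h′ :* fi :+ :- k)
            :+ con 1ℤ :* (k :+ fj :+ :- t) :+ fi :* (h :+ :- h′))
          R.refl (∑ₛ λ a → η i a ⊛ (η j a ⊛ f a)) (∑ₛ λ a → η j a ⊛ f a) (∑ₛ f) (f i) (f j) (η i j) (η j i))))

-- Closed form of the sum over end colours and twin colours

module TwinnedCycleSeries (N : ℕ) (P : PowerSeries) (P-relation : CommutativeRing._≈_ (seriesRing N) P (⟪ 1ℤ ⟫ ⊕ P ⊛ Words.s N)) where

  open Words N
  open SmirnovWords N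
  open R using (_≈_)
  open SeriesSolver N using (solve; _:=_; _:+_; _:*_; :-_; con)
  open import Relation.Binary.Reasoning.Setoid R.setoid

  -- The value of `V i j` for `i = j`. For distinct ends `x i` has to be left out too, and `V₂` is
  -- the resulting correction.
  V₁ : Colour → PowerSeries
  V₁ j = (e 1 ⊕ ⊖ x j) ⊛ (e 1 ⊕ ⊖ x j) ⊕ ⊖ p₂ ⊕ x j ⊛ x j

  V₂ : Colour → Colour → PowerSeries
  V₂ i j = ⟪ + 2 ⟫ ⊛ (x i ⊛ x i ⊕ ⊖ (e 1 ⊛ x i) ⊕ x i ⊛ x j)

  -- The pairs `a ≠ b` are all pairs without the diagonal, so `V i j` is the square of the sum of
  -- the `u i j a` minus the sum of their squares. Indicators are idempotent, which makes `∑-ηη`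
  -- applicable to the squares.
  V-formula : ∀ i j → V i j ≈ V₁ j ⊕ η i j ⊛ V₂ i j
  V-formula i j = modulo (x i ⊛ x i) (≈⇒-≈0 (𝟙-idem (¬? (i ≟ᶠ j)))) (R.trans V≈
    (solve 5 (λ e p a b h → (e :+ :- (b :+ h :* a)) :* (e :+ :- (b :+ h :* a)) :+ :- (p :+ :- (b :* b :+ h :* (a :* a)))
         := (e :+ :- b) :* (e :+ :- b) :+ :- p :+ b :* b :+ h :* (con (+ 2) :* (a :* a :+ :- (e :* a) :+ a :* b))
            :+ a :* a :* (h :* h :+ :- h))
      R.refl (e 1) p₂ (x i) (x j) (η i j)))
    where
    U≈ : ∑ₛ (u i j) ≈ e 1 ⊕ ⊖ (x j ⊕ η i j ⊛ x i)
    U≈ = R.trans (∑-ηη i j x) (R.+-congʳ ∑x≈e₁)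
    u²≈ : (∑ₛ λ a → u i j a ⊛ u i j a) ≈ p₂ ⊕ ⊖ (x j ⊛ x j ⊕ η i j ⊛ (x i ⊛ x i))
    u²≈ = R.trans (∑ₛ-cong λ a → R.trans
      (solve 3 (λ g h x → g :* (h :* x) :* (g :* (h :* x)) := g :* g :* (h :* h :* (x :* x))) R.refl (η i a) (η j a) (x a))
      (R.*-cong (𝟙-idem (¬? (i ≟ᶠ a))) (R.*-congʳ (𝟙-idem (¬? (j ≟ᶠ a)))))) (∑-ηη i j (λ a → x a ⊛ x a))
    V+u² : V i j ⊕ (∑ₛ λ a → u i j a ⊛ u i j a) ≈ ∑ₛ (u i j) ⊛ ∑ₛ (u i j)
    V+u² = begin
      V i j ⊕ (∑ₛ λ a → u i j a ⊛ u i j a)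
        ≈⟨ ∑ₛ-+ (λ a → ∑ₛ λ b → η a b ⊛ (u i j a ⊛ u i j b)) (λ a → u i j a ⊛ u i j a) ⟨
      (∑ₛ λ a → (∑ₛ λ b → η a b ⊛ (u i j a ⊛ u i j b)) ⊕ u i j a ⊛ u i j a)
        ≈⟨ ∑ₛ-cong (λ a → ∑-η a (λ b → u i j a ⊛ u i j b)) ⟩
      (∑ₛ λ a → ∑ₛ λ b → u i j a ⊛ u i j b)
        ≈⟨ ∑ₛ-cong (λ a → *-∑ₛ (u i j a) (u i j)) ⟨
      (∑ₛ λ a → u i j a ⊛ ∑ₛ (u i j))
        ≈⟨ S.*-distribʳ-∑ (allFin N) (∑ₛ (u i j)) (u i j) ⟨
      ∑ₛ (u i j) ⊛ ∑ₛ (u i j) ∎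
    V≈ : V i j ≈ (e 1 ⊕ ⊖ (x j ⊕ η i j ⊛ x i)) ⊛ (e 1 ⊕ ⊖ (x j ⊕ η i j ⊛ x i)) ⊕ ⊖ (p₂ ⊕ ⊖ (x j ⊛ x j ⊕ η i j ⊛ (x i ⊛ x i)))
    V≈ = R.trans (R.sym (solve 2 (λ a b → (a :+ b) :+ :- b := a) R.refl (V i j) (∑ₛ λ a → u i j a ⊛ u i j a)))
      (R.+-cong (R.trans V+u² (R.*-cong U≈ U≈)) (R.-‿cong u²≈))

  K₁ K₂ K₃ : PowerSeries
  K₁ = ∑ₛ λ j → y j ⊛ V₁ j
  K₂ = ∑ₛ λ i → ∑ₛ λ j → y i ⊛ y j ⊛ V₂ i j
  K₃ = ∑ₛ λ i → y i ⊛ y i ⊛ V₂ i i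

  h≈0 : ∀ i → y i ⊕ x i ⊛ y i ⊕ ⊖ x i ≈ 0ₛ
  h≈0 i = ≈⇒-≈0 (y-relation i)

  -- The relation `x y = x - y` reduces `y` times a polynomial in `x` to a combination of `y`, `x`
  -- and `x²` with coefficients free of the colour, and such a combination can be summed. `K₂` and
  -- `K₃` are reduced in the same way.
  K₁≈ : K₁ ≈ (e 1 ⊛ e 1 ⊕ ⊖ p₂ ⊕ ⟪ + 2 ⟫ ⊛ e 1 ⊕ ⟪ + 2 ⟫) ⊛ s ⊕ (⊖ (⟪ + 2 ⟫ ⊛ e 1 ⊕ ⟪ + 2 ⟫) ⊛ e 1 ⊕ ⟪ + 2 ⟫ ⊛ p₂)
  K₁≈ = R.trans (∑ₛ-cong (λ j → modulo (⊖ (⟪ + 2 ⟫ ⊛ e 1) ⊕ ⟪ + 2 ⟫ ⊛ x j ⊕ ⊖ ⟪ + 2 ⟫) (h≈0 j)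
      (solve 4 (λ e p x y → y :* ((e :+ :- x) :* (e :+ :- x) :+ :- p :+ x :* x)
          := (e :* e :+ :- p :+ con (+ 2) :* e :+ con (+ 2)) :* y :+ (:- (con (+ 2) :* e :+ con (+ 2)) :* x :+ con (+ 2) :* (x :* x))
             :+ (:- (con (+ 2) :* e) :+ con (+ 2) :* x :+ :- con (+ 2)) :* (y :+ x :* y :+ :- x))
        R.refl (e 1) p₂ (x j) (y j))))
    (R.trans (∑ₛ-linear₃ (e 1 ⊛ e 1 ⊕ ⊖ p₂ ⊕ ⟪ + 2 ⟫ ⊛ e 1 ⊕ ⟪ + 2 ⟫) (⊖ (⟪ + 2 ⟫ ⊛ e 1 ⊕ ⟪ + 2 ⟫)) ⟪ + 2 ⟫ y x (λ j → x j ⊛ x j))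
      (R.+-congˡ (R.+-congʳ (R.*-congˡ ∑x≈e₁))))

  K₂≈ : K₂ ≈ (⟪ + 2 ⟫ ⊛ s) ⊛ p₂ ⊕ ((⟪ + 2 ⟫ ⊛ e 1 ⊕ ⊖ ((⟪ + 4 ⟫ ⊕ ⟪ + 2 ⟫ ⊛ e 1) ⊛ s)) ⊛ e 1
              ⊕ ((⟪ + 4 ⟫ ⊕ ⟪ + 2 ⟫ ⊛ e 1) ⊛ s ⊕ ⊖ (⟪ + 2 ⟫ ⊛ e 1)) ⊛ s)
  K₂≈ = R.trans (∑ₛ-cong λ i → R.trans (row i)
      (solve 4 (λ e s a y → (con (+ 2) :* (a :* a) :+ :- ((con (+ 4) :+ con (+ 2) :* e) :* (a :+ :- y))) :* s :+ (con (+ 2) :* (a :+ :- y)) :* e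
          := (con (+ 2) :* s) :* (a :* a) :+ ((con (+ 2) :* e :+ :- ((con (+ 4) :+ con (+ 2) :* e) :* s)) :* a
             :+ ((con (+ 4) :+ con (+ 2) :* e) :* s :+ :- (con (+ 2) :* e)) :* y))
        R.refl (e 1) s (x i) (y i)))
    (R.trans (∑ₛ-linear₃ (⟪ + 2 ⟫ ⊛ s) (⟪ + 2 ⟫ ⊛ e 1 ⊕ ⊖ ((⟪ + 4 ⟫ ⊕ ⟪ + 2 ⟫ ⊛ e 1) ⊛ s))
        ((⟪ + 4 ⟫ ⊕ ⟪ + 2 ⟫ ⊛ e 1) ⊛ s ⊕ ⊖ (⟪ + 2 ⟫ ⊛ e 1)) (λ i → x i ⊛ x i) x y)
      (R.+-congˡ (R.+-congʳ (R.*-congˡ ∑x≈e₁))))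
    where
    row : ∀ i → (∑ₛ λ j → y i ⊛ y j ⊛ V₂ i j) ≈
      (⟪ + 2 ⟫ ⊛ (x i ⊛ x i) ⊕ ⊖ ((⟪ + 4 ⟫ ⊕ ⟪ + 2 ⟫ ⊛ e 1) ⊛ (x i ⊕ ⊖ y i))) ⊛ s ⊕ (⟪ + 2 ⟫ ⊛ (x i ⊕ ⊖ y i)) ⊛ e 1
    row i = R.trans (∑ₛ-cong λ j →
        modulo (⟪ + 2 ⟫ ⊛ y j ⊛ (x i ⊕ ⊖ ⟪ 1ℤ ⟫) ⊕ ⊖ (⟪ + 2 ⟫ ⊛ e 1 ⊛ y j) ⊕ ⟪ + 2 ⟫ ⊛ (x j ⊛ y j)) (h≈0 i)
        (modulo (⟪ + 2 ⟫ ⊛ (x i ⊕ ⊖ y i)) (h≈0 j)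
          (solve 5 (λ e a y b z → y :* z :* (con (+ 2) :* (a :* a :+ :- (e :* a) :+ a :* b))
              := (con (+ 2) :* (a :* a) :+ :- ((con (+ 4) :+ con (+ 2) :* e) :* (a :+ :- y))) :* z :+ (con (+ 2) :* (a :+ :- y)) :* b
                 :+ (con (+ 2) :* z :* (a :+ :- con 1ℤ) :+ :- (con (+ 2) :* e :* z) :+ con (+ 2) :* (b :* z)) :* (y :+ a :* y :+ :- a)
                 :+ (con (+ 2) :* (a :+ :- y)) :* (z :+ b :* z :+ :- b))
            R.refl (e 1) (x i) (y i) (x j) (y j))))
      (R.trans (∑ₛ-linear₂ (⟪ + 2 ⟫ ⊛ (x i ⊛ x i) ⊕ ⊖ ((⟪ + 4 ⟫ ⊕ ⟪ + 2 ⟫ ⊛ e 1) ⊛ (x i ⊕ ⊖ y i))) (⟪ + 2 ⟫ ⊛ (x i ⊕ ⊖ y i)) y x)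
        (R.+-congˡ (R.*-congˡ ∑x≈e₁)))

  -- On the diagonal `y` occurs squared. From `x² y² = (x - y)²` and `x y² = x - y - y²` a multiple
  -- of `y²` remains, and its sum is the source of `B`.
  K₃≈ : K₃ ≈ ⟪ + 4 ⟫ ⊛ p₂ ⊕ (⊖ (⟪ + 8 ⟫ ⊕ ⟪ + 2 ⟫ ⊛ e 1) ⊛ e 1 ⊕ ((⟪ + 8 ⟫ ⊕ ⟪ + 2 ⟫ ⊛ e 1) ⊛ s ⊕ (⟪ + 4 ⟫ ⊕ ⟪ + 2 ⟫ ⊛ e 1) ⊛ B))
  K₃≈ = R.trans (∑ₛ-cong λ i →
      modulo (⟪ + 4 ⟫ ⊛ (⟪ + 2 ⟫ ⊛ (x i ⊕ ⊖ y i) ⊕ (y i ⊕ x i ⊛ y i ⊕ ⊖ x i) ⊕ ⊖ ⟪ + 2 ⟫) ⊕ ⊖ (⟪ + 2 ⟫ ⊛ e 1 ⊛ (⟪ 1ℤ ⟫ ⊕ y i))) (h≈0 i)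
      (solve 3 (λ e a y → y :* y :* (con (+ 2) :* (a :* a :+ :- (e :* a) :+ a :* a))
          := con (+ 4) :* (a :* a) :+ (:- (con (+ 8) :+ con (+ 2) :* e) :* a :+ ((con (+ 8) :+ con (+ 2) :* e) :* y :+ (con (+ 4) :+ con (+ 2) :* e) :* (y :* y)))
             :+ (con (+ 4) :* (con (+ 2) :* (a :+ :- y) :+ (y :+ a :* y :+ :- a) :+ :- con (+ 2)) :+ :- (con (+ 2) :* e :* (con 1ℤ :+ y))) :* (y :+ a :* y :+ :- a))
        R.refl (e 1) (x i) (y i)))
    (R.trans (∑ₛ-linear₄ ⟪ + 4 ⟫ (⊖ (⟪ + 8 ⟫ ⊕ ⟪ + 2 ⟫ ⊛ e 1)) (⟪ + 8 ⟫ ⊕ ⟪ + 2 ⟫ ⊛ e 1) (⟪ + 4 ⟫ ⊕ ⟪ + 2 ⟫ ⊛ e 1)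
        (λ i → x i ⊛ x i) x y (λ i → y i ⊛ y i))
      (R.+-congˡ (R.+-congʳ (R.*-congˡ ∑x≈e₁))))

  T₂ : PowerSeries
  T₂ = ∑ₛ λ i → ∑ₛ λ j → W i j ⊛ V i j

  -- The `δ` term of `W` sees `V₁` alone because `δ i j ⊛ η i j` is 0. The `P` term sees `V₂` off
  -- the diagonal; the diagonal term added on the left completes that sum over `j`.
  T₂-row : ∀ i → (∑ₛ λ j → W i j ⊛ V i j) ⊕ P ⊛ (y i ⊛ y i ⊛ V₂ i i) ≈
    y i ⊛ V₁ i ⊕ (P ⊛ K₁ ⊛ y i ⊕ P ⊛ (∑ₛ λ j → y i ⊛ y j ⊛ V₂ i j))
  T₂-row i = begin
    (∑ₛ λ j → W i j ⊛ V i j) ⊕ g i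
      ≈⟨ R.+-congʳ (∑ₛ-cong λ j → R.trans (R.*-cong (W-formula P P-relation i j) (V-formula i j))
           (modulo (y i ⊛ V₂ i j) (𝟙-disjoint (i ≟ᶠ j))
             (solve 7 (λ p a b d h v w → (d :* a :+ p :* (a :* b)) :* (v :+ h :* w) :=
                 d :* (a :* v) :+ ((p :* a) :* (b :* v) :+ h :* (p :* (a :* b :* w))) :+ (a :* w) :* (d :* h))
               R.refl P (y i) (y j) (δ i j) (η i j) (V₁ j) (V₂ i j)))) ⟩
    (∑ₛ λ j → δ i j ⊛ (y i ⊛ V₁ j) ⊕ ((P ⊛ y i) ⊛ (y j ⊛ V₁ j) ⊕ η i j ⊛ g j)) ⊕ g i
      ≈⟨ R.+-congʳ (R.trans (∑ₛ-+ (λ j → δ i j ⊛ (y i ⊛ V₁ j)) _) (R.+-congˡ (∑ₛ-+ (λ j → (P ⊛ y i) ⊛ (y j ⊛ V₁ j)) (λ j → η i j ⊛ g j)))) ⟩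
    (∑ₛ (λ j → δ i j ⊛ (y i ⊛ V₁ j)) ⊕ (∑ₛ (λ j → (P ⊛ y i) ⊛ (y j ⊛ V₁ j)) ⊕ ∑ₛ (λ j → η i j ⊛ g j))) ⊕ g i
      ≈⟨ solve 4 (λ a b c d → a :+ (b :+ c) :+ d := a :+ (b :+ (c :+ d))) R.refl _ _ _ (g i) ⟩
    ∑ₛ (λ j → δ i j ⊛ (y i ⊛ V₁ j)) ⊕ (∑ₛ (λ j → (P ⊛ y i) ⊛ (y j ⊛ V₁ j)) ⊕ (∑ₛ (λ j → η i j ⊛ g j) ⊕ g i))
      ≈⟨ R.+-cong (∑-δ i (λ j → y i ⊛ V₁ j)) (R.+-cong
           (R.trans (R.sym (*-∑ₛ (P ⊛ y i) (λ j → y j ⊛ V₁ j))) (solve 3 (λ p y k → p :* y :* k := p :* k :* y) R.refl P (y i) K₁))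
           (R.trans (∑-η i g) (R.sym (*-∑ₛ P (λ j → y i ⊛ y j ⊛ V₂ i j))))) ⟩
    y i ⊛ V₁ i ⊕ (P ⊛ K₁ ⊛ y i ⊕ P ⊛ (∑ₛ λ j → y i ⊛ y j ⊛ V₂ i j)) ∎
    where
    g : Colour → PowerSeries
    g j = P ⊛ (y i ⊛ y j ⊛ V₂ i j)

  T₂-sum : T₂ ⊕ P ⊛ K₃ ≈ K₁ ⊕ (P ⊛ K₁ ⊛ s ⊕ P ⊛ K₂)
  T₂-sum = begin
    T₂ ⊕ P ⊛ K₃
      ≈⟨ R.+-congˡ (*-∑ₛ P (λ i → y i ⊛ y i ⊛ V₂ i i)) ⟩
    T₂ ⊕ (∑ₛ λ i → P ⊛ (y i ⊛ y i ⊛ V₂ i i))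
      ≈⟨ ∑ₛ-+ (λ i → ∑ₛ λ j → W i j ⊛ V i j) (λ i → P ⊛ (y i ⊛ y i ⊛ V₂ i i)) ⟨
    (∑ₛ λ i → (∑ₛ λ j → W i j ⊛ V i j) ⊕ P ⊛ (y i ⊛ y i ⊛ V₂ i i))
      ≈⟨ ∑ₛ-cong T₂-row ⟩
    (∑ₛ λ i → y i ⊛ V₁ i ⊕ (P ⊛ K₁ ⊛ y i ⊕ P ⊛ (∑ₛ λ j → y i ⊛ y j ⊛ V₂ i j)))
      ≈⟨ ∑ₛ-+ (λ i → y i ⊛ V₁ i) (λ i → P ⊛ K₁ ⊛ y i ⊕ P ⊛ (∑ₛ λ j → y i ⊛ y j ⊛ V₂ i j)) ⟩
    K₁ ⊕ (∑ₛ λ i → P ⊛ K₁ ⊛ y i ⊕ P ⊛ (∑ₛ λ j → y i ⊛ y j ⊛ V₂ i j))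
      ≈⟨ R.+-congˡ (∑ₛ-linear₂ (P ⊛ K₁) P y (λ i → ∑ₛ λ j → y i ⊛ y j ⊛ V₂ i j)) ⟩
    K₁ ⊕ (P ⊛ K₁ ⊛ s ⊕ P ⊛ K₂) ∎

  C : PowerSeries
  C = P ⊛ (s ⊛ s ⊕ ⊖ B)

  -- After substitution `e₁² = p₂ + 2 e₂` eliminates the power sum, and `P = 1 + P s` absorbs the
  -- `s` outside `C`. The polynomial summand only cancels what the others contribute in degrees
  -- below 3, where `T₂` has no terms.
  T₂-formula : T₂ ≈ ⟪ + 2 ⟫ ⊛ ((⟪ + 2 ⟫ ⊛ C ⊕ e 1 ⊛ C ⊕ (e 2 ⊛ P ⊕ ⊖ (⟪ + 3 ⟫ ⊛ P))) ⊕ (e 2 ⊕ ⟪ + 3 ⟫ ⊛ e 1 ⊕ ⟪ + 3 ⟫))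
  T₂-formula = R.trans (R.sym (solve 2 (λ a b → (a :+ b) :+ :- b := a) R.refl T₂ (P ⊛ K₃)))
    (R.trans (R.+-cong (R.trans T₂-sum (R.+-cong K₁≈ (R.+-cong (R.*-congʳ (R.*-congˡ K₁≈)) (R.*-congˡ K₂≈)))) (R.-‿cong (R.*-congˡ K₃≈)))
    (modulo (⊖ ((⟪ 1ℤ ⟫ ⊕ P ⊛ s) ⊛ (⟪ + 2 ⟫ ⊕ ⊖ s) ⊕ ⟪ + 2 ⟫ ⊛ (P ⊛ s) ⊕ ⊖ (⟪ + 4 ⟫ ⊛ P))) (≈⇒-≈0 e₁²≈p₂+2e₂)
    (modulo (⟪ + 2 ⟫ ⊛ (e 2 ⊕ ⟪ + 3 ⟫ ⊛ e 1 ⊕ ⟪ + 3 ⟫) ⊕ ⊖ (⟪ + 2 ⟫ ⊛ ((e 2 ⊕ e 1 ⊕ ⟪ 1ℤ ⟫) ⊛ s ⊕ ⊖ ((e 1 ⊕ ⟪ 1ℤ ⟫) ⊛ e 1) ⊕ (e 1 ⊛ e 1 ⊕ ⊖ (⟪ + 2 ⟫ ⊛ e 2))))) (≈⇒-≈0 {P} P-relation)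
      (solve 6 (λ P s b e e₂ p →
          let 2′ = con (+ 2)
              k₁ = (e :* e :+ :- p :+ 2′ :* e :+ 2′) :* s :+ (:- (2′ :* e :+ 2′) :* e :+ 2′ :* p)
              k₂ = (2′ :* s) :* p :+ ((2′ :* e :+ :- ((con (+ 4) :+ 2′ :* e) :* s)) :* e :+ ((con (+ 4) :+ 2′ :* e) :* s :+ :- (2′ :* e)) :* s)
              k₃ = con (+ 4) :* p :+ (:- (con (+ 8) :+ 2′ :* e) :* e :+ ((con (+ 8) :+ 2′ :* e) :* s :+ (con (+ 4) :+ 2′ :* e) :* b))
              c  = P :* (s :* s :+ :- b)
          in k₁ :+ (P :* k₁ :* s :+ P :* k₂) :+ :- (P :* k₃)
             := 2′ :* ((2′ :* c :+ e :* c :+ (e₂ :* P :+ :- (con (+ 3) :* P))) :+ (e₂ :+ con (+ 3) :* e :+ con (+ 3)))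
                :+ :- ((con 1ℤ :+ P :* s) :* (2′ :+ :- s) :+ 2′ :* (P :* s) :+ :- (con (+ 4) :* P)) :* (e :* e :+ :- (p :+ (e₂ :+ e₂)))
                :+ (2′ :* (e₂ :+ con (+ 3) :* e :+ con (+ 3)) :+ :- (2′ :* ((e₂ :+ e :+ con 1ℤ) :* s :+ :- ((e :+ con 1ℤ) :* e) :+ (e :* e :+ :- (2′ :* e₂)))))
                   :* (P :+ :- (con 1ℤ :+ P :* s)))
        R.refl P s B (e 1) (e 2) p₂))))

-- Partitions

-- Bijective changes of a summation index are carried out as permutations of duplicate-free lists,
-- for partitions and for colourings.
unique-complete⇒↭ : {A : Set} {xs ys : List A} → Unique xs → Unique ys →
  (∀ {v} → v ∈ xs → v ∈ ys) → (∀ {v} → v ∈ ys → v ∈ xs) → xs ↭ ys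
unique-complete⇒↭ xs! ys! f g = ∼bag⇒↭ (unique∧set⇒bag xs! ys! (mk⇔ f g))

record Bounded (m n : ℕ) (ν : List ℕ) : Set where
  field
    sorted   : AllPairs _≥_ ν
    positive : All NonZero ν
    bounded  : All (_≤ m) ν
    size     : sum ν ≡ n

sum-replicate-++ : ∀ i k ρ → sum (replicate i k ++ ρ) ≡ i *ℕ k +ℕ sum ρ
sum-replicate-++ zero    k ρ = refl
sum-replicate-++ (suc i) k ρ = trans (cong (k +ℕ_) (sum-replicate-++ i k ρ)) (sym (ℕ.+-assoc k (i *ℕ k) (sum ρ)))

partitions≤-sound : ∀ m n {ν} → ν ∈ partitions≤ m n → Bounded m n ν
partitions≤-sound zero    zero (here refl) = record { sorted = [] ; positive = [] ; bounded = [] ; size = refl }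
partitions≤-sound (suc m) n    ν∈
  with i , i∈ , ν∈′ ← find (∈-concatMap⁻ (λ i → map (replicate i (suc m) ++_) (partitions≤ m (n ∸ i *ℕ suc m))) ν∈)
  with ρ , ρ∈ , refl ← ∈-map⁻ (replicate i (suc m) ++_) ν∈′ = record
    { sorted   = AllPairs.++⁺ (constant i) sorted (All.replicate⁺ i (All.map (λ ≤m → ℕ.≤-trans ≤m (ℕ.n≤1+n m)) bounded))
    ; positive = All.++⁺ (All.replicate⁺ i _) positive
    ; bounded  = All.++⁺ (All.replicate⁺ i ℕ.≤-refl) (All.map (λ ≤m → ℕ.≤-trans ≤m (ℕ.n≤1+n m)) bounded)
    ; size     = trans (sum-replicate-++ i (suc m) ρ) (trans (cong (i *ℕ suc m +ℕ_) size)
        (ℕ.m+[n∸m]≡n (proj₂ (∈-filter⁻ (λ i → i *ℕ suc m ≤? n) {xs = upTo (suc n)} i∈))))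
    }
  where
  open Bounded (partitions≤-sound m (n ∸ i *ℕ suc m) ρ∈)
  constant : ∀ i → AllPairs _≥_ (replicate i (suc m))
  constant zero    = []
  constant (suc i) = All.replicate⁺ i ℕ.≤-refl ∷ constant i

-- In a decreasing list bounded by `suc m` the copies of `suc m` stand in front, and what follows is
-- bounded by `m`.
leading : ∀ m n {ν} → Bounded (suc m) n ν → ∃ λ i → ∃ λ ρ → ν ≡ replicate i (suc m) ++ ρ × Bounded m (sum ρ) ρ
leading m n {[]} _ = 0 , [] , refl , record { sorted = [] ; positive = [] ; bounded = [] ; size = refl }
leading m n {a ∷ ν} record { sorted = a≥ ∷ sorted ; positive = a>0 ∷ positive ; bounded = a≤ ∷ bounded } with a ℕ.≟ suc m
... | yes refl with i , ρ , refl , b ← leading m (sum ν) {ν} record { sorted = sorted ; positive = positive ; bounded = bounded ; size = refl } =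
  suc i , ρ , refl , b
... | no a≢ = 0 , a ∷ ν , refl , record
  { sorted = a≥ ∷ sorted ; positive = a>0 ∷ positive ; size = refl
  ; bounded = a≤m ∷ All.map (λ ≤a → ℕ.≤-trans ≤a a≤m) a≥ }
  where a≤m = ℕ.≤-pred (ℕ.≤∧≢⇒< a≤ a≢)

partitions≤-complete : ∀ m n {ν} → Bounded m n ν → ν ∈ partitions≤ m n
partitions≤-complete zero zero    {[]} _ = here refl
partitions≤-complete zero (suc n) {[]} record { size = () }
partitions≤-complete zero n {zero ∷ ν} record { positive = () ∷ _ }
partitions≤-complete zero n {suc a ∷ ν} record { bounded = () ∷ _ }
partitions≤-complete (suc m) n {ν} b with i , ρ , refl , b′ ← leading m n b =
  ∈-concatMap⁺ (λ i → map (replicate i (suc m) ++_) (partitions≤ m (n ∸ i *ℕ suc m)))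
    (lose (∈-filter⁺ (λ i → i *ℕ suc m ≤? n) (∈-upTo⁺ (s≤s (ℕ.≤-trans (ℕ.m≤m*n i (suc m)) i≤))) i≤)
      (∈-map⁺ (replicate i (suc m) ++_) (subst (λ k → ρ ∈ partitions≤ m k) sumρ (partitions≤-complete m (sum ρ) b′))))
  where
  n≡ : i *ℕ suc m +ℕ sum ρ ≡ n
  n≡ = trans (sym (sum-replicate-++ i (suc m) ρ)) (Bounded.size b)
  i≤ : i *ℕ suc m ≤ n
  i≤ = subst (i *ℕ suc m ≤_) n≡ (ℕ.m≤m+n (i *ℕ suc m) (sum ρ))
  sumρ : sum ρ ≡ n ∸ i *ℕ suc m
  sumρ = trans (sym (ℕ.m+n∸m≡n (i *ℕ suc m) (sum ρ))) (cong (_∸ i *ℕ suc m) n≡)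

-- The tails have no part `suc m`, so the number of leading copies can be read off. Hence the blocks
-- of `partitions≤` for different `i` are disjoint.
replicate-++-injective : ∀ m i j {ρ σ} → All (_≤ m) ρ → All (_≤ m) σ →
  replicate i (suc m) ++ ρ ≡ replicate j (suc m) ++ σ → i ≡ j
replicate-++-injective m zero    zero    ρ≤ σ≤ eq = refl
replicate-++-injective m zero    (suc j) (≤m ∷ _) σ≤ refl = ⊥-elim (ℕ.1+n≰n ≤m)
replicate-++-injective m (suc i) zero    ρ≤ (≤m ∷ _) refl = ⊥-elim (ℕ.1+n≰n ≤m)
replicate-++-injective m (suc i) (suc j) ρ≤ σ≤ eq = cong suc (replicate-++-injective m i j ρ≤ σ≤ (∷-injectiveʳ eq))

partitions≤-unique : ∀ m n → Unique (partitions≤ m n)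
partitions≤-unique zero    zero    = [] ∷ []
partitions≤-unique zero    (suc n) = []
partitions≤-unique (suc m) n       = Unique.concat⁺
  (All.map⁺ (All.universal (λ i → Unique.map⁺ (λ {ρ} {σ} → ++-cancelˡ (replicate i (suc m)) ρ σ) (partitions≤-unique m (n ∸ i *ℕ suc m))) _))
  (AllPairs.map⁺ (AllPairs.map (λ {i} {j} → disjoint i j) (Unique.filter⁺ (λ i → i *ℕ suc m ≤? n) (Unique.upTo⁺ (suc n)))))
  where
  disjoint : ∀ i j → i ≢ j → ∀ {ν} → ¬ (ν ∈ map (replicate i (suc m) ++_) (partitions≤ m (n ∸ i *ℕ suc m)) ×
                                        ν ∈ map (replicate j (suc m) ++_) (partitions≤ m (n ∸ j *ℕ suc m)))
  disjoint i j i≢j (p , q) with ρ , ρ∈ , refl ← ∈-map⁻ (replicate i (suc m) ++_) p | σ , σ∈ , eq ← ∈-map⁻ (replicate j (suc m) ++_) q =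
    i≢j (replicate-++-injective m i j (Bounded.bounded (partitions≤-sound m _ ρ∈)) (Bounded.bounded (partitions≤-sound m _ σ∈)) eq)

record Partition (n : ℕ) (ν : List ℕ) : Set where
  field
    sorted   : AllPairs _≥_ ν
    positive : All NonZero ν
    size     : sum ν ≡ n

partitions-sound : ∀ {n ν} → ν ∈ partitions n → Partition n ν
partitions-sound {n} ν∈ = record { sorted = sorted ; positive = positive ; size = size }
  where open Bounded (partitions≤-sound n n ν∈)

parts≤sum : ∀ ν → All (_≤ sum ν) ν
parts≤sum []      = []
parts≤sum (a ∷ ν) = ℕ.m≤m+n a (sum ν) ∷ All.map (λ ≤s → ℕ.≤-trans ≤s (ℕ.m≤n+m (sum ν) a)) (parts≤sum ν)

partitions-complete : ∀ {n ν} → Partition n ν → ν ∈ partitions n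
partitions-complete {ν = ν} record { sorted = sorted ; positive = positive ; size = refl } =
  partitions≤-complete (sum ν) (sum ν) record { sorted = sorted ; positive = positive ; bounded = parts≤sum ν ; size = refl }

⊢⇒Partition : ∀ {n ν} → ν ⊢ n → Partition n ν
⊢⇒Partition p = record
  { sorted = Linked⇒AllPairs (λ x≥y y≥z → ℕ.≤-trans y≥z x≥y) decreasing ; positive = positive ; size = size }
  where open _⊢_ p

remove-here : ∀ a ν → remove a (a ∷ ν) ≡ just ν
remove-here a ν = cong (λ b → if b then just ν else mapMaybe (a ∷_) (remove a ν)) (dec-true (a ℕ.≟ a) refl)

remove-there : ∀ {a b} ν → b ≢ a → remove a (b ∷ ν) ≡ mapMaybe (b ∷_) (remove a ν)
remove-there {a} {b} ν b≢a = cong (λ t → if t then just ν else mapMaybe (b ∷_) (remove a ν)) (dec-false (b ℕ.≟ a) b≢a)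

-- The inverse of `remove` on decreasing lists. The two match partitions with those partitions that
-- have a given part `a`.
insert : ℕ → List ℕ → List ℕ
insert a []      = a ∷ []
insert a (b ∷ ν) = if does (b ≤? a) then a ∷ b ∷ ν else b ∷ insert a ν

insert-here : ∀ {a b} ν → b ≤ a → insert a (b ∷ ν) ≡ a ∷ b ∷ ν
insert-here {a} {b} ν b≤a = cong (λ t → if t then a ∷ b ∷ ν else b ∷ insert a ν) (dec-true (b ≤? a) b≤a)

insert-there : ∀ {a b} ν → ¬ b ≤ a → insert a (b ∷ ν) ≡ b ∷ insert a ν
insert-there {a} {b} ν b≰a = cong (λ t → if t then a ∷ b ∷ ν else b ∷ insert a ν) (dec-false (b ≤? a) b≰a)

remove-insert : ∀ a ν → remove a (insert a ν) ≡ just ν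
remove-insert a []      = remove-here a []
remove-insert a (b ∷ ν) = go (b ≤? a)
  where
  go : Dec (b ≤ a) → remove a (insert a (b ∷ ν)) ≡ just (b ∷ ν)
  go (yes b≤a) = trans (cong (remove a) (insert-here ν b≤a)) (remove-here a (b ∷ ν))
  go (no b≰a)  = trans (cong (remove a) (insert-there ν b≰a))
    (trans (remove-there (insert a ν) (λ { refl → b≰a ℕ.≤-refl })) (cong (mapMaybe (b ∷_)) (remove-insert a ν)))

insert-↭ : ∀ a ν → insert a ν ↭ a ∷ ν
insert-↭ a []      = Perm.refl
insert-↭ a (b ∷ ν) = go (b ≤? a)
  where
  go : Dec (b ≤ a) → insert a (b ∷ ν) ↭ a ∷ b ∷ ν
  go (yes b≤a) = Perm.↭-reflexive (insert-here ν b≤a)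
  go (no b≰a)  = Perm.trans (Perm.↭-reflexive (insert-there ν b≰a)) (Perm.trans (Perm.prep b (insert-↭ a ν)) (Perm.swap b a Perm.refl))

insert-sorted : ∀ a {ν} → AllPairs _≥_ ν → AllPairs _≥_ (insert a ν)
insert-sorted a {[]}    []        = [] ∷ []
insert-sorted a {b ∷ ν} (b≥ ∷ ν≥) = go (b ≤? a)
  where
  go : Dec (b ≤ a) → AllPairs _≥_ (insert a (b ∷ ν))
  go (yes b≤a) = subst (AllPairs _≥_) (sym (insert-here ν b≤a)) ((b≤a ∷ All.map (λ ≤b → ℕ.≤-trans ≤b b≤a) b≥) ∷ b≥ ∷ ν≥)
  go (no b≰a)  = subst (AllPairs _≥_) (sym (insert-there ν b≰a))
    (All-resp-↭ (Perm.↭-sym (insert-↭ a ν)) (ℕ.<⇒≤ (ℕ.≰⇒> b≰a) ∷ b≥) ∷ insert-sorted a ν≥)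

insert-partition : ∀ {a n ν} → NonZero a → Partition n ν → Partition (a +ℕ n) (insert a ν)
insert-partition {a} {n} {ν} a>0 record { sorted = sorted ; positive = positive ; size = refl } = record
  { sorted = insert-sorted a sorted ; positive = All-resp-↭ (Perm.↭-sym (insert-↭ a ν)) (a>0 ∷ positive) ; size = sum-↭ (insert-↭ a ν) }

remove-view : ∀ a b ν {μ} → remove a (b ∷ ν) ≡ just μ → (b ≡ a × ν ≡ μ) ⊎ (b ≢ a × ∃ λ μ′ → remove a ν ≡ just μ′ × μ ≡ b ∷ μ′)
remove-view a b ν {μ} eq = go (b ℕ.≟ a)
  where
  go′ : ∀ m → remove a ν ≡ m → mapMaybe (b ∷_) m ≡ just μ → ∃ λ μ′ → remove a ν ≡ just μ′ × μ ≡ b ∷ μ′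
  go′ (just μ′) eq′ refl = μ′ , eq′ , refl
  go : Dec (b ≡ a) → _
  go (yes refl) = inj₁ (refl , just-injective (trans (sym (remove-here a ν)) eq))
  go (no b≢a)   = inj₂ (b≢a , go′ (remove a ν) refl (trans (sym (remove-there ν b≢a)) eq))

remove-↭ : ∀ a ν {μ} → remove a ν ≡ just μ → ν ↭ a ∷ μ
remove-↭ a (b ∷ ν) eq with remove-view a b ν eq
... | inj₁ (refl , refl)            = Perm.refl
... | inj₂ (_ , μ′ , eq′ , refl)    = Perm.trans (Perm.prep b (remove-↭ a ν eq′)) (Perm.swap b a Perm.refl)

insert-remove : ∀ a ν {μ} → AllPairs _≥_ ν → remove a ν ≡ just μ → insert a μ ≡ ν × AllPairs _≥_ μ
insert-remove a (b ∷ ν) (b≥ ∷ ν≥) eq with remove-view a b ν eq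
insert-remove a (b ∷ [])    (b≥ ∷ ν≥)         eq | inj₁ (refl , refl) = refl , ν≥
insert-remove a (b ∷ c ∷ ν) ((b≥c ∷ b≥) ∷ ν≥) eq | inj₁ (refl , refl) = insert-here ν b≥c , ν≥
insert-remove a (b ∷ ν)     (b≥ ∷ ν≥)         eq | inj₂ (b≢a , μ′ , eq′ , refl) with insert-remove a ν ν≥ eq′ | All-resp-↭ (remove-↭ a ν eq′) b≥
... | ins , μ≥ | a≤b ∷ b≥μ′ = trans (insert-there μ′ (λ b≤a → b≢a (ℕ.≤-antisym b≤a a≤b))) (cong (b ∷_) ins) , b≥μ′ ∷ μ≥

remove-partition : ∀ {a n ν μ} → Partition n ν → remove a ν ≡ just μ → insert a μ ≡ ν × Partition (sum μ) μ × a +ℕ sum μ ≡ n × NonZero a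
remove-partition {a} {ν = ν} record { sorted = sorted ; positive = positive ; size = refl } eq
  with insert-remove a ν sorted eq | All-resp-↭ (remove-↭ a ν eq) positive
... | ins , sorted′ | a>0 ∷ positive′ =
  ins , record { sorted = sorted′ ; positive = positive′ ; size = refl } , sym (sum-↭ (remove-↭ a ν eq)) , a>0

-- Expansions in elementary symmetric functions

𝔼 : (List ℕ → ℚ) → PowerSeries
𝔼 c α = ∑ (partitions (sum α)) λ ν → c ν * e[ ν ] α

𝔼-cong : ∀ {c d} α → (∀ ν → Partition (sum α) ν → c ν ≡ d ν) → 𝔼 c α ≡ 𝔼 d α
𝔼-cong α h = ∑-cong-∈ (partitions (sum α)) λ {ν} ν∈ → cong (_* e[ ν ] α) (h ν (partitions-sound ν∈))

𝔼-+ : ∀ c d α → 𝔼 (λ ν → c ν + d ν) α ≡ 𝔼 c α + 𝔼 d α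
𝔼-+ c d α = trans (∑-cong (partitions (sum α)) (λ ν → ℚ.*-distribʳ-+ (e[ ν ] α) (c ν) (d ν)))
  (∑-distrib-+ (partitions (sum α)) (λ ν → c ν * e[ ν ] α) (λ ν → d ν * e[ ν ] α))

𝔼-* : ∀ q c α → 𝔼 (λ ν → q * c ν) α ≡ q * 𝔼 c α
𝔼-* q c α = trans (∑-cong (partitions (sum α)) (λ ν → ℚ.*-assoc q (c ν) (e[ ν ] α)))
  (sym (*-distribˡ-∑ (partitions (sum α)) q (λ ν → c ν * e[ ν ] α)))

𝔼-∑ : ∀ {A : Set} (xs : List A) (c : A → List ℕ → ℚ) α → 𝔼 (λ ν → ∑ xs (λ a → c a ν)) α ≡ ∑ xs (λ a → 𝔼 (c a) α)
𝔼-∑ xs c α = trans (∑-cong (partitions (sum α)) (λ ν → *-distribʳ-∑ xs (e[ ν ] α) (λ a → c a ν)))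
  (∑-swap (partitions (sum α)) xs (λ ν a → c a ν * e[ ν ] α))

ext : (List ℕ → ℚ) → Maybe (List ℕ) → ℚ
ext c nothing  = 0ℚ
ext c (just ν) = c ν

shift : ℕ → (List ℕ → ℚ) → List ℕ → ℚ
shift j c ν = ext c (remove j ν)

e[insert] : ∀ a ν α → e[ insert a ν ] α ≡ e[ a ∷ ν ] α
e[insert] a []      α = refl
e[insert] a (b ∷ ν) α = go (b ≤? a)
  where
  go : Dec (b ≤ a) → e[ insert a (b ∷ ν) ] α ≡ e[ a ∷ b ∷ ν ] α
  go (yes b≤a) = cong (λ ρ → e[ ρ ] α) (insert-here ν b≤a)
  go (no b≰a)  = trans (cong (λ ρ → e[ ρ ] α) (insert-there ν b≰a))
    (trans (*ₛ-congˡ α (e b) (e[insert] a ν))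
    (trans (sym (*ₛ-assoc α (e b) (e a) e[ ν ])) (trans (*ₛ-congʳ α e[ ν ] (λ β → *ₛ-comm β (e b) (e a))) (*ₛ-assoc α (e a) (e b) e[ ν ]))))

-- `insert j` maps the partitions of `n` bijectively to the partitions of `j + n` with a part `j`;
-- on all other partitions of `j + n` the shifted coefficient is 0.
∑-shift : ∀ j n c α → NonZero j →
  ∑ (partitions n) (λ μ → c μ * e[ j ∷ μ ] α) ≡ ∑ (partitions (j +ℕ n)) (λ ν → shift j c ν * e[ ν ] α)
∑-shift j n c α j>0 = begin
  ∑ (partitions n) (λ μ → c μ * e[ j ∷ μ ] α)
    ≡⟨ ∑-cong (partitions n) (λ μ → cong₂ _*_ (cong (ext c) (remove-insert j μ)) (e[insert] j μ α)) ⟨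
  ∑ (partitions n) (λ μ → term (insert j μ))
    ≡⟨ ∑-map (partitions n) (insert j) term ⟨
  ∑ (map (insert j) (partitions n)) term
    ≡⟨ ∑-↭ term (unique-complete⇒↭ (Unique.map⁺ insert-injective (partitions≤-unique n n))
         (Unique.filter⁺ removable? (partitions≤-unique (j +ℕ n) (j +ℕ n))) ⊆ ⊇) ⟩
  ∑ (filter removable? (partitions (j +ℕ n))) term
    ≡⟨ ∑-filter removable? (partitions (j +ℕ n)) term (λ ν ¬r → trans (cong (_* e[ ν ] α) (unremovable ν (remove j ν) refl ¬r)) (ℚ.*-zeroˡ (e[ ν ] α))) ⟩
  ∑ (partitions (j +ℕ n)) term ∎
  where
  open ≡-Reasoning
  term : List ℕ → ℚ
  term ν = shift j c ν * e[ ν ] α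
  Removable : List ℕ → Set
  Removable ν = ∃ λ μ → remove j ν ≡ just μ
  isJust? : ∀ (m : Maybe (List ℕ)) → Dec (∃ λ μ → m ≡ just μ)
  isJust? nothing  = no λ ()
  isJust? (just μ) = yes (μ , refl)
  removable? : ∀ ν → Dec (Removable ν)
  removable? ν = isJust? (remove j ν)
  unremovable : ∀ ν m → remove j ν ≡ m → ¬ Removable ν → ext c m ≡ 0ℚ
  unremovable ν nothing  eq ¬r = refl
  unremovable ν (just μ) eq ¬r = ⊥-elim (¬r (μ , eq))
  insert-injective : ∀ {μ ρ} → insert j μ ≡ insert j ρ → μ ≡ ρ
  insert-injective {μ} {ρ} eq = just-injective (trans (sym (remove-insert j μ)) (trans (cong (remove j) eq) (remove-insert j ρ)))
  ⊆ : ∀ {ν} → ν ∈ map (insert j) (partitions n) → ν ∈ filter removable? (partitions (j +ℕ n))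
  ⊆ ν∈ with μ , μ∈ , refl ← ∈-map⁻ (insert j) ν∈ =
    ∈-filter⁺ removable? (partitions-complete (insert-partition j>0 (partitions-sound μ∈))) (μ , remove-insert j μ)
  ⊇ : ∀ {ν} → ν ∈ filter removable? (partitions (j +ℕ n)) → ν ∈ map (insert j) (partitions n)
  ⊇ ν∈ with ν∈′ , μ , eq ← ∈-filter⁻ removable? {xs = partitions (j +ℕ n)} ν∈
       with refl , p , size , _ ← remove-partition (partitions-sound ν∈′) eq
       with refl ← ℕ.+-cancelˡ-≡ j (sum μ) n size = ∈-map⁺ (insert j) (partitions-complete p)

e*𝔼 : ∀ j c α → NonZero j → (e j *ₛ 𝔼 c) α ≡ 𝔼 (shift j c) α
e*𝔼 j c α j>0 = go (j ≤? sum α)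
  where
  open ≡-Reasoning
  go : Dec (j ≤ sum α) → (e j *ₛ 𝔼 c) α ≡ 𝔼 (shift j c) α
  go (yes j≤) = begin
    (e j *ₛ 𝔼 c) α
      ≡⟨ homogeneous-*-cong α (𝔼 c) (λ γ → ∑ (partitions n) (λ μ → c μ * e[ μ ] γ)) (homogeneous-e j)
           (λ γ eq → cong (λ k → ∑ (partitions k) (λ μ → c μ * e[ μ ] γ)) (ℕ.+-cancelˡ-≡ j (sum γ) n (trans eq (sym j+n)))) ⟩
    ∑ (splits α) (λ (β , γ) → e j β * ∑ (partitions n) (λ μ → c μ * e[ μ ] γ))
      ≡⟨ ∑-cong (splits α) (λ (β , γ) → *-distribˡ-∑ (partitions n) (e j β) (λ μ → c μ * e[ μ ] γ)) ⟩
    ∑ (splits α) (λ (β , γ) → ∑ (partitions n) (λ μ → e j β * (c μ * e[ μ ] γ)))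
      ≡⟨ ∑-swap (splits α) (partitions n) (λ (β , γ) μ → e j β * (c μ * e[ μ ] γ)) ⟩
    ∑ (partitions n) (λ μ → ∑ (splits α) (λ (β , γ) → e j β * (c μ * e[ μ ] γ)))
      ≡⟨ ∑-cong (partitions n) (λ μ → trans (∑-cong (splits α) (λ (β , γ) → left-comm (e j β) (c μ) (e[ μ ] γ)))
           (sym (*-distribˡ-∑ (splits α) (c μ) (λ (β , γ) → e j β * e[ μ ] γ)))) ⟩
    ∑ (partitions n) (λ μ → c μ * e[ j ∷ μ ] α)
      ≡⟨ ∑-shift j n c α j>0 ⟩
    ∑ (partitions (j +ℕ n)) (λ ν → shift j c ν * e[ ν ] α)
      ≡⟨ cong (λ k → ∑ (partitions k) (λ ν → shift j c ν * e[ ν ] α)) j+n ⟩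
    𝔼 (shift j c) α ∎
    where
    n = sum α ∸ j
    j+n : j +ℕ n ≡ sum α
    j+n = ℕ.m+[n∸m]≡n j≤
    open Data.Rational.Solver.+-*-Solver
    left-comm : ∀ p q r → p * (q * r) ≡ q * (p * r)
    left-comm = solve 3 (λ p q r → p :* (q :* r) := q :* (p :* r)) refl
  -- In degrees below `j` the product has no terms, and no partition has a part `j`.
  go (no j≰) = trans (homogeneous-*-zero α (𝔼 c) (homogeneous-e j) (λ γ eq → ⊥-elim (j≰ (subst (j ≤_) eq (ℕ.m≤m+n j (sum γ))))))
    (sym (∑-zero (partitions (sum α)) λ {ν} ν∈ → trans (cong (_* e[ ν ] α) (absent ν (remove j ν) refl ν∈)) (ℚ.*-zeroˡ (e[ ν ] α))))
    where
    absent : ∀ ν m → remove j ν ≡ m → ν ∈ partitions (sum α) → ext c m ≡ 0ℚ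
    absent ν nothing  eq ν∈ = refl
    absent ν (just μ) eq ν∈ with _ , _ , size , _ ← remove-partition (partitions-sound ν∈) eq =
      ⊥-elim (j≰ (subst (j ≤_) size (ℕ.m≤m+n j (sum μ))))

e-E : ∀ k α → sum α ≡ k → e k α ≡ E α
e-E k α eq = cong (λ b → if b then 1ℚ else 0ℚ)
  (does-⇔ (mk⇔ proj₁ (λ a → a , eq)) (allList? (_≤? 1) α ×-dec (sum α ℕ.≟ k)) (allList? (_≤? 1) α))

∑-upTo-single : ∀ n k (f : ℕ → ℚ) → k < n → (∀ j → j ≢ k → f j ≡ 0ℚ) → ∑ (upTo n) f ≡ f k
∑-upTo-single (suc n) zero    f _         h = trans (∑-upTo-suc n f)
  (trans (cong (λ r → f 0 + r) (∑-zero (upTo n) (λ {j} _ → h (suc j) λ ()))) (ℚ.+-identityʳ (f 0)))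
∑-upTo-single (suc n) (suc k) f (s≤s k<n) h = trans (∑-upTo-suc n f)
  (trans (cong₂ _+_ (h 0 (λ ())) (∑-upTo-single n k (f ∘ suc) k<n (λ j j≢k → h (suc j) (λ { refl → j≢k refl })))) (ℚ.+-identityˡ (f (suc k))))

-- The common shape `Σ φ(j) e_j` of the multipliers of `F`, namely `E`, `D E` and `D (D E) - D E`.
weightedE : (ℕ → ℚ) → PowerSeries
weightedE φ α = φ (sum α) * E α

-- Only the `e j` of the degree of `β` contributes, so every cutoff `n` above that degree works; a
-- cutoff common to all splits of a monomial allows the sums to be exchanged.
weightedE≡∑e : ∀ φ n β → sum β ≤ n → weightedE φ β ≡ ∑ (upTo (suc n)) (λ j → φ j * e j β)
weightedE≡∑e φ n β ≤n = sym (trans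
  (∑-upTo-single (suc n) (sum β) (λ j → φ j * e j β) (s≤s ≤n)
    (λ j j≢ → trans (cong (φ j *_) (homogeneous-e j β (j≢ ∘ sym))) (ℚ.*-zeroʳ (φ j))))
  (cong (φ (sum β) *_) (e-E (sum β) β refl)))

weightedE-* : ∀ φ g α → (weightedE φ *ₛ g) α ≡ ∑ (upTo (suc (sum α))) (λ j → φ j * (e j *ₛ g) α)
weightedE-* φ g α = begin
  (weightedE φ *ₛ g) α
    ≡⟨ ∑-cong-∈ (splits α) (λ {(β , γ)} p → cong (_* g γ) (weightedE≡∑e φ n β (subst (sum β ≤_) (splits-sum α p) (ℕ.m≤m+n (sum β) (sum γ))))) ⟩
  ∑ (splits α) (λ (β , γ) → ∑ (upTo (suc n)) (λ j → φ j * e j β) * g γ)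
    ≡⟨ ∑-cong (splits α) (λ (β , γ) → trans (*-distribʳ-∑ (upTo (suc n)) (g γ) (λ j → φ j * e j β))
         (∑-cong (upTo (suc n)) (λ j → ℚ.*-assoc (φ j) (e j β) (g γ)))) ⟩
  ∑ (splits α) (λ (β , γ) → ∑ (upTo (suc n)) (λ j → φ j * (e j β * g γ)))
    ≡⟨ ∑-swap (splits α) (upTo (suc n)) (λ (β , γ) j → φ j * (e j β * g γ)) ⟩
  ∑ (upTo (suc n)) (λ j → ∑ (splits α) (λ (β , γ) → φ j * (e j β * g γ)))
    ≡⟨ ∑-cong (upTo (suc n)) (λ j → *-distribˡ-∑ (splits α) (φ j) (λ (β , γ) → e j β * g γ)) ⟨
  ∑ (upTo (suc n)) (λ j → φ j * (e j *ₛ g) α) ∎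
  where
  open ≡-Reasoning
  n = sum α

-- The term with `e 0 = 1` is kept apart: 0 is never a part of a partition, so this term is no
-- shift.
weightedE*𝔼 : ∀ φ c α → (weightedE φ *ₛ 𝔼 c) α ≡ 𝔼 (λ ν → φ 0 * c ν + ∑ (upTo (sum ν)) (λ j → φ (suc j) * shift (suc j) c ν)) α
weightedE*𝔼 φ c α = begin
  (weightedE φ *ₛ 𝔼 c) α
    ≡⟨ weightedE-* φ (𝔼 c) α ⟩
  ∑ (upTo (suc (sum α))) (λ j → φ j * (e j *ₛ 𝔼 c) α)
    ≡⟨ ∑-upTo-suc (sum α) (λ j → φ j * (e j *ₛ 𝔼 c) α) ⟩
  φ 0 * (e 0 *ₛ 𝔼 c) α + ∑ (upTo (sum α)) (λ j → φ (suc j) * (e (suc j) *ₛ 𝔼 c) α)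
    ≡⟨ cong₂ _+_ (cong (φ 0 *_) (trans (*ₛ-congʳ α (𝔼 c) e₀) (*ₛ-identityˡ α (𝔼 c))))
         (∑-cong (upTo (sum α)) (λ j → trans (cong (φ (suc j) *_) (e*𝔼 (suc j) c α _)) (sym (𝔼-* (φ (suc j)) (shift (suc j) c) α)))) ⟩
  φ 0 * 𝔼 c α + ∑ (upTo (sum α)) (λ j → 𝔼 (λ ν → φ (suc j) * shift (suc j) c ν) α)
    ≡⟨ cong₂ _+_ (𝔼-* (φ 0) c α) (𝔼-∑ (upTo (sum α)) (λ j ν → φ (suc j) * shift (suc j) c ν) α) ⟨
  𝔼 (λ ν → φ 0 * c ν) α + 𝔼 (λ ν → ∑ (upTo (sum α)) (λ j → φ (suc j) * shift (suc j) c ν)) α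
    ≡⟨ 𝔼-+ (λ ν → φ 0 * c ν) (λ ν → ∑ (upTo (sum α)) (λ j → φ (suc j) * shift (suc j) c ν)) α ⟨
  𝔼 (λ ν → φ 0 * c ν + ∑ (upTo (sum α)) (λ j → φ (suc j) * shift (suc j) c ν)) α
    ≡⟨ 𝔼-cong α (λ ν p → cong (λ n → φ 0 * c ν + ∑ (upTo n) (λ j → φ (suc j) * shift (suc j) c ν)) (sym (Partition.size p))) ⟩
  𝔼 (λ ν → φ 0 * c ν + ∑ (upTo (sum ν)) (λ j → φ (suc j) * shift (suc j) c ν)) α ∎
  where open ≡-Reasoning

-- The recursion for ε

mult-here : ∀ j ν → mult j (j ∷ ν) ≡ suc (mult j ν)
mult-here j ν = cong length (filter-accept (ℕ._≟ j) {j} {ν} refl)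

mult-there : ∀ {j b} ν → b ≢ j → mult j (b ∷ ν) ≡ mult j ν
mult-there {j} {b} ν b≢j = cong length (filter-reject (ℕ._≟ j) {b} {ν} b≢j)

mult-↭ : ∀ j {ν μ} → ν ↭ μ → mult j ν ≡ mult j μ
mult-↭ j p = ↭-length (filter-↭ (ℕ._≟ j) p)

mult-above : ∀ j ν → sum ν < j → mult j ν ≡ 0
mult-above j []      _  = refl
mult-above j (b ∷ ν) <j = trans (mult-there {j} {b} ν (λ { refl → ℕ.<⇒≱ <j (ℕ.m≤m+n b (sum ν)) }))
  (mult-above j ν (ℕ.≤-<-trans (ℕ.m≤n+m (sum ν) b) <j))

remove-nothing : ∀ a ν → mult a ν ≡ 0 → remove a ν ≡ nothing
remove-nothing a []      _  = refl
remove-nothing a (b ∷ ν) ≡0 = go (b ℕ.≟ a)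
  where
  go : Dec (b ≡ a) → remove a (b ∷ ν) ≡ nothing
  go (yes refl) = ⊥-elim (ℕ.1+n≢0 (trans (sym (mult-here b ν)) ≡0))
  go (no b≢a)   = trans (remove-there ν b≢a) (cong (mapMaybe (b ∷_)) (remove-nothing a ν (trans (sym (mult-there ν b≢a)) ≡0)))

remove-just : ∀ a ν {m} → mult a ν ≡ suc m → ∃ λ μ → remove a ν ≡ just μ
remove-just a (b ∷ ν) ≡s = go (b ℕ.≟ a)
  where
  go : Dec (b ≡ a) → ∃ λ μ → remove a (b ∷ ν) ≡ just μ
  go (yes refl) = ν , remove-here b ν
  go (no b≢a) with μ , eq ← remove-just a ν (trans (sym (mult-there ν b≢a)) ≡s) =
    b ∷ μ , trans (remove-there ν b≢a) (cong (mapMaybe (b ∷_)) eq)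

∏-cong : {A : Set} (xs : List A) {f g : A → ℚ} → (∀ x → f x ≡ g x) → ∏ xs f ≡ ∏ xs g
∏-cong []       h = refl
∏-cong (x ∷ xs) h = cong₂ _*_ (h x) (∏-cong xs h)

∏-filter : {A : Set} {P : A → Set} (P? : ∀ x → Dec (P x)) (xs : List A) (f : A → ℚ) →
  (∀ x → ¬ P x → f x ≡ 1ℚ) → ∏ (filter P? xs) f ≡ ∏ xs f
∏-filter P? []       f h = refl
∏-filter P? (x ∷ xs) f h with P? x
... | yes _ = cong (f x *_) (∏-filter P? xs f h)
... | no ¬p = trans (∏-filter P? xs f h) (sym (trans (cong (_* ∏ xs f) (h x ¬p)) (ℚ.*-identityˡ (∏ xs f))))

∏-map : {A B : Set} (xs : List A) (h : A → B) (f : B → ℚ) → ∏ (map h xs) f ≡ ∏ xs (f ∘ h)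
∏-map []       h f = refl
∏-map (x ∷ xs) h f = cong (f (h x) *_) (∏-map xs h f)

∏-upTo-suc : ∀ n (f : ℕ → ℚ) → ∏ (upTo (suc n)) f ≡ f 0 * ∏ (upTo n) (f ∘ suc)
∏-upTo-suc n f = cong (f 0 *_) (trans (cong (λ xs → ∏ xs f) (sym (map-upTo suc n))) (∏-map (upTo n) suc f))

∏-upTo-extend : ∀ k {n} (f : ℕ → ℚ) → k ≤ n → (∀ j → k ≤ j → f j ≡ 1ℚ) → ∏ (upTo k) f ≡ ∏ (upTo n) f
∏-upTo-extend zero    {zero}  f _         h = refl
∏-upTo-extend zero    {suc n} f _         h = trans (∏-upTo-extend zero {n} (f ∘ suc) z≤n (λ j _ → h (suc j) z≤n))
  (sym (trans (∏-upTo-suc n f) (trans (cong (_* ∏ (upTo n) (f ∘ suc)) (h 0 z≤n)) (ℚ.*-identityˡ _))))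
∏-upTo-extend (suc k) {suc n} f (s≤s k≤n) h = trans (∏-upTo-suc k f)
  (trans (cong (f 0 *_) (∏-upTo-extend k (f ∘ suc) k≤n (λ j k≤j → h (suc j) (s≤s k≤j)))) (sym (∏-upTo-suc n f)))

-- Two products that differ in a single factor; the cross-multiplied hypothesis `f a * q ≡ r * g a`
-- avoids dividing by factors that may be 0.
∏-upTo-change : ∀ n a (f g : ℕ → ℚ) q r → a < n → (∀ j → j ≢ a → f j ≡ g j) → f a * q ≡ r * g a →
  ∏ (upTo n) f * q ≡ r * ∏ (upTo n) g
∏-upTo-change (suc n) zero f g q r _ same eq = begin
  ∏ (upTo (suc n)) f * q             ≡⟨ cong (_* q) (∏-upTo-suc n f) ⟩
  f 0 * ∏ (upTo n) (f ∘ suc) * q     ≡⟨ solve 3 (λ a b c → a :* b :* c := a :* c :* b) refl (f 0) _ q ⟩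
  f 0 * q * ∏ (upTo n) (f ∘ suc)     ≡⟨ cong₂ _*_ eq (∏-cong (upTo n) (λ j → same (suc j) λ ())) ⟩
  r * g 0 * ∏ (upTo n) (g ∘ suc)     ≡⟨ ℚ.*-assoc r (g 0) _ ⟩
  r * (g 0 * ∏ (upTo n) (g ∘ suc))   ≡⟨ cong (r *_) (∏-upTo-suc n g) ⟨
  r * ∏ (upTo (suc n)) g             ∎
  where
  open ≡-Reasoning
  open Data.Rational.Solver.+-*-Solver
∏-upTo-change (suc n) (suc a) f g q r (s≤s a<n) same eq = begin
  ∏ (upTo (suc n)) f * q             ≡⟨ cong (_* q) (∏-upTo-suc n f) ⟩
  f 0 * ∏ (upTo n) (f ∘ suc) * q     ≡⟨ ℚ.*-assoc (f 0) _ q ⟩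
  f 0 * (∏ (upTo n) (f ∘ suc) * q)   ≡⟨ cong₂ _*_ (same 0 λ ()) (∏-upTo-change n a (f ∘ suc) (g ∘ suc) q r a<n (λ j j≢a → same (suc j) (λ { refl → j≢a refl })) eq) ⟩
  g 0 * (r * ∏ (upTo n) (g ∘ suc))   ≡⟨ solve 3 (λ a b c → a :* (b :* c) := b :* (a :* c)) refl (g 0) r _ ⟩
  r * (g 0 * ∏ (upTo n) (g ∘ suc))   ≡⟨ cong (r *_) (∏-upTo-suc n g) ⟨
  r * ∏ (upTo (suc n)) g             ∎
  where
  open ≡-Reasoning
  open Data.Rational.Solver.+-*-Solver

-- The factor of `ε` belonging to the part size `j`. It is 1 for multiplicity 0, so the product over
-- the support extends to any larger range.
factor : ℕ → ℕ → ℚ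
factor j m = _/_ ((+ j -ℤ 1ℤ) ^ℤ m) (m !) {{m ℕ.!≢0}}

fraction-suc : ∀ (z p : ℤ) k m n {{_ : NonZero m}} {{_ : NonZero n}} → n ≡ suc k *ℕ m →
  ((z *ℤ p) / n) * fromℕ (suc k) ≡ ι z * (p / m)
fraction-suc z p k (suc m) (suc n) eq = ℚ.toℚᵘ-injective (begin
  toℚᵘ (((z *ℤ p) / suc n) * fromℕ (suc k))
    ≈⟨ ℚ.toℚᵘ-homo-* ((z *ℤ p) / suc n) (fromℕ (suc k)) ⟩
  toℚᵘ ((z *ℤ p) / suc n) ℚᵘ.* toℚᵘ (fromℕ (suc k))
    ≈⟨ ℚᵘ.*-cong (ℚ.toℚᵘ-fromℚᵘ (ℚᵘ.mkℚᵘ (z *ℤ p) n)) (ℚ.toℚᵘ-fromℚᵘ (ℚᵘ.mkℚᵘ (+ suc k) 0)) ⟩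
  ℚᵘ.mkℚᵘ (z *ℤ p) n ℚᵘ.* ℚᵘ.mkℚᵘ (+ suc k) 0
    ≈⟨ ℚᵘ.*≡* numerators ⟩
  ℚᵘ.mkℚᵘ z 0 ℚᵘ.* ℚᵘ.mkℚᵘ p m
    ≈⟨ ℚᵘ.*-cong (ℚ.toℚᵘ-fromℚᵘ (ℚᵘ.mkℚᵘ z 0)) (ℚ.toℚᵘ-fromℚᵘ (ℚᵘ.mkℚᵘ p m)) ⟨
  toℚᵘ (ι z) ℚᵘ.* toℚᵘ (p / suc m)
    ≈⟨ ℚ.toℚᵘ-homo-* (ι z) (p / suc m) ⟨
  toℚᵘ (ι z * (p / suc m)) ∎)
  where
  open import Relation.Binary.Reasoning.Setoid ℚᵘ.≃-setoid
  numerators : z *ℤ p *ℤ + suc k *ℤ + (1 *ℕ suc m) ≡ z *ℤ p *ℤ + (suc n *ℕ 1)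
  numerators = trans (ℤ.*-assoc (z *ℤ p) (+ suc k) (+ (1 *ℕ suc m))) (cong (z *ℤ p *ℤ_)
    (trans (sym (ℤ.pos-* (suc k) (1 *ℕ suc m))) (cong +_ (trans (cong (suc k *ℕ_) (ℕ.*-identityˡ (suc m))) (trans (sym eq) (sym (ℕ.*-identityʳ (suc n))))))))

factor-suc : ∀ j m → factor j (suc m) * fromℕ (suc m) ≡ ι (+ j -ℤ 1ℤ) * factor j m
factor-suc j m = fraction-suc (+ j -ℤ 1ℤ) ((+ j -ℤ 1ℤ) ^ℤ m) m (m !) (suc m !) {{m ℕ.!≢0}} {{suc m ℕ.!≢0}} refl

ε-∏ : ∀ K ν → sum ν < K → ε ν ≡ fromℕ (length ν !) * ∏ (upTo K) (λ j → factor j (mult j ν))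
ε-∏ K ν <K = cong (fromℕ (length ν !) *_)
  (trans (∏-filter (λ j → 1 ≤? mult j ν) (upTo (suc (sum ν))) (λ j → factor j (mult j ν))
           (λ j ≱1 → cong (factor j) (ℕ.n<1⇒n≡0 (ℕ.≰⇒> ≱1))))
         (∏-upTo-extend (suc (sum ν)) (λ j → factor j (mult j ν)) <K (λ j <j → cong (factor j) (mult-above j ν <j))))

ε-↭ : ∀ {ν μ} → ν ↭ μ → ε ν ≡ ε μ
ε-↭ {ν} {μ} p = trans (ε-∏ K ν ℕ.≤-refl) (trans
  (cong₂ _*_ (cong (λ n → fromℕ (n !)) (↭-length p)) (∏-cong (upTo K) (λ j → cong (factor j) (mult-↭ j p))))
  (sym (ε-∏ K μ (s≤s (ℕ.≤-reflexive (sym (sum-↭ p)))))))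
  where K = suc (sum ν)

-- Removing a part `a` of multiplicity m turns `ℓ!` into `(ℓ - 1)!` and `(a - 1)^m / m!` into
-- `(a - 1)^(m - 1) / (m - 1)!`; the other factors stay.
ε-remove : ∀ a {ν μ} → ν ↭ a ∷ μ → ε ν * fromℕ (mult a ν) ≡ fromℕ (length ν) * (ι (+ a -ℤ 1ℤ) * ε μ)
ε-remove a {ν} {μ} p = begin
  ε ν * fromℕ (mult a ν)
    ≡⟨ cong₂ _*_ (ε-∏ K ν ℕ.≤-refl) (cong fromℕ mult-a) ⟩
  fromℕ (length ν !) * ∏ (upTo K) (λ j → factor j (mult j ν)) * fromℕ (suc (mult a μ))
    ≡⟨ ℚ.*-assoc (fromℕ (length ν !)) _ _ ⟩
  fromℕ (length ν !) * (∏ (upTo K) (λ j → factor j (mult j ν)) * fromℕ (suc (mult a μ)))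
    ≡⟨ cong₂ _*_ (cong (λ n → fromℕ (n !)) (↭-length p))
         (∏-upTo-change K a (λ j → factor j (mult j ν)) (λ j → factor j (mult j μ)) (fromℕ (suc (mult a μ))) (ι (+ a -ℤ 1ℤ))
           a<K (λ j j≢a → cong (factor j) (trans (mult-↭ j p) (mult-there μ (j≢a ∘ sym))))
           (trans (cong (λ m → factor a m * fromℕ (suc (mult a μ))) mult-a) (factor-suc a (mult a μ)))) ⟩
  fromℕ (suc (length μ) *ℕ length μ !) * (ι (+ a -ℤ 1ℤ) * ∏ (upTo K) (λ j → factor j (mult j μ)))
    ≡⟨ cong (_* (ι (+ a -ℤ 1ℤ) * ∏ (upTo K) (λ j → factor j (mult j μ))))
         (trans (cong ι (ℤ.pos-* (suc (length μ)) (length μ !))) (ι-* (+ suc (length μ)) (+ (length μ !)))) ⟩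
  fromℕ (suc (length μ)) * fromℕ (length μ !) * (ι (+ a -ℤ 1ℤ) * ∏ (upTo K) (λ j → factor j (mult j μ)))
    ≡⟨ solve 4 (λ a b c d → a :* b :* (c :* d) := a :* (c :* (b :* d))) refl (fromℕ (suc (length μ))) (fromℕ (length μ !)) (ι (+ a -ℤ 1ℤ)) _ ⟩
  fromℕ (suc (length μ)) * (ι (+ a -ℤ 1ℤ) * (fromℕ (length μ !) * ∏ (upTo K) (λ j → factor j (mult j μ))))
    ≡⟨ cong₂ _*_ (cong fromℕ (↭-length p)) (cong (ι (+ a -ℤ 1ℤ) *_) (ε-∏ K μ μ<K)) ⟨
  fromℕ (length ν) * (ι (+ a -ℤ 1ℤ) * ε μ) ∎
  where
  open ≡-Reasoning
  open Data.Rational.Solver.+-*-Solver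
  K = suc (sum ν)
  mult-a : mult a ν ≡ suc (mult a μ)
  mult-a = trans (mult-↭ a p) (mult-here a μ)
  a<K : a < K
  a<K = s≤s (subst (a ≤_) (sym (sum-↭ p)) (ℕ.m≤m+n a (sum μ)))
  μ<K : sum μ < K
  μ<K = s≤s (subst (sum μ ≤_) (sym (sum-↭ p)) (ℕ.m≤n+m (sum μ) a))

fromℕ-cancel : ∀ n {p q} → fromℕ (suc n) * p ≡ fromℕ (suc n) * q → p ≡ q
fromℕ-cancel n {p} {q} eq = trans (sym (inv p)) (trans (cong (1/ r *_) eq) (inv q))
  where
  r = fromℕ (suc n)
  instance
    r≢0 : Data.Rational.NonZero r
    r≢0 = ℚ.pos⇒nonZero r {{ℚ.normalize-pos (suc n) 1}}
  inv : ∀ p → 1/ r * (r * p) ≡ p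
  inv p = trans (sym (ℚ.*-assoc (1/ r) r p)) (trans (cong (_* p) (ℚ.*-inverseˡ r)) (ℚ.*-identityˡ p))

∑-mult : ∀ K ν → All NonZero ν → All (_≤ K) ν → ∑ (upTo K) (λ j → fromℕ (mult (suc j) ν)) ≡ fromℕ (length ν)
∑-mult K []          _         _        = ∑-zero (upTo K) (λ _ → refl)
∑-mult K (suc b ∷ ν) (_ ∷ ν>0) (b<K ∷ ν≤) = begin
  ∑ (upTo K) (λ j → fromℕ (mult (suc j) (suc b ∷ ν)))
    ≡⟨ ∑-cong (upTo K) (λ j → split j (j ℕ.≟ b)) ⟩
  ∑ (upTo K) (λ j → single j (j ℕ.≟ b) + fromℕ (mult (suc j) ν))
    ≡⟨ ∑-distrib-+ (upTo K) (λ j → single j (j ℕ.≟ b)) (λ j → fromℕ (mult (suc j) ν)) ⟩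
  ∑ (upTo K) (λ j → single j (j ℕ.≟ b)) + ∑ (upTo K) (λ j → fromℕ (mult (suc j) ν))
    ≡⟨ cong₂ _+_ (trans (∑-upTo-single K b (λ j → single j (j ℕ.≟ b)) b<K (λ j → off j (j ℕ.≟ b))) (on (b ℕ.≟ b))) (∑-mult K ν ν>0 ν≤) ⟩
  1ℚ + fromℕ (length ν)
    ≡⟨ fromℕ-+ 1 (length ν) ⟨
  fromℕ (suc (length ν)) ∎
  where
  open ≡-Reasoning
  single : ∀ j → Dec (j ≡ b) → ℚ
  single j (yes _) = 1ℚ
  single j (no _)  = 0ℚ
  split : ∀ j (d : Dec (j ≡ b)) → fromℕ (mult (suc j) (suc b ∷ ν)) ≡ single j d + fromℕ (mult (suc j) ν)
  split j (yes refl) = trans (cong fromℕ (mult-here (suc b) ν)) (fromℕ-+ 1 (mult (suc b) ν))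
  split j (no j≢b)   = trans (cong fromℕ (mult-there ν (j≢b ∘ sym ∘ ℕ.suc-injective))) (sym (ℚ.+-identityˡ _))
  off : ∀ j (d : Dec (j ≡ b)) → j ≢ b → single j d ≡ 0ℚ
  off j (yes eq) j≢b = ⊥-elim (j≢b eq)
  off j (no _)   _   = refl
  on : ∀ (d : Dec (b ≡ b)) → single b d ≡ 1ℚ
  on (yes _)  = refl
  on (no b≢b) = ⊥-elim (b≢b refl)

-- Sum `ε-remove` over all part sizes: the multiplicities add up to the length, which then cancels.
ε-recursion : ∀ K a ν → All NonZero (a ∷ ν) → sum (a ∷ ν) ≤ K →
  ε (a ∷ ν) ≡ ∑ (upTo K) (λ j → ι (+ suc j -ℤ 1ℤ) * shift (suc j) ε (a ∷ ν))
ε-recursion K a ν >0 ≤K = fromℕ-cancel (length ν) (begin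
  fromℕ (length λ′) * ε λ′
    ≡⟨ cong (_* ε λ′) (∑-mult K λ′ >0 (All.map (λ ≤s → ℕ.≤-trans ≤s ≤K) (parts≤sum λ′))) ⟨
  ∑ (upTo K) (λ j → fromℕ (mult (suc j) λ′)) * ε λ′
    ≡⟨ *-distribʳ-∑ (upTo K) (ε λ′) (λ j → fromℕ (mult (suc j) λ′)) ⟩
  ∑ (upTo K) (λ j → fromℕ (mult (suc j) λ′) * ε λ′)
    ≡⟨ ∑-cong (upTo K) (λ j → term (suc j) (mult (suc j) λ′) refl) ⟩
  ∑ (upTo K) (λ j → fromℕ (length λ′) * (ι (+ suc j -ℤ 1ℤ) * shift (suc j) ε λ′))
    ≡⟨ *-distribˡ-∑ (upTo K) (fromℕ (length λ′)) (λ j → ι (+ suc j -ℤ 1ℤ) * shift (suc j) ε λ′) ⟨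
  fromℕ (length λ′) * ∑ (upTo K) (λ j → ι (+ suc j -ℤ 1ℤ) * shift (suc j) ε λ′) ∎)
  where
  open ≡-Reasoning
  λ′ = a ∷ ν
  term : ∀ j m → mult j λ′ ≡ m → fromℕ (mult j λ′) * ε λ′ ≡ fromℕ (length λ′) * (ι (+ j -ℤ 1ℤ) * shift j ε λ′)
  term j zero    eq = trans (cong (λ m → fromℕ m * ε λ′) eq) (trans (ℚ.*-zeroˡ (ε λ′)) (sym
    (trans (cong (λ m → fromℕ (length λ′) * (ι (+ j -ℤ 1ℤ) * ext ε m)) (remove-nothing j λ′ eq))
      (trans (cong (fromℕ (length λ′) *_) (ℚ.*-zeroʳ (ι (+ j -ℤ 1ℤ)))) (ℚ.*-zeroʳ (fromℕ (length λ′)))))))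
  term j (suc m) eq with μ , rem ← remove-just j λ′ eq =
    trans (ℚ.*-comm (fromℕ (mult j λ′)) (ε λ′)) (trans (ε-remove j (remove-↭ j λ′ rem))
      (cong (λ m → fromℕ (length λ′) * (ι (+ j -ℤ 1ℤ) * ext ε m)) (sym rem)))

-- In `ε-remove` the part 1 has the weight `1 - 1`.
ε-1∈ : ∀ ν {m} → mult 1 ν ≡ suc m → ε ν ≡ 0ℚ
ε-1∈ ν {m} eq with μ , rem ← remove-just 1 ν eq = fromℕ-cancel m (begin
  fromℕ (suc m) * ε ν                      ≡⟨ ℚ.*-comm (fromℕ (suc m)) (ε ν) ⟩
  ε ν * fromℕ (suc m)                      ≡⟨ cong (λ n → ε ν * fromℕ n) eq ⟨
  ε ν * fromℕ (mult 1 ν)                   ≡⟨ ε-remove 1 (remove-↭ 1 ν rem) ⟩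
  fromℕ (length ν) * (ι (+ 1 -ℤ 1ℤ) * ε μ) ≡⟨ cong (fromℕ (length ν) *_) (ℚ.*-zeroˡ (ε μ)) ⟩
  fromℕ (length ν) * 0ℚ                    ≡⟨ ℚ.*-zeroʳ (fromℕ (length ν)) ⟩
  0ℚ                                       ≡⟨ ℚ.*-zeroʳ (fromℕ (suc m)) ⟨
  fromℕ (suc m) * 0ℚ                       ∎)
  where open ≡-Reasoning

-- The weights of `E`, `D E` and `D (D E) - D E`; multiplied by `F` these series become `P`, `P s`
-- and `C`.
φP φD φC : ℕ → ℚ
φP n = 1ℚ
φD n = fromℕ n
φC n = fromℕ n * fromℕ n -ℚ fromℕ n

-- By `weightedE*𝔼` this is the coefficient of `e[ ν ]` in `weightedE φ` times `F`.
coeff : (ℕ → ℚ) → List ℕ → ℚ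
coeff φ ν = φ 0 * ε ν + ∑ (upTo (sum ν)) (λ j → φ (suc j) * shift (suc j) ε ν)

F : PowerSeries
F = 𝔼 ε

empty : List ℕ → ℚ
empty []      = 1ℚ
empty (_ ∷ _) = 0ℚ

𝔼-empty : ∀ α → 𝔼 empty α ≡ 1ₛ α
𝔼-empty α = go (sum α) refl
  where
  nonempty : ∀ {n} ν → Partition (suc n) ν → empty ν * e[ ν ] α ≡ 0ℚ
  nonempty []      record { size = () }
  nonempty (a ∷ ν) _ = ℚ.*-zeroˡ (e[ a ∷ ν ] α)
  go : ∀ n → sum α ≡ n → ∑ (partitions n) (λ ν → empty ν * e[ ν ] α) ≡ 1ₛ α
  go zero    eq = trans (ℚ.+-identityʳ _) (ℚ.*-identityˡ (1ₛ α))
  go (suc n) eq = trans (∑-zero (partitions (suc n)) (λ {ν} ν∈ → nonempty {n} ν (partitions-sound ν∈)))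
    (sym (homogeneous-1 α (λ ≡0 → ℕ.1+n≢0 (trans (sym eq) ≡0))))

-- For nonempty `ν` the recursion turns `ε ν` into a sum with weights `j - 1`, and adding the
-- weights 1 of `φP` gives the weights `j` of `φD`. The empty partition has no recursion and
-- supplies the constant term.
coeffP : ∀ ν → All NonZero ν → coeff φP ν ≡ empty ν + coeff φD ν
coeffP []      _  = refl
coeffP (a ∷ ν) >0 = begin
  1ℚ * ε λ′ + ∑ (upTo (sum λ′)) (λ j → 1ℚ * shift (suc j) ε λ′)
    ≡⟨ cong (λ r → r + ∑ (upTo (sum λ′)) (λ j → 1ℚ * shift (suc j) ε λ′)) (trans (ℚ.*-identityˡ (ε λ′)) (ε-recursion (sum λ′) a ν >0 ℕ.≤-refl)) ⟩
  ∑ (upTo (sum λ′)) (λ j → ι (+ suc j -ℤ 1ℤ) * shift (suc j) ε λ′) + ∑ (upTo (sum λ′)) (λ j → 1ℚ * shift (suc j) ε λ′)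
    ≡⟨ ∑-distrib-+ (upTo (sum λ′)) (λ j → ι (+ suc j -ℤ 1ℤ) * shift (suc j) ε λ′) (λ j → 1ℚ * shift (suc j) ε λ′) ⟨
  ∑ (upTo (sum λ′)) (λ j → ι (+ suc j -ℤ 1ℤ) * shift (suc j) ε λ′ + 1ℚ * shift (suc j) ε λ′)
    ≡⟨ ∑-cong (upTo (sum λ′)) (λ j → trans (sym (ℚ.*-distribʳ-+ (shift (suc j) ε λ′) (ι (+ suc j -ℤ 1ℤ)) 1ℚ))
         (cong (_* shift (suc j) ε λ′) (trans (sym (ι-+ (+ suc j -ℤ 1ℤ) 1ℤ)) (cong ι (cong +_ (ℕ.+-comm j 1)))))) ⟩
  ∑ (upTo (sum λ′)) (λ j → fromℕ (suc j) * shift (suc j) ε λ′)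
    ≡⟨ ℚ.+-identityˡ _ ⟨
  0ℚ + ∑ (upTo (sum λ′)) (λ j → fromℕ (suc j) * shift (suc j) ε λ′)
    ≡⟨ cong (λ r → r + ∑ (upTo (sum λ′)) (λ j → fromℕ (suc j) * shift (suc j) ε λ′)) (ℚ.*-zeroˡ (ε λ′)) ⟨
  coeff φD λ′
    ≡⟨ ℚ.+-identityˡ _ ⟨
  0ℚ + coeff φD λ′ ∎
  where
  open ≡-Reasoning
  λ′ = a ∷ ν

E*F : ∀ α → (E *ₛ F) α ≡ 𝔼 (coeff φP) α
E*F α = trans (*ₛ-congʳ α F (λ β → sym (ℚ.*-identityˡ (E β)))) (weightedE*𝔼 φP ε α)

F-relation : ∀ α → (E *ₛ F) α ≡ 1ₛ α + (D E *ₛ F) α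
F-relation α = begin
  (E *ₛ F) α                          ≡⟨ E*F α ⟩
  𝔼 (coeff φP) α                      ≡⟨ 𝔼-cong α (λ ν p → coeffP ν (Partition.positive p)) ⟩
  𝔼 (λ ν → empty ν + coeff φD ν) α    ≡⟨ 𝔼-+ empty (coeff φD) α ⟩
  𝔼 empty α + 𝔼 (coeff φD) α          ≡⟨ cong₂ _+_ (𝔼-empty α) (sym (weightedE*𝔼 φD ε α)) ⟩
  1ₛ α + (D E *ₛ F) α                 ∎
  where open ≡-Reasoning

-- The coefficients of `(2 + e₁) C + (e₂ - 3) P`. The polynomial summand of `T₂-formula` is absent
-- because it does not reach degree 3.
twinCoeff : List ℕ → ℚ
twinCoeff ν = (ι (+ 2) * coeff φC ν + shift 1 (coeff φC) ν) + (shift 2 (coeff φP) ν + - ι (+ 3) * coeff φP ν)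

-- Expansion of the closed form in elementary symmetric functions

module TwinnedCycleExpansion (N : ℕ) where

  open Words N
  open SmirnovWords N
  open R using (_≈_)
  open SeriesSolver N using (solve; _:=_; _:+_; _:*_; :-_; con)
  open import Relation.Binary.Reasoning.Setoid R.setoid

  P : PowerSeries
  P = E ⊛ F

  P-relation : P ≈ ⟪ 1ℤ ⟫ ⊕ P ⊛ s
  P-relation = begin
    E ⊛ F                       ≈⟨ (λ α _ → trans (⊛-eval E F α) (trans (F-relation α)
                                     (sym (trans (⊕-eval ⟪ 1ℤ ⟫ (D E ⊛ F) α) (cong₂ _+_ (ℚ.*-identityˡ (1ₛ α)) (⊛-eval (D E) F α)))))) ⟩
    ⟪ 1ℤ ⟫ ⊕ D E ⊛ F            ≈⟨ R.+-congˡ (R.*-congʳ E*s) ⟨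
    ⟪ 1ℤ ⟫ ⊕ (E ⊛ s) ⊛ F        ≈⟨ R.+-congˡ (solve 3 (λ e s f → e :* s :* f := e :* f :* s) R.refl E s F) ⟩
    ⟪ 1ℤ ⟫ ⊕ P ⊛ s              ∎

  open TwinnedCycleSeries N P P-relation

  P-expansion : P ≈ 𝔼 (coeff φP)
  P-expansion α _ = trans (⊛-eval E F α) (E*F α)

  C-expansion : C ≈ 𝔼 (coeff φC)
  C-expansion = R.trans (R.trans (solve 3 (λ e f c → e :* f :* c := e :* c :* f) R.refl E F (s ⊛ s ⊕ ⊖ B)) (R.*-congʳ E*[s²-B]))
    (λ α _ → trans (⊛-eval (D (D E) ⊕ ⊖ D E) F α) (trans (*ₛ-congʳ α F degree) (weightedE*𝔼 φC ε α)))
    where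
    degree : ∀ β → (D (D E) ⊕ ⊖ D E) β ≡ weightedE φC β
    degree β = trans (⊕-eval (D (D E)) (⊖ D E) β) (trans (cong (λ r → D (D E) β + r) (⊖-eval (D E) β))
      (distribute (fromℕ (sum β)) (E β)))
      where
      module Q = Data.Rational.Solver.+-*-Solver
      distribute : ∀ n p → n * (n * p) + - (n * p) ≡ (n * n -ℚ n) * p
      distribute = Q.solve 2 (λ n p → n Q.:* (n Q.:* p) Q.:+ Q.:- (n Q.:* p) Q.:= (n Q.:* n Q.:- n) Q.:* p) refl

  e⊛-expansion : ∀ j c {f} → NonZero j → f ≈ 𝔼 c → e j ⊛ f ≈ 𝔼 (shift j c)
  e⊛-expansion j c j>0 eq = R.trans (R.*-congˡ eq) (λ α _ → trans (⊛-eval (e j) (𝔼 c) α) (e*𝔼 j c α j>0))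

  T₂-expansion : ∀ α → length α ≡ N → 3 ≤ sum α → T₂ α ≡ ι (+ 2) * 𝔼 twinCoeff α
  T₂-expansion α l 3≤ = trans (T₂-formula α l) (trans (⟪⟫-⊛ α (+ 2) (main ⊕ low)) (cong (ι (+ 2) *_)
    (trans (⊕-eval main low α) (trans (cong₂ _+_ main≡ low≡) (ℚ.+-identityʳ (𝔼 twinCoeff α))))))
    where
    main low : PowerSeries
    main = ⟪ + 2 ⟫ ⊛ C ⊕ e 1 ⊛ C ⊕ (e 2 ⊛ P ⊕ ⊖ (⟪ + 3 ⟫ ⊛ P))
    low  = e 2 ⊕ ⟪ + 3 ⟫ ⊛ e 1 ⊕ ⟪ + 3 ⟫
    ≢3 : ∀ {n} → n < 3 → sum α ≢ n
    ≢3 n<3 refl = ℕ.<⇒≱ n<3 3≤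
    low≡ : low α ≡ 0ℚ
    low≡ = trans (⊕-eval (e 2 ⊕ ⟪ + 3 ⟫ ⊛ e 1) ⟪ + 3 ⟫ α) (cong₂ _+_
      (trans (⊕-eval (e 2) (⟪ + 3 ⟫ ⊛ e 1) α) (cong₂ _+_ (homogeneous-e 2 α (≢3 (s≤s (s≤s (s≤s z≤n)))))
        (trans (⟪⟫-⊛ α (+ 3) (e 1)) (cong (ι (+ 3) *_) (homogeneous-e 1 α (≢3 (s≤s (s≤s z≤n))))))))
      (cong (ι (+ 3) *_) (homogeneous-1 α (≢3 (s≤s z≤n)))))
    main≡ : main α ≡ 𝔼 twinCoeff α
    main≡ = trans (⊕-eval (⟪ + 2 ⟫ ⊛ C ⊕ e 1 ⊛ C) (e 2 ⊛ P ⊕ ⊖ (⟪ + 3 ⟫ ⊛ P)) α) (trans (cong₂ _+_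
      (trans (⊕-eval (⟪ + 2 ⟫ ⊛ C) (e 1 ⊛ C) α) (trans (cong₂ _+_
        (trans (⟪⟫-⊛ α (+ 2) C) (trans (cong (ι (+ 2) *_) (C-expansion α l)) (sym (𝔼-* (ι (+ 2)) (coeff φC) α))))
        (e⊛-expansion 1 (coeff φC) _ C-expansion α l)) (sym (𝔼-+ (λ ν → ι (+ 2) * coeff φC ν) (shift 1 (coeff φC)) α))))
      (trans (⊕-eval (e 2 ⊛ P) (⊖ (⟪ + 3 ⟫ ⊛ P)) α) (trans (cong₂ _+_
        (e⊛-expansion 2 (coeff φP) _ P-expansion α l)
        (trans (⊖-eval (⟪ + 3 ⟫ ⊛ P) α) (trans (cong -_ (trans (⟪⟫-⊛ α (+ 3) P) (cong (ι (+ 3) *_) (P-expansion α l))))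
          (trans (ℚ.neg-distribˡ-* (ι (+ 3)) (𝔼 (coeff φP) α)) (sym (𝔼-* (- ι (+ 3)) (coeff φP) α))))))
        (sym (𝔼-+ (shift 2 (coeff φP)) (λ ν → - ι (+ 3) * coeff φP ν) α)))))
      (sym (𝔼-+ (λ ν → ι (+ 2) * coeff φC ν + shift 1 (coeff φC) ν) (λ ν → shift 2 (coeff φP) ν + - ι (+ 3) * coeff φP ν) α)))

-- Counting colourings

ind : {A : Set} → Dec A → ℚ
ind d = if does d then 1ℚ else 0ℚ

ind-⇔ : {A B : Set} (a : Dec A) (b : Dec B) → A ⇔ B → ind a ≡ ind b
ind-⇔ a b eq = cong (λ t → if t then 1ℚ else 0ℚ) (does-⇔ eq a b)

ind-no : {A : Set} (a : Dec A) → ¬ A → ind a ≡ 0ℚ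
ind-no a p = cong (λ t → if t then 1ℚ else 0ℚ) (dec-false a p)

ind-× : {A B : Set} (a : Dec A) (b : Dec B) → ind (a ×-dec b) ≡ ind a * ind b
ind-× a b with does a
... | true  = sym (ℚ.*-identityˡ (ind b))
... | false = sym (ℚ.*-zeroˡ (ind b))

length-filter : {A : Set} {P : A → Set} (P? : ∀ x → Dec (P x)) (xs : List A) →
  fromℕ (length (filter P? xs)) ≡ ∑ xs (λ x → ind (P? x))
length-filter P? []       = refl
length-filter P? (x ∷ xs) with P? x
... | yes _ = trans (fromℕ-+ 1 (length (filter P? xs))) (cong (λ r → 1ℚ + r) (length-filter P? xs))
... | no _  = trans (length-filter P? xs) (sym (ℚ.+-identityˡ _))

-- A total lookup with exponent 0 beyond the end, so that colours can be taken from `Fin N` for a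
-- fixed `N` while the exponent list changes.
nth : List ℕ → ℕ → ℕ
nth []      i       = 0
nth (a ∷ α) zero    = a
nth (a ∷ α) (suc i) = nth α i

decrement : ℕ → List ℕ → List ℕ
decrement i       []      = []
decrement zero    (a ∷ α) = a ∸ 1 ∷ α
decrement (suc i) (a ∷ α) = a ∷ decrement i α

lookup-nth : ∀ α (i : Fin (length α)) → lookup α i ≡ nth α (toℕ i)
lookup-nth (a ∷ α) zero    = refl
lookup-nth (a ∷ α) (suc i) = lookup-nth α i

lower-absent : ∀ i f α → nth α i ≡ 0 → lower i f α ≡ 0ℚ
lower-absent i       f []         _  = refl
lower-absent zero    f (zero ∷ α) _  = refl
lower-absent (suc i) f (a ∷ α)    ≡0 = lower-absent i (f ∘ (a ∷_)) α ≡0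

lower-present : ∀ i f α {b} → nth α i ≡ suc b → lower i f α ≡ f (decrement i α)
lower-present zero    f (suc a ∷ α) _  = refl
lower-present (suc i) f (a ∷ α)     ≡s = lower-present i (f ∘ (a ∷_)) α ≡s

length-decrement : ∀ i α → length (decrement i α) ≡ length α
length-decrement i       []      = refl
length-decrement zero    (a ∷ α) = refl
length-decrement (suc i) (a ∷ α) = cong suc (length-decrement i α)

nth-decrement : ∀ i α → nth (decrement i α) i ≡ nth α i ∸ 1
nth-decrement i       []      = refl
nth-decrement zero    (a ∷ α) = refl
nth-decrement (suc i) (a ∷ α) = nth-decrement i α

nth-decrement-≢ : ∀ i j α → i ≢ j → nth (decrement i α) j ≡ nth α j
nth-decrement-≢ i       j       []      _   = refl
nth-decrement-≢ zero    zero    (a ∷ α) i≢j = ⊥-elim (i≢j refl)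
nth-decrement-≢ zero    (suc j) (a ∷ α) _   = refl
nth-decrement-≢ (suc i) zero    (a ∷ α) _   = refl
nth-decrement-≢ (suc i) (suc j) (a ∷ α) i≢j = nth-decrement-≢ i j α (i≢j ∘ cong suc)

count-here : ∀ {N n} (c : Fin N) (κ : Vec (Fin N) n) → count (_≟ᶠ c) (c ∷ κ) ≡ suc (count (_≟ᶠ c) κ)
count-here c κ = cong (λ t → (if t then suc else id) (count (_≟ᶠ c) κ)) (dec-true (c ≟ᶠ c) refl)

count-there : ∀ {N n} {c i : Fin N} (κ : Vec (Fin N) n) → c ≢ i → count (_≟ᶠ i) (c ∷ κ) ≡ count (_≟ᶠ i) κ
count-there {c = c} {i} κ c≢i = cong (λ t → (if t then suc else id) (count (_≟ᶠ i) κ)) (dec-false (c ≟ᶠ i) c≢i)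

module Colourings (N : ℕ) where

  open Words N
  open SmirnovWords N
  open R using (_≈_)
  open SeriesSolver N using (solve; _:=_; _:+_; _:*_; :-_; con)
  open import Relation.Binary.Reasoning.Setoid R.setoid

  mono : ∀ {n} → Vec Colour n → PowerSeries
  mono []      = 1ₛ
  mono (c ∷ κ) = x c ⊛ mono κ

  Content : ∀ {n} → Vec Colour n → List ℕ → Set
  Content κ β = ∀ i → count (_≟ᶠ i) κ ≡ nth β (toℕ i)

  content? : ∀ {n} (κ : Vec Colour n) β → Dec (Content κ β)
  content? κ β = all? λ i → count (_≟ᶠ i) κ ℕ.≟ nth β (toℕ i)

  -- Multiplication by `x c` looks up the exponent of `c` lowered by one, just as deleting the first
  -- vertex lowers the count of its colour.
  mono-content : ∀ {n} (κ : Vec Colour n) β → length β ≡ N → mono κ β ≡ ind (content? κ β)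
  mono-content []      β refl = ind-⇔ (allList? (ℕ._≟ 0) β) (content? [] β) (mk⇔ (to β) (from β))
    where
    to : ∀ β → All (_≡ 0) β → (i : Fin (length β)) → 0 ≡ nth β (toℕ i)
    to (b ∷ β) (eq ∷ _) zero    = sym eq
    to (b ∷ β) (_ ∷ p)  (suc i) = to β p i
    from : ∀ β → ((i : Fin (length β)) → 0 ≡ nth β (toℕ i)) → All (_≡ 0) β
    from []      h = []
    from (b ∷ β) h = sym (h zero) ∷ from β (h ∘ suc)
  mono-content (c ∷ κ) β l = trans (var-⊛ (toℕ c) (mono κ) β) (go (nth β (toℕ c)) refl)
    where
    go : ∀ b → nth β (toℕ c) ≡ b → lower (toℕ c) (mono κ) β ≡ ind (content? (c ∷ κ) β)
    go zero    eq = trans (lower-absent (toℕ c) (mono κ) β eq)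
      (sym (ind-no (content? (c ∷ κ) β) (λ h → ℕ.1+n≢0 (trans (sym (count-here c κ)) (trans (h c) eq)))))
    go (suc b) eq = trans (lower-present (toℕ c) (mono κ) β eq)
      (trans (mono-content κ (decrement (toℕ c) β) (trans (length-decrement (toℕ c) β) l))
             (ind-⇔ (content? κ (decrement (toℕ c) β)) (content? (c ∷ κ) β) (mk⇔ to from)))
      where
      at-c : nth (decrement (toℕ c) β) (toℕ c) ≡ b
      at-c = trans (nth-decrement (toℕ c) β) (cong (_∸ 1) eq)
      off-c : ∀ i → c ≢ i → nth (decrement (toℕ c) β) (toℕ i) ≡ nth β (toℕ i)
      off-c i c≢i = nth-decrement-≢ (toℕ c) (toℕ i) β (c≢i ∘ toℕ-injective)
      to : Content κ (decrement (toℕ c) β) → Content (c ∷ κ) β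
      to h i = case i (c ≟ᶠ i)
        where
        case : ∀ i → Dec (c ≡ i) → count (_≟ᶠ i) (c ∷ κ) ≡ nth β (toℕ i)
        case i (yes refl) = trans (count-here c κ) (trans (cong suc (trans (h c) at-c)) (sym eq))
        case i (no c≢i)   = trans (count-there κ c≢i) (trans (h i) (off-c i c≢i))
      from : Content (c ∷ κ) β → Content κ (decrement (toℕ c) β)
      from h i = case i (c ≟ᶠ i)
        where
        case : ∀ i → Dec (c ≡ i) → count (_≟ᶠ i) κ ≡ nth (decrement (toℕ c) β) (toℕ i)
        case i (yes refl) = trans (ℕ.suc-injective (trans (sym (count-here c κ)) (trans (h c) eq))) (sym at-c)
        case i (no c≢i)   = trans (sym (count-there κ c≢i)) (trans (h i) (sym (off-c i c≢i)))

  homogeneous-⊛ : ∀ {p q f g} → Homogeneous p f → Homogeneous q g → Homogeneous (p +ℕ q) (f ⊛ g)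
  homogeneous-⊛ {f = f} {g} hf hg α ≢ = trans (⊛-eval f g α) (homogeneous-* hf hg α ≢)

  homogeneous-mono : ∀ {n} (κ : Vec Colour n) → Homogeneous n (mono κ)
  homogeneous-mono []      = homogeneous-1
  homogeneous-mono (c ∷ κ) = homogeneous-⊛ (homogeneous-var (toℕ c)) (homogeneous-mono κ)

  Smirnov : ∀ {n} → Colour → Vec Colour n → Set
  Smirnov i []      = ⊤
  Smirnov i (k ∷ κ) = i ≢ k × Smirnov k κ

  smirnov? : ∀ {n} i (κ : Vec Colour n) → Dec (Smirnov i κ)
  smirnov? i []      = yes tt
  smirnov? i (k ∷ κ) = ¬? (i ≟ᶠ k) ×-dec smirnov? k κ

  last : ∀ {n} → Colour → Vec Colour n → Colour
  last i []      = i
  last i (k ∷ κ) = last k κ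

  𝟙-× : {A B : Set} (a : Dec A) (b : Dec B) → 𝟙 (a ×-dec b) ≈ 𝟙 a ⊛ 𝟙 b
  𝟙-× a b with does a
  ... | true  = R.sym (R.*-identityˡ (𝟙 b))
  ... | false = R.sym (R.zeroˡ (𝟙 b))

  ∑ᶜ : ∀ n → (Vec Colour n → PowerSeries) → PowerSeries
  ∑ᶜ n = S.∑ᴿ (colorings n N)

  ∑ᶜ-suc : ∀ n (f : Vec Colour (suc n) → PowerSeries) → ∑ᶜ (suc n) f ≈ ∑ₛ λ c → ∑ᶜ n λ κ → f (c ∷ κ)
  ∑ᶜ-suc n f = S.∑-cartesianProductWith _∷_ (allFin N) (colorings n N) f

  -- The weight `g` of the last colour stays arbitrary, because the factors of the twins depend on
  -- the far end of the path and have to pass through the induction.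
  words-sum : ∀ n i (g : Colour → PowerSeries) →
    (∑ᶜ n λ κ → 𝟙 (smirnov? i κ) ⊛ (g (last i κ) ⊛ mono (i ∷ κ))) ≈ ∑ₛ λ j → word (suc n) i j ⊛ g j
  words-sum zero i g = begin
    1ₛ ⊛ (g i ⊛ (x i ⊛ 1ₛ)) ⊕ 0ₛ     ≈⟨ R.trans (R.+-identityʳ _) (R.trans (R.*-identityˡ _) (R.*-congˡ (R.*-identityʳ (x i)))) ⟩
    g i ⊛ x i                        ≈⟨ R.*-comm (g i) (x i) ⟩
    x i ⊛ g i                        ≈⟨ ∑-δ i (λ j → x i ⊛ g j) ⟨
    (∑ₛ λ j → δ i j ⊛ (x i ⊛ g j))   ≈⟨ ∑ₛ-cong (λ j → R.*-assoc (δ i j) (x i) (g j)) ⟨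
    (∑ₛ λ j → δ i j ⊛ x i ⊛ g j)     ∎
  words-sum (suc n) i g = begin
    (∑ᶜ (suc n) λ κ → 𝟙 (smirnov? i κ) ⊛ (g (last i κ) ⊛ mono (i ∷ κ)))
      ≈⟨ ∑ᶜ-suc n (λ κ → 𝟙 (smirnov? i κ) ⊛ (g (last i κ) ⊛ mono (i ∷ κ))) ⟩
    (∑ₛ λ k → ∑ᶜ n λ κ → 𝟙 (¬? (i ≟ᶠ k) ×-dec smirnov? k κ) ⊛ (g (last k κ) ⊛ (x i ⊛ mono (k ∷ κ))))
      ≈⟨ ∑ₛ-cong (λ k → S.∑-cong (colorings n N) λ κ → R.trans (R.*-congʳ (𝟙-× (¬? (i ≟ᶠ k)) (smirnov? k κ)))
           (solve 5 (λ h s g x m → h :* s :* (g :* (x :* m)) := x :* h :* (s :* (g :* m))) R.refl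
              (η i k) (𝟙 (smirnov? k κ)) (g (last k κ)) (x i) (mono (k ∷ κ)))) ⟩
    (∑ₛ λ k → ∑ᶜ n λ κ → x i ⊛ η i k ⊛ (𝟙 (smirnov? k κ) ⊛ (g (last k κ) ⊛ mono (k ∷ κ))))
      ≈⟨ ∑ₛ-cong (λ k → S.*-distribˡ-∑ (colorings n N) (x i ⊛ η i k) (λ κ → 𝟙 (smirnov? k κ) ⊛ (g (last k κ) ⊛ mono (k ∷ κ)))) ⟨
    (∑ₛ λ k → x i ⊛ η i k ⊛ (∑ᶜ n λ κ → 𝟙 (smirnov? k κ) ⊛ (g (last k κ) ⊛ mono (k ∷ κ))))
      ≈⟨ ∑ₛ-cong (λ k → R.*-congˡ (words-sum n k g)) ⟩
    (∑ₛ λ k → x i ⊛ η i k ⊛ (∑ₛ λ j → word (suc n) k j ⊛ g j))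
      ≈⟨ ∑ₛ-cong (λ k → *-∑ₛ (x i ⊛ η i k) (λ j → word (suc n) k j ⊛ g j)) ⟩
    (∑ₛ λ k → ∑ₛ λ j → x i ⊛ η i k ⊛ (word (suc n) k j ⊛ g j))
      ≈⟨ S.∑-swap (allFin N) (allFin N) (λ k j → x i ⊛ η i k ⊛ (word (suc n) k j ⊛ g j)) ⟩
    (∑ₛ λ j → ∑ₛ λ k → x i ⊛ η i k ⊛ (word (suc n) k j ⊛ g j))
      ≈⟨ ∑ₛ-cong (λ j → ∑ₛ-cong λ k →
           solve 4 (λ x h w g → x :* h :* (w :* g) := g :* x :* (h :* w)) R.refl (x i) (η i k) (word (suc n) k j) (g j)) ⟩
    (∑ₛ λ j → ∑ₛ λ k → g j ⊛ x i ⊛ (η i k ⊛ word (suc n) k j))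
      ≈⟨ ∑ₛ-cong (λ j → *-∑ₛ (g j ⊛ x i) (λ k → η i k ⊛ word (suc n) k j)) ⟨
    (∑ₛ λ j → g j ⊛ x i ⊛ (∑ₛ λ k → η i k ⊛ word (suc n) k j))
      ≈⟨ ∑ₛ-cong (λ j → solve 3 (λ g x s → g :* x :* s := x :* s :* g) R.refl (g j) (x i) (∑ₛ λ k → η i k ⊛ word (suc n) k j)) ⟩
    (∑ₛ λ j → x i ⊛ (∑ₛ λ k → η i k ⊛ word (suc n) k j) ⊛ g j) ∎

  Avoids : Colour → Colour → Colour → Set
  Avoids i j a = i ≢ a × j ≢ a

  avoids? : ∀ i j a → Dec (Avoids i j a)
  avoids? i j a = ¬? (i ≟ᶠ a) ×-dec ¬? (j ≟ᶠ a)

  -- Position 0 is the new vertex, position 1 the vertex 0 of the cycle that it twins, and the rest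
  -- is the path that remains when both are deleted.
  Twinned : ∀ {n} → Vec Colour (3 +ℕ n) → Set
  Twinned (a ∷ b ∷ i ∷ κ) = a ≢ b × Avoids i (last i κ) a × Avoids i (last i κ) b × Smirnov i κ

  twinned? : ∀ {n} (κ : Vec Colour (3 +ℕ n)) → Dec (Twinned κ)
  twinned? (a ∷ b ∷ i ∷ κ) = ¬? (a ≟ᶠ b) ×-dec (avoids? i (last i κ) a ×-dec (avoids? i (last i κ) b ×-dec smirnov? i κ))

  pairs : Colour → Colour → Colour → Colour → PowerSeries
  pairs i j a b = η a b ⊛ (u i j a ⊛ u i j b)

  -- The twin colours `a` and `b` interact with the path only through its end colours `i` and `j`,
  -- so the sums can be regrouped by these ends.
  twinned-sum : ∀ n → (∑ᶜ (3 +ℕ n) λ κ → 𝟙 (twinned? κ) ⊛ mono κ) ≈ ∑ₛ λ i → ∑ₛ λ j → V i j ⊛ word (suc n) i j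
  twinned-sum n = begin
    (∑ᶜ (3 +ℕ n) λ κ → 𝟙 (twinned? κ) ⊛ mono κ)
      ≈⟨ R.trans (∑ᶜ-suc (2 +ℕ n) term) (∑ₛ-cong λ a → R.trans (∑ᶜ-suc (1 +ℕ n) (term ∘ (a ∷_)))
           (∑ₛ-cong λ b → ∑ᶜ-suc n (λ κ → term (a ∷ b ∷ κ)))) ⟩
    (∑ₛ λ a → ∑ₛ λ b → ∑ₛ λ i → ∑ᶜ n λ κ → 𝟙 (twinned? (a ∷ b ∷ i ∷ κ)) ⊛ (x a ⊛ (x b ⊛ mono (i ∷ κ))))
      ≈⟨ ∑ₛ-cong (λ a → ∑ₛ-cong λ b → ∑ₛ-cong λ i → S.∑-cong (colorings n N) (rearrange a b i)) ⟩
    (∑ₛ λ a → ∑ₛ λ b → ∑ₛ λ i → ∑ᶜ n λ κ → 𝟙 (smirnov? i κ) ⊛ (pairs i (last i κ) a b ⊛ mono (i ∷ κ)))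
      ≈⟨ ∑ₛ-cong (λ a → ∑ₛ-cong λ b → ∑ₛ-cong λ i → words-sum n i (λ j → pairs i j a b)) ⟩
    (∑ₛ λ a → ∑ₛ λ b → ∑ₛ λ i → ∑ₛ λ j → word (suc n) i j ⊛ pairs i j a b)
      ≈⟨ ∑ₛ-cong (λ a → S.∑-swap (allFin N) (allFin N) (λ b i → ∑ₛ λ j → word (suc n) i j ⊛ pairs i j a b)) ⟩
    (∑ₛ λ a → ∑ₛ λ i → ∑ₛ λ b → ∑ₛ λ j → word (suc n) i j ⊛ pairs i j a b)
      ≈⟨ S.∑-swap (allFin N) (allFin N) (λ a i → ∑ₛ λ b → ∑ₛ λ j → word (suc n) i j ⊛ pairs i j a b) ⟩
    (∑ₛ λ i → ∑ₛ λ a → ∑ₛ λ b → ∑ₛ λ j → word (suc n) i j ⊛ pairs i j a b)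
      ≈⟨ ∑ₛ-cong (λ i → ∑ₛ-cong λ a → S.∑-swap (allFin N) (allFin N) (λ b j → word (suc n) i j ⊛ pairs i j a b)) ⟩
    (∑ₛ λ i → ∑ₛ λ a → ∑ₛ λ j → ∑ₛ λ b → word (suc n) i j ⊛ pairs i j a b)
      ≈⟨ ∑ₛ-cong (λ i → S.∑-swap (allFin N) (allFin N) (λ a j → ∑ₛ λ b → word (suc n) i j ⊛ pairs i j a b)) ⟩
    (∑ₛ λ i → ∑ₛ λ j → ∑ₛ λ a → ∑ₛ λ b → word (suc n) i j ⊛ pairs i j a b)
      ≈⟨ ∑ₛ-cong (λ i → ∑ₛ-cong λ j → R.trans (*-∑ₛ (word (suc n) i j) (λ a → ∑ₛ λ b → pairs i j a b))
           (∑ₛ-cong λ a → *-∑ₛ (word (suc n) i j) (λ b → pairs i j a b))) ⟨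
    (∑ₛ λ i → ∑ₛ λ j → word (suc n) i j ⊛ V i j)
      ≈⟨ ∑ₛ-cong (λ i → ∑ₛ-cong λ j → R.*-comm (word (suc n) i j) (V i j)) ⟩
    (∑ₛ λ i → ∑ₛ λ j → V i j ⊛ word (suc n) i j) ∎
    where
    term : Vec Colour (3 +ℕ n) → PowerSeries
    term κ = 𝟙 (twinned? κ) ⊛ mono κ
    rearrange : ∀ a b i (κ : Vec Colour n) → 𝟙 (twinned? (a ∷ b ∷ i ∷ κ)) ⊛ (x a ⊛ (x b ⊛ mono (i ∷ κ))) ≈
      𝟙 (smirnov? i κ) ⊛ (pairs i (last i κ) a b ⊛ mono (i ∷ κ))
    rearrange a b i κ = R.trans (R.*-congʳ (R.trans (𝟙-× (¬? (a ≟ᶠ b)) (avoids? i j a ×-dec (avoids? i j b ×-dec smirnov? i κ)))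
        (R.*-congˡ (R.trans (𝟙-× (avoids? i j a) (avoids? i j b ×-dec smirnov? i κ))
        (R.*-cong (𝟙-× (¬? (i ≟ᶠ a)) (¬? (j ≟ᶠ a)))
          (R.trans (𝟙-× (avoids? i j b) (smirnov? i κ)) (R.*-congʳ (𝟙-× (¬? (i ≟ᶠ b)) (¬? (j ≟ᶠ b))))))))))
      (solve 9 (λ h ia ja ib jb s xa xb m → h :* (ia :* ja :* (ib :* jb :* s)) :* (xa :* (xb :* m)) :=
          s :* (h :* (ia :* (ja :* xa) :* (ib :* (jb :* xb))) :* m)) R.refl
        (η a b) (η i a) (η j a) (η i b) (η j b) (𝟙 (smirnov? i κ)) (x a) (x b) (mono (i ∷ κ)))
      where j = last i κ

  homogeneous-V : ∀ i j → Homogeneous 2 (V i j)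
  homogeneous-V i j = homogeneous-∑ N 2 (allFin N) (λ a → ∑ₛ λ b → pairs i j a b) λ a → homogeneous-∑ N 2 (allFin N) (pairs i j a) λ b →
    homogeneous-⊛ (homogeneous-𝟙 (¬? (a ≟ᶠ b))) (homogeneous-⊛ (homogeneous-u a) (homogeneous-u b))
    where
    homogeneous-u : ∀ a → Homogeneous 1 (u i j a)
    homogeneous-u a = homogeneous-⊛ (homogeneous-𝟙 (¬? (i ≟ᶠ a))) (homogeneous-⊛ (homogeneous-𝟙 (¬? (j ≟ᶠ a))) (homogeneous-var (toℕ a)))

  twinned-count : ∀ n α → length α ≡ N → sum α ≡ 3 +ℕ n →
    ∑ (colorings (3 +ℕ n) N) (λ κ → ind (twinned? κ) * mono κ α) ≡ (∑ₛ λ i → ∑ₛ λ j → W i j ⊛ V i j) α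
  twinned-count n α l eq = trans
    (trans (∑-cong (colorings (3 +ℕ n) N) (λ κ → sym (𝟙-eval (twinned? κ) (mono κ))))
      (trans (sym (eval-∑ N (colorings (3 +ℕ n) N) (λ κ → 𝟙 (twinned? κ) ⊛ mono κ) α)) (twinned-sum n α l)))
    (trans (eval-∑ N (allFin N) (λ i → ∑ₛ λ j → V i j ⊛ word (suc n) i j) α)
      (trans (∑-cong (allFin N) λ i → trans (eval-∑ N (allFin N) (λ j → V i j ⊛ word (suc n) i j) α)
         (trans (∑-cong (allFin N) λ j → replace i j) (sym (eval-∑ N (allFin N) (λ j → W i j ⊛ V i j) α))))
       (sym (eval-∑ N (allFin N) (λ i → ∑ₛ λ j → W i j ⊛ V i j) α))))
    where
    𝟙-eval : {A : Set} (d : Dec A) (f : PowerSeries) → (𝟙 d ⊛ f) α ≡ ind d * f α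
    𝟙-eval d f = trans (⊛-eval (𝟙 d) f α) (go (does d))
      where
      go : ∀ t → ((if t then 1ₛ else 0ₛ) *ₛ f) α ≡ (if t then 1ℚ else 0ℚ) * f α
      go true  = trans (*ₛ-identityˡ α f) (sym (ℚ.*-identityˡ (f α)))
      go false = trans (*ₛ-zeroˡ α f (λ _ → refl)) (sym (ℚ.*-zeroˡ (f α)))
    -- `V i j` is homogeneous of degree 2, so in degree `3 + n` only the words of length `suc n` in
    -- `W i j` matter.
    replace : ∀ i j → (V i j ⊛ word (suc n) i j) α ≡ (W i j ⊛ V i j) α
    replace i j = trans (⊛-eval (V i j) (word (suc n) i j) α) (trans
      (homogeneous-*-cong α (word (suc n) i j) (W i j) (homogeneous-V i j)
        (λ γ eq′ → cong (λ k → word k i j γ) (sym (ℕ.+-cancelˡ-≡ 2 (sum γ) (suc n) (trans eq′ eq)))))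
      (trans (sym (⊛-eval (V i j) (W i j) α)) (R.*-comm (V i j) (W i j) α l)))

-- The twinned cycle

module _ {N : ℕ} where

  open Colourings N using (Smirnov; last; Twinned)

  lookup-last : ∀ {n} i (κ : Vec (Fin N) n) → lookupᵛ (i ∷ κ) (maxFin n) ≡ last i κ
  lookup-last i []      = refl
  lookup-last i (k ∷ κ) = lookup-last k κ

  smirnov⇒ : ∀ {n} i (κ : Vec (Fin N) n) → Smirnov i κ → ∀ u w → toℕ w ≡ suc (toℕ u) → lookupᵛ (i ∷ κ) u ≢ lookupᵛ (i ∷ κ) w
  smirnov⇒ i (k ∷ κ) (i≢k , _) zero    (suc zero)    _  = i≢k
  smirnov⇒ i (k ∷ κ) (_ , smi) (suc u) (suc w)       eq = smirnov⇒ k κ smi u w (ℕ.suc-injective eq)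

  ⇒smirnov : ∀ {n} i (κ : Vec (Fin N) n) → (∀ u w → toℕ w ≡ suc (toℕ u) → lookupᵛ (i ∷ κ) u ≢ lookupᵛ (i ∷ κ) w) → Smirnov i κ
  ⇒smirnov i []      h = tt
  ⇒smirnov i (k ∷ κ) h = h zero (suc zero) refl , ⇒smirnov k κ (λ u w eq → h (suc u) (suc w) (cong suc eq))

  -- The two neighbours of the vertex 0 on the cycle are the ends of the path formed by the other
  -- vertices, and the twin is adjacent to these and to 0.
  proper⇔twinned : ∀ m (κ : Vec (Fin N) (4 +ℕ m)) → Proper (twin (cycle m) zero) κ ⇔ Twinned κ
  proper⇔twinned m (a ∷ b ∷ i ∷ κ) = mk⇔ to from
    where
    open SimpleGraph (cycle m)
    top : Fin (2 +ℕ m)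
    top = maxFin (suc m)
    first : zero ~ suc zero
    first = inj₁ (inj₁ refl)
    final : zero ~ suc top
    final = inj₂ (inj₂ (cong (λ k → suc (suc k)) (toℕ-fromℕ (suc m)) , refl))
    neighbours : ∀ u → zero ~ suc u → u ≡ zero ⊎ u ≡ top
    neighbours u (inj₁ (inj₁ eq))       = inj₁ (toℕ-injective (ℕ.suc-injective eq))
    neighbours u (inj₂ (inj₂ (eq , _))) = inj₂ (toℕ-injective (trans (ℕ.suc-injective (ℕ.suc-injective eq)) (sym (toℕ-fromℕ (suc m)))))
    to : Proper (twin (cycle m) zero) (a ∷ b ∷ i ∷ κ) → Twinned (a ∷ b ∷ i ∷ κ)
    to p = p zero (suc zero) (inj₁ refl)
      , ((λ eq → p zero (suc (suc zero)) (inj₂ first) (sym eq))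
        , (λ eq → p zero (suc (suc top)) (inj₂ final) (trans (sym eq) (sym (lookup-last i κ)))))
      , ((λ eq → p (suc zero) (suc (suc zero)) first (sym eq))
        , (λ eq → p (suc zero) (suc (suc top)) final (trans (sym eq) (sym (lookup-last i κ)))))
      , ⇒smirnov i κ (λ u w eq → p (suc (suc u)) (suc (suc w)) (inj₁ (inj₁ (cong suc eq))))
    from : Twinned (a ∷ b ∷ i ∷ κ) → Proper (twin (cycle m) zero) (a ∷ b ∷ i ∷ κ)
    from (a≢b , (i≢a , l≢a) , (i≢b , l≢b) , smi) = proper
      where
      avoid : ∀ {c} → i ≢ c → last i κ ≢ c → ∀ u → zero ~ suc u → c ≢ lookupᵛ (i ∷ κ) u
      avoid i≢c l≢c u adj eq with neighbours u adj
      ... | inj₁ refl = i≢c (sym eq)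
      ... | inj₂ refl = l≢c (trans (sym (lookup-last i κ)) (sym eq))
      path : ∀ u w → suc u ~ suc w → lookupᵛ (i ∷ κ) u ≢ lookupᵛ (i ∷ κ) w
      path u w (inj₁ (inj₁ eq)) = smirnov⇒ i κ smi u w (ℕ.suc-injective eq)
      path u w (inj₂ (inj₁ eq)) = λ eq′ → smirnov⇒ i κ smi w u (ℕ.suc-injective eq) (sym eq′)
      proper : Proper (twin (cycle m) zero) (a ∷ b ∷ i ∷ κ)
      proper zero          (suc zero)    _          = a≢b
      proper zero          (suc (suc w)) (inj₂ adj) = avoid i≢a l≢a w adj
      proper (suc zero)    zero          _          = a≢b ∘ sym
      proper (suc (suc u)) zero          (inj₂ adj) = avoid i≢a l≢a u adj ∘ sym
      proper (suc zero)    (suc zero)    adj        = ⊥-elim (~-irrefl zero adj)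
      proper (suc zero)    (suc (suc w)) adj        = avoid i≢b l≢b w adj
      proper (suc (suc u)) (suc zero)    adj        = avoid i≢b l≢b u (~-sym adj) ∘ sym
      proper (suc (suc u)) (suc (suc w)) adj        = path u w adj

X-ind : ∀ {n} (G : SimpleGraph n) α →
  X G α ≡ ∑ (colorings n (length α)) (λ κ → ind (proper? G κ) * Colourings.mono (length α) κ α)
X-ind {n} G α = trans (length-filter (λ κ → proper? G κ ×-dec hasContent? α κ) (colorings n (length α)))
  (∑-cong (colorings n (length α)) λ κ → trans (ind-× (proper? G κ) (hasContent? α κ)) (cong (ind (proper? G κ) *_)
    (trans (ind-⇔ (hasContent? α κ) (content? κ α) (mk⇔ (λ h i → trans (h i) (lookup-nth α i)) (λ h i → trans (h i) (sym (lookup-nth α i)))))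
      (sym (mono-content κ α refl)))))
  where open Colourings (length α)

X-degree : ∀ {n} (G : SimpleGraph n) → Homogeneous n (X G)
X-degree {n} G α ≢n = trans (X-ind G α) (∑-zero (colorings n (length α)) λ {κ} _ →
  trans (cong (ind (proper? G κ) *_) (Colourings.homogeneous-mono (length α) κ α ≢n)) (ℚ.*-zeroʳ (ind (proper? G κ))))

X-twin-zero : ∀ m α → sum α ≡ 4 +ℕ m → X (twin (cycle m) zero) α ≡ ι (+ 2) * 𝔼 twinCoeff α
X-twin-zero m α eq = trans (X-ind (twin (cycle m) zero) α) (trans
  (∑-cong (colorings (4 +ℕ m) (length α)) λ κ → cong (_* mono κ α) (ind-⇔ (proper? (twin (cycle m) zero) κ) (twinned? κ) (proper⇔twinned m κ)))
  (trans (twinned-count (suc m) α refl eq)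
    (TwinnedCycleExpansion.T₂-expansion (length α) α refl (subst (3 ≤_) (sym eq) (s≤s (s≤s (s≤s z≤n)))))))
  where open Colourings (length α)

-- Independence of the choice of the twinned vertex

Next-functional : ∀ n {i j k} → Next n i j → Next n i k → j ≡ k
Next-functional n {i} {j} {k} p q = toℕ-injective (go p q)
  where
  go : Next n i j → Next n i k → toℕ j ≡ toℕ k
  go (inj₁ a)       (inj₁ b)       = trans a (sym b)
  go (inj₁ a)       (inj₂ (b , _)) = ⊥-elim (ℕ.<-irrefl (trans a b) (toℕ<n j))
  go (inj₂ (a , _)) (inj₁ b)       = ⊥-elim (ℕ.<-irrefl (trans b a) (toℕ<n k))
  go (inj₂ (_ , a)) (inj₂ (_ , b)) = trans a (sym b)

Next-injective : ∀ n {i j k} → Next n i k → Next n j k → i ≡ j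
Next-injective n {i} {j} {k} p q = toℕ-injective (ℕ.suc-injective (go p q))
  where
  go : Next n i k → Next n j k → suc (toℕ i) ≡ suc (toℕ j)
  go (inj₁ a)       (inj₁ b)       = trans (sym a) b
  go (inj₁ a)       (inj₂ (_ , b)) = ⊥-elim (ℕ.1+n≢0 (trans (sym a) b))
  go (inj₂ (_ , a)) (inj₁ b)       = ⊥-elim (ℕ.1+n≢0 (trans (sym b) a))
  go (inj₂ (a , _)) (inj₂ (b , _)) = trans a (sym b)

prev : ∀ {n} → Fin (suc n) → Fin (suc n)
prev {n} zero    = maxFin n
prev     (suc i) = inject₁ i

Next-prev : ∀ {n} (i : Fin (suc n)) → Next (suc n) (prev i) i
Next-prev {n} zero    = inj₂ (cong suc (toℕ-fromℕ n) , refl)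
Next-prev     (suc i) = inj₁ (cong suc (sym (toℕ-inject₁ i)))

-- Moving the first colour to the end shifts a colouring by one step along the cycle, wrap-around
-- included.
lookup-∷ʳ : ∀ {A : Set} {n} (c : A) (κ : Vec A n) {u w} → Next (suc n) u w → lookupᵛ (κ ∷ʳ c) u ≡ lookupᵛ (c ∷ κ) w
lookup-∷ʳ c []      {zero}  {zero}  _                = refl
lookup-∷ʳ c (k ∷ κ) {zero}  {suc w} (inj₁ eq)        = go w (ℕ.suc-injective eq)
  where
  go : ∀ w → toℕ w ≡ 0 → k ≡ lookupᵛ (k ∷ κ) w
  go zero _ = refl
lookup-∷ʳ c (k ∷ κ) {suc u} {suc (suc w)} (inj₁ eq)  = lookup-∷ʳ c κ {u} {suc w} (inj₁ (ℕ.suc-injective eq))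
lookup-∷ʳ c (k ∷ κ) {suc u} {zero}  (inj₂ (eq , _))  = lookup-∷ʳ c κ {u} {zero} (inj₂ (ℕ.suc-injective eq , refl))

count-∷ʳ : ∀ {N n} (i c : Fin N) (κ : Vec (Fin N) n) → count (_≟ᶠ i) (κ ∷ʳ c) ≡ count (_≟ᶠ i) (c ∷ κ)
count-∷ʳ i c []      = refl
count-∷ʳ i c (k ∷ κ) = trans (cong (step k) (count-∷ʳ i c κ)) (comm (does (k ≟ᶠ i)) (does (c ≟ᶠ i)) (count (_≟ᶠ i) κ))
  where
  step : ∀ k → ℕ → ℕ
  step k = if does (k ≟ᶠ i) then suc else id
  comm : ∀ s t n → (if s then suc else id) ((if t then suc else id) n) ≡ (if t then suc else id) ((if s then suc else id) n)
  comm true  true  n = refl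
  comm true  false n = refl
  comm false true  n = refl
  comm false false n = refl

∈-colorings : ∀ {n N} (κ : Vec (Fin N) n) → κ ∈ colorings n N
∈-colorings []      = here refl
∈-colorings (c ∷ κ) = ∈-cartesianProductWith⁺ _∷_ (∈-allFin c) (∈-colorings κ)

colorings-unique : ∀ n N → Unique (colorings n N)
colorings-unique zero    N = [] ∷ []
colorings-unique (suc n) N = Unique.cartesianProductWith⁺ _∷_ Vec.∷-injective (Unique.allFin⁺ N) (colorings-unique n N)

-- The colour of the new vertex is kept while the colouring of the cycle turns by one step.
rotate : ∀ {A : Set} {n} → Vec A (2 +ℕ n) → Vec A (2 +ℕ n)
rotate (a ∷ c ∷ κ) = a ∷ (κ ∷ʳ c)

rotate-↭ : ∀ n N → colorings (2 +ℕ n) N ↭ map rotate (colorings (2 +ℕ n) N)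
rotate-↭ n N = unique-complete⇒↭ (colorings-unique (2 +ℕ n) N) (Unique.map⁺ injective (colorings-unique (2 +ℕ n) N)) surjective (λ _ → ∈-colorings _)
  where
  injective : ∀ {κ κ′ : Vec (Fin N) (2 +ℕ n)} → rotate κ ≡ rotate κ′ → κ ≡ κ′
  injective {a ∷ c ∷ κ} {a′ ∷ c′ ∷ κ′} eq
    with refl , eq′ ← Vec.∷-injective eq
    with refl , refl ← Vec.∷ʳ-injective κ κ′ eq′ = refl
  surjective : ∀ {κ} → κ ∈ colorings (2 +ℕ n) N → κ ∈ map rotate (colorings (2 +ℕ n) N)
  surjective {a ∷ κ} _ with κ′ , c , refl ← Vec.initLast κ = ∈-map⁺ rotate (∈-colorings (a ∷ c ∷ κ′))

count-rotate : ∀ {N k} (i : Fin N) (κ : Vec (Fin N) (2 +ℕ k)) → count (_≟ᶠ i) (rotate κ) ≡ count (_≟ᶠ i) κ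
count-rotate i (a ∷ c ∷ κ) = cong (if does (a ≟ᶠ i) then suc else id) (count-∷ʳ i c κ)

X-reindex : ∀ {n} (G H : SimpleGraph n) α (τ : Vec (Fin (length α)) n → Vec (Fin (length α)) n) →
  colorings n (length α) ↭ map τ (colorings n (length α)) → (∀ κ → Proper G (τ κ) ⇔ Proper H κ) →
  (∀ i κ → count (_≟ᶠ i) (τ κ) ≡ count (_≟ᶠ i) κ) → X G α ≡ X H α
X-reindex {n} G H α τ perm prop cnt =
  trans (length-filter (λ κ → proper? G κ ×-dec hasContent? α κ) (colorings n (length α)))
  (trans (∑-↭ (λ κ → ind (proper? G κ ×-dec hasContent? α κ)) perm)
  (trans (∑-map (colorings n (length α)) τ (λ κ → ind (proper? G κ ×-dec hasContent? α κ)))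
  (trans (∑-cong (colorings n (length α)) (λ κ → ind-⇔ (proper? G (τ κ) ×-dec hasContent? α (τ κ)) (proper? H κ ×-dec hasContent? α κ)
    (mk⇔ (λ (a , b) → Equivalence.to (prop κ) a , λ i → trans (sym (cnt i κ)) (b i))
         (λ (a , b) → Equivalence.from (prop κ) a , λ i → trans (cnt i κ) (b i)))))
    (sym (length-filter (λ κ → proper? H κ ×-dec hasContent? α κ) (colorings n (length α)))))))

module _ (m : ℕ) where

  private n = 3 +ℕ m
  open SimpleGraph (cycle m)

  ~-next : ∀ {u u′ w w′} → Next n u u′ → Next n w w′ → u ~ w → u′ ~ w′
  ~-next p q (inj₁ r) with refl ← Next-functional n r p = inj₁ q
  ~-next p q (inj₂ r) with refl ← Next-functional n r q = inj₂ p

  ~-prev : ∀ {u u′ w w′} → Next n u u′ → Next n w w′ → u′ ~ w′ → u ~ w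
  ~-prev p q (inj₁ r) with refl ← Next-injective n r q = inj₁ p
  ~-prev p q (inj₂ r) with refl ← Next-injective n r p = inj₂ q

  -- One step along the cycle is an automorphism that takes `v` to `v′`, hence the neighbours of `v`
  -- to those of `v′`.
  proper-rotate : ∀ {N v v′} → Next n v v′ → (κ : Vec (Fin N) (suc n)) → Proper (twin (cycle m) v) (rotate κ) ⇔ Proper (twin (cycle m) v′) κ
  proper-rotate {v = v} {v′} p (a ∷ c ∷ κ) = mk⇔ to from
    where
    nbr-next : ∀ {u u′} → Next n u u′ → u ≡ v ⊎ v ~ u → u′ ≡ v′ ⊎ v′ ~ u′
    nbr-next q (inj₁ refl) = inj₁ (Next-functional n q p)
    nbr-next q (inj₂ r)    = inj₂ (~-next p q r)
    nbr-prev : ∀ {u u′} → Next n u u′ → u′ ≡ v′ ⊎ v′ ~ u′ → u ≡ v ⊎ v ~ u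
    nbr-prev q (inj₁ refl) = inj₁ (Next-injective n q p)
    nbr-prev q (inj₂ r)    = inj₂ (~-prev p q r)
    at : ∀ u → lookupᵛ (κ ∷ʳ c) (prev u) ≡ lookupᵛ (c ∷ κ) u
    at u = lookup-∷ʳ c κ (Next-prev u)
    to : Proper (twin (cycle m) v) (rotate (a ∷ c ∷ κ)) → Proper (twin (cycle m) v′) (a ∷ c ∷ κ)
    to h zero    (suc w) adj eq = h zero (suc (prev w)) (nbr-prev (Next-prev w) adj) (trans eq (sym (at w)))
    to h (suc u) zero    adj eq = h (suc (prev u)) zero (nbr-prev (Next-prev u) adj) (trans (at u) eq)
    to h (suc u) (suc w) adj eq = h (suc (prev u)) (suc (prev w)) (~-prev (Next-prev u) (Next-prev w) adj) (trans (at u) (trans eq (sym (at w))))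
    next : ∀ u → ∃ λ u′ → Next n u u′
    next u with suc (toℕ u) ℕ.≟ n
    ... | yes eq = zero , inj₂ (eq , refl)
    ... | no ≢n  = Data.Fin.fromℕ< u<n , inj₁ (toℕ-fromℕ< u<n)
      where u<n = ℕ.≤∧≢⇒< (toℕ<n u) ≢n
    from : Proper (twin (cycle m) v′) (a ∷ c ∷ κ) → Proper (twin (cycle m) v) (rotate (a ∷ c ∷ κ))
    from h zero    (suc w) adj eq = let w′ , q = next w in
      h zero (suc w′) (nbr-next q adj) (trans eq (lookup-∷ʳ c κ q))
    from h (suc u) zero    adj eq = let u′ , q = next u in
      h (suc u′) zero (nbr-next q adj) (trans (sym (lookup-∷ʳ c κ q)) eq)
    from h (suc u) (suc w) adj eq = let u′ , q = next u ; w′ , r = next w in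
      h (suc u′) (suc w′) (~-next q r adj) (trans (sym (lookup-∷ʳ c κ q)) (trans eq (lookup-∷ʳ c κ r)))

  X-rotate : ∀ {v v′} → Next n v v′ → ∀ α → X (twin (cycle m) v) α ≡ X (twin (cycle m) v′) α
  X-rotate {v} {v′} p α = X-reindex (twin (cycle m) v) (twin (cycle m) v′) α rotate (rotate-↭ (2 +ℕ m) (length α)) (proper-rotate p) count-rotate

  -- The recursion is on `t`, since `inject₁ v` is not a subterm of `suc v`.
  X-vertex : ∀ t v → toℕ v ≡ t → ∀ α → X (twin (cycle m) v) α ≡ X (twin (cycle m) zero) α
  X-vertex t       zero    eq α = refl
  X-vertex (suc t) (suc v) eq α = trans (sym (X-rotate (Next-prev (suc v)) α))
    (X-vertex t (inject₁ v) (trans (toℕ-inject₁ v) (ℕ.suc-injective eq)) α)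

X-twin : ∀ m v α → sum α ≡ 4 +ℕ m → X (twin (cycle m) v) α ≡ ι (+ 2) * 𝔼 twinCoeff α
X-twin m v α eq = trans (X-vertex m (toℕ v) v refl α) (X-twin-zero m α eq)

-- Linear independence of the products of elementary symmetric functions

homogeneous-e[] : ∀ ν → Homogeneous (sum ν) e[ ν ]
homogeneous-e[] []      = homogeneous-1
homogeneous-e[] (a ∷ ν) = homogeneous-* (homogeneous-e a) (homogeneous-e[] ν)

positives : List ℕ → ℕ
positives []          = 0
positives (zero ∷ ν)  = positives ν
positives (suc a ∷ ν) = suc (positives ν)

-- Each `e a` has degree at most 1 in the first variable, and `e 0` is constant; so the exponent in
-- `e[ ν ]` is at most the number of positive parts.
e-above : ∀ ν b α → positives ν < b → e[ ν ] (b ∷ α) ≡ 0ℚ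
e-above []          (suc b) α _  = refl
e-above (zero ∷ ν)  b       α <b = trans (*ₛ-congʳ (b ∷ α) e[ ν ] e₀) (trans (*ₛ-identityˡ (b ∷ α) e[ ν ]) (e-above ν b α <b))
e-above (suc a ∷ ν) (suc b) α (s≤s <b) = trans (*ₛ-∷ (e (suc a)) e[ ν ] (suc b) α)
  (trans (cong₂ _+_ (*ₛ-zeroʳ α (e (suc a)) (λ β → e-above ν (suc b) β (ℕ.m<n⇒m<1+n <b))) (tail b <b)) refl)
  where
  tail : ∀ b → positives ν < b → anti (λ i j → ((e (suc a) ∘ (suc i ∷_)) *ₛ (e[ ν ] ∘ (j ∷_))) α) b ≡ 0ℚ
  tail (suc b) <b = trans (cong₂ _+_ (*ₛ-zeroʳ α (e a) (λ β → e-above ν (suc b) β <b))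
    (anti-zero b (λ i j → *ₛ-zeroˡ α {e (suc a) ∘ (suc (suc i) ∷_)} (e[ ν ] ∘ (j ∷_)) (λ _ → refl)))) refl

-- The top exponent arises only by taking the first variable from every factor with a positive
-- index, which leaves `e` of the index lowered by 1. Parts lowered to 0 stay in the list, as `e 0`
-- is 1.
e-top : ∀ ν b α → positives ν ≡ b → e[ ν ] (b ∷ α) ≡ e[ map Data.Nat.pred ν ] α
e-top []          zero    α _  = refl
e-top (zero ∷ ν)  b       α eq = trans (*ₛ-congʳ (b ∷ α) e[ ν ] e₀) (trans (*ₛ-identityˡ (b ∷ α) e[ ν ])
  (trans (e-top ν b α eq) (sym (trans (*ₛ-congʳ α e[ map Data.Nat.pred ν ] e₀) (*ₛ-identityˡ α e[ map Data.Nat.pred ν ])))))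
e-top (suc a ∷ ν) (suc b) α eq = trans (*ₛ-∷ (e (suc a)) e[ ν ] (suc b) α)
  (trans (cong₂ _+_ (*ₛ-zeroʳ α (e (suc a)) (λ β → e-above ν (suc b) β (ℕ.≤-reflexive eq))) (tail b (ℕ.suc-injective eq))) (ℚ.+-identityˡ _))
  where
  tail : ∀ b → positives ν ≡ b → anti (λ i j → ((e (suc a) ∘ (suc i ∷_)) *ₛ (e[ ν ] ∘ (j ∷_))) α) b ≡ (e a *ₛ e[ map Data.Nat.pred ν ]) α
  tail zero    eq = *ₛ-congˡ α (e a) (λ β → e-top ν 0 β eq)
  tail (suc b) eq = trans (cong₂ _+_ (*ₛ-congˡ α (e a) (λ β → e-top ν (suc b) β eq))
    (anti-zero b (λ i j → *ₛ-zeroˡ α {e (suc a) ∘ (suc (suc i) ∷_)} (e[ ν ] ∘ (j ∷_)) (λ _ → refl)))) (ℚ.+-identityʳ _)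

sub : ℕ → List ℕ → List ℕ
sub t = map (_∸ t)

map-pred-sub : ∀ t ν → map Data.Nat.pred (sub t ν) ≡ sub (suc t) ν
map-pred-sub t []      = refl
map-pred-sub t (a ∷ ν) = cong₂ _∷_ (ℕ.pred[m∸n]≡m∸[1+n] a t) (map-pred-sub t ν)

positives-pred : ∀ ν → positives (map Data.Nat.pred ν) ≤ positives ν
positives-pred []                = z≤n
positives-pred (zero ∷ ν)        = positives-pred ν
positives-pred (suc zero ∷ ν)    = ℕ.m≤n⇒m≤1+n (positives-pred ν)
positives-pred (suc (suc a) ∷ ν) = s≤s (positives-pred ν)

positives-sub-suc : ∀ t ν → positives (sub (suc t) ν) ≤ positives (sub t ν)
positives-sub-suc t ν = subst (λ μ → positives μ ≤ positives (sub t ν)) (map-pred-sub t ν) (positives-pred (sub t ν))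

positives-sub-mono : ∀ {t u} ν → t ≤ u → positives (sub u ν) ≤ positives (sub t ν)
positives-sub-mono {t} {u} ν t≤u = subst (λ k → positives (sub k ν) ≤ positives (sub t ν)) (ℕ.m∸n+n≡m t≤u) (go (u ∸ t))
  where
  go : ∀ k → positives (sub (k +ℕ t) ν) ≤ positives (sub t ν)
  go zero    = ℕ.≤-refl
  go (suc k) = ℕ.≤-trans (positives-sub-suc (k +ℕ t) ν) (go k)

positives-bounded : ∀ t {ν} → All (_≤ t) ν → positives (sub t ν) ≡ 0
positives-bounded t {[]}    []       = refl
positives-bounded t {a ∷ ν} (≤t ∷ p) rewrite ℕ.m≤n⇒m∸n≡0 ≤t = positives-bounded t p

e[]-zeros : ∀ ν → positives ν ≡ 0 → e[ ν ] [] ≡ 1ℚ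
e[]-zeros []         _  = refl
e[]-zeros (zero ∷ ν) eq = trans (*ₛ-[] (e 0) e[ ν ]) (cong (1ℚ *_) (e[]-zeros ν eq))

-- `positives (sub u ν)` counts the parts greater than `u`; as a function of `u` it is the conjugate
-- partition. Elements of `S` must be told apart by its entries from `t` on, the ones not yet read
-- off.
Separated : ℕ → List (List ℕ) → Set
Separated t S = ∀ {ν μ} → ν ∈ S → μ ∈ S → (∀ u → t ≤ u → positives (sub u ν) ≡ positives (sub u μ)) → ν ≡ μ

-- Evaluating at exponent l in the first variable, with l the maximal number of positive parts,
-- keeps only the ν with l positive parts and lowers each of these parts by 1.
independent : ∀ f l t S (d : List ℕ → ℚ) → Unique S → Separated t S →
  (∀ {ν} → ν ∈ S → All (_≤ f +ℕ t) ν) → (∀ {ν} → ν ∈ S → positives (sub t ν) ≤ l) →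
  (∀ α → ∑ S (λ ν → d ν * e[ sub t ν ] α) ≡ 0ℚ) → ∀ {ν} → ν ∈ S → d ν ≡ 0ℚ
-- With all parts lowered to 0 nothing separates two elements of `S`, so `S` has at most one, and
-- the constant coefficient isolates its `d`.
independent-base : ∀ t S (d : List ℕ → ℚ) → Unique S → Separated t S → (∀ {ν} → ν ∈ S → positives (sub t ν) ≡ 0) →
  (∀ α → ∑ S (λ ν → d ν * e[ sub t ν ] α) ≡ 0ℚ) → ∀ {ν} → ν ∈ S → d ν ≡ 0ℚ
independent-base t (ν ∷ []) d S! sep zeros vanish (here refl) = begin
  d ν                             ≡⟨ ℚ.*-identityʳ (d ν) ⟨
  d ν * 1ℚ                        ≡⟨ cong (d ν *_) (e[]-zeros (sub t ν) (zeros (here refl))) ⟨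
  d ν * e[ sub t ν ] []           ≡⟨ ℚ.+-identityʳ _ ⟨
  d ν * e[ sub t ν ] [] + 0ℚ      ≡⟨ vanish [] ⟩
  0ℚ                              ∎
  where open ≡-Reasoning
independent-base t (ν ∷ μ ∷ S) d ((ν≢μ ∷ _) ∷ _) sep zeros vanish _ =
  ⊥-elim (ν≢μ (sep (here refl) (there (here refl)) λ u t≤u → trans (none (here refl) t≤u) (sym (none (there (here refl)) t≤u))))
  where
  none : ∀ {ν u} → ν ∈ _ → t ≤ u → positives (sub u ν) ≡ 0
  none {ν} ν∈ t≤u = ℕ.n≤0⇒n≡0 (subst (_ ≤_) (zeros ν∈) (positives-sub-mono ν t≤u))

independent zero    l       t S d S! sep ≤t ≤l vanish = independent-base t S d S! sep (λ ν∈ → positives-bounded t (≤t ν∈)) vanish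
independent (suc f) zero    t S d S! sep ≤t ≤l vanish = independent-base t S d S! sep (λ ν∈ → ℕ.n≤0⇒n≡0 (≤l ν∈)) vanish
independent (suc f) (suc l) t S d S! sep ≤t ≤l vanish {ν} ν∈ = go (maximal? ν)
  where
  Maximal : List ℕ → Set
  Maximal ν = positives (sub t ν) ≡ suc l
  maximal? : ∀ ν → Dec (Maximal ν)
  maximal? ν = positives (sub t ν) ℕ.≟ suc l
  S₁ S₂ : List (List ℕ)
  S₁ = filter maximal? S
  S₂ = filter (¬? ∘ maximal?) S
  S₁⊆ : ∀ {ν} → ν ∈ S₁ → ν ∈ S × Maximal ν
  S₁⊆ = ∈-filter⁻ maximal? {xs = S}
  S₂⊆ : ∀ {ν} → ν ∈ S₂ → ν ∈ S × ¬ Maximal ν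
  S₂⊆ = ∈-filter⁻ (¬? ∘ maximal?) {xs = S}
  vanish₁ : ∀ α → ∑ S₁ (λ ν → d ν * e[ sub (suc t) ν ] α) ≡ 0ℚ
  vanish₁ α = begin
    ∑ S₁ (λ ν → d ν * e[ sub (suc t) ν ] α)
      ≡⟨ ∑-cong-∈ S₁ (λ {ν} ν∈ → cong (d ν *_) (trans (e-top (sub t ν) (suc l) α (proj₂ (S₁⊆ ν∈))) (cong (λ μ → e[ μ ] α) (map-pred-sub t ν)))) ⟨
    ∑ S₁ (λ ν → d ν * e[ sub t ν ] (suc l ∷ α))
      ≡⟨ ∑-filter-∈ maximal? S (λ ν → d ν * e[ sub t ν ] (suc l ∷ α))
           (λ {ν} ν∈ ¬max → trans (cong (d ν *_) (e-above (sub t ν) (suc l) α (ℕ.≤∧≢⇒< (≤l ν∈) ¬max))) (ℚ.*-zeroʳ (d ν))) ⟩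
    ∑ S (λ ν → d ν * e[ sub t ν ] (suc l ∷ α))
      ≡⟨ vanish (suc l ∷ α) ⟩
    0ℚ ∎
    where open ≡-Reasoning
  sep₁ : Separated (suc t) S₁
  sep₁ {ν} {μ} ν∈ μ∈ h = sep (proj₁ (S₁⊆ ν∈)) (proj₁ (S₁⊆ μ∈)) λ u t≤u → case u (t ℕ.≟ u) t≤u
    where
    case : ∀ u → Dec (t ≡ u) → t ≤ u → positives (sub u ν) ≡ positives (sub u μ)
    case u (yes refl) _   = trans (proj₂ (S₁⊆ ν∈)) (sym (proj₂ (S₁⊆ μ∈)))
    case u (no t≢u)   t≤u = h u (ℕ.≤∧≢⇒< t≤u t≢u)
  -- Lowering the parts raises `t`, so the same bound on the parts is now `f + suc t`: `f` decreases
  -- while the bound on the number of positive parts is kept.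
  zero₁ : ∀ {ν} → ν ∈ S₁ → d ν ≡ 0ℚ
  zero₁ = independent f (suc l) (suc t) S₁ d (Unique.filter⁺ maximal? S!) sep₁
    (λ {ν} ν∈ → subst (λ k → All (_≤ k) ν) (sym (ℕ.+-suc f t)) (≤t (proj₁ (S₁⊆ ν∈))))
    (λ {ν} ν∈ → ℕ.≤-trans (positives-sub-suc t ν) (≤l (proj₁ (S₁⊆ ν∈)))) vanish₁
  vanish₂ : ∀ α → ∑ S₂ (λ ν → d ν * e[ sub t ν ] α) ≡ 0ℚ
  vanish₂ α = trans (∑-filter-∈ (¬? ∘ maximal?) S (λ ν → d ν * e[ sub t ν ] α)
    (λ {ν} ν∈ ¬¬max → trans (cong (_* e[ sub t ν ] α) (zero₁ (∈-filter⁺ maximal? ν∈ (decidable-stable (maximal? ν) ¬¬max)))) (ℚ.*-zeroˡ (e[ sub t ν ] α))))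
    (vanish α)
  go : Dec (Maximal ν) → d ν ≡ 0ℚ
  go (yes max) = zero₁ (∈-filter⁺ maximal? ν∈ max)
  -- Once the maximal elements are discarded, the bound on the number of positive parts decreases
  -- instead.
  go (no ¬max) = independent (suc f) l t S₂ d (Unique.filter⁺ (¬? ∘ maximal?) S!)
    (λ ν∈ μ∈ → sep (proj₁ (S₂⊆ ν∈)) (proj₁ (S₂⊆ μ∈)))
    (≤t ∘ proj₁ ∘ S₂⊆) (λ ν∈ → ℕ.≤-pred (ℕ.≤∧≢⇒< (≤l (proj₁ (S₂⊆ ν∈))) (proj₂ (S₂⊆ ν∈)))) vanish₂
    (∈-filter⁺ (¬? ∘ maximal?) ν∈ ¬max)

positives-above : ∀ {a b} ν → a < b → ∃ λ k → positives (sub a (b ∷ ν)) ≡ suc k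
positives-above {a} {b} ν a<b with b ∸ a | ℕ.m<n⇒0<n∸m a<b
... | suc _ | _ = positives (sub a ν) , refl

positives-cancel : ∀ a ν μ → positives (a ∷ ν) ≡ positives (a ∷ μ) → positives ν ≡ positives μ
positives-cancel zero    ν μ eq = eq
positives-cancel (suc a) ν μ eq = ℕ.suc-injective eq

-- If the largest parts differ, take the smaller of them as `u`: one list has no part above `u`, the
-- other has one. Equal largest parts are cancelled.
partition-separated : ∀ ν μ → AllPairs _≥_ ν → AllPairs _≥_ μ → All NonZero ν → All NonZero μ →
  (∀ u → positives (sub u ν) ≡ positives (sub u μ)) → ν ≡ μ
partition-separated []      []      _ _ _ _ h = refl
partition-separated []      (zero ∷ μ)  _ _ _ (() ∷ _) h
partition-separated []      (suc b ∷ μ) _ _ _ _ h = ⊥-elim (ℕ.1+n≢0 (sym (h 0)))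
partition-separated (suc a ∷ ν) []      _ _ _ _ h = ⊥-elim (ℕ.1+n≢0 (h 0))
partition-separated (a ∷ ν) (b ∷ μ) (a≥ ∷ ν≥) (b≥ ∷ μ≥) (_ ∷ ν>0) (_ ∷ μ>0) h with ℕ.<-cmp a b
... | tri< a<b _ _ = ⊥-elim (ℕ.1+n≢0 (trans (sym (proj₂ (positives-above μ a<b))) (trans (sym (h a)) (positives-bounded a (ℕ.≤-refl ∷ a≥)))))
... | tri> _ _ b<a = ⊥-elim (ℕ.1+n≢0 (trans (sym (proj₂ (positives-above ν b<a))) (trans (h b) (positives-bounded b (ℕ.≤-refl ∷ b≥)))))
... | tri≈ _ refl _ = cong (a ∷_) (partition-separated ν μ ν≥ μ≥ ν>0 μ>0 (λ u → positives-cancel (a ∸ u) (sub u ν) (sub u μ) (h u)))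

sub-zero : ∀ ν → sub 0 ν ≡ ν
sub-zero []      = refl
sub-zero (a ∷ ν) = cong (a ∷_) (sub-zero ν)

expansion-unique : ∀ c d k → (∀ α → sum α ≡ k → 𝔼 c α ≡ 𝔼 d α) → ∀ {ν} → Partition k ν → c ν ≡ d ν
expansion-unique c d k same {ν} p = begin
  c ν               ≡⟨ solve 2 (λ a b → a := (a :- b) :+ b) refl (c ν) (d ν) ⟩
  (c ν -ℚ d ν) + d ν ≡⟨ cong (λ r → r + d ν) difference ⟩
  0ℚ + d ν          ≡⟨ ℚ.+-identityˡ (d ν) ⟩
  d ν               ∎
  where
  open ≡-Reasoning
  open Data.Rational.Solver.+-*-Solver
  S = partitions k
  vanish : ∀ α → ∑ S (λ ν → (c ν -ℚ d ν) * e[ ν ] α) ≡ 0ℚ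
  vanish α = go (sum α ℕ.≟ k)
    where
    go : Dec (sum α ≡ k) → ∑ S (λ ν → (c ν -ℚ d ν) * e[ ν ] α) ≡ 0ℚ
    go (yes refl) = begin
      𝔼 (λ ν → c ν + - d ν) α       ≡⟨ 𝔼-+ c (λ ν → - d ν) α ⟩
      𝔼 c α + 𝔼 (λ ν → - d ν) α     ≡⟨ cong₂ _+_ (same α refl) (𝔼-cong α (λ ν _ → solve 1 (λ a → :- a := con (- 1ℚ) :* a) refl (d ν))) ⟩
      𝔼 d α + 𝔼 (λ ν → - 1ℚ * d ν) α ≡⟨ cong (λ r → 𝔼 d α + r) (𝔼-* (- 1ℚ) d α) ⟩
      𝔼 d α + - 1ℚ * 𝔼 d α          ≡⟨ solve 1 (λ a → a :+ con (- 1ℚ) :* a := con 0ℚ) refl (𝔼 d α) ⟩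
      0ℚ                            ∎
    -- Outside degree `k` every term vanishes by homogeneity; `independent` asks for the relation at
    -- all monomials.
    go (no ≢k) = ∑-zero S λ {ν} ν∈ → trans (cong ((c ν -ℚ d ν) *_)
      (homogeneous-e[] ν α (λ eq → ≢k (trans eq (Partition.size (partitions-sound ν∈)))))) (ℚ.*-zeroʳ (c ν -ℚ d ν))
  difference : c ν -ℚ d ν ≡ 0ℚ
  difference = independent k (totalPositives S) 0 S (λ ν → c ν -ℚ d ν) (partitions≤-unique k k)
    (λ ν∈ μ∈ h → separated (partitions-sound ν∈) (partitions-sound μ∈) (λ u → h u z≤n))
    (λ {ν} ν∈ → subst (λ n → All (_≤ n) ν) (trans (Partition.size (partitions-sound ν∈)) (sym (ℕ.+-identityʳ k))) (parts≤sum ν))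
    (bound S)
    (λ α → trans (∑-cong S (λ ν → cong (λ μ → (c ν -ℚ d ν) * e[ μ ] α) (sub-zero ν))) (vanish α))
    (partitions-complete p)
    where
    open Partition
    separated : ∀ {ν μ} → Partition k ν → Partition k μ → (∀ u → positives (sub u ν) ≡ positives (sub u μ)) → ν ≡ μ
    separated {ν} {μ} p q = partition-separated ν μ (sorted p) (sorted q) (positive p) (positive q)
    -- A crude common bound on the numbers of parts is enough to start the induction.
    totalPositives : List (List ℕ) → ℕ
    totalPositives []      = 0
    totalPositives (ν ∷ S) = positives (sub 0 ν) +ℕ totalPositives S
    bound : ∀ S {ν} → ν ∈ S → positives (sub 0 ν) ≤ totalPositives S
    bound (ν ∷ S) (here refl) = ℕ.m≤m+n _ (totalPositives S)
    bound (ν ∷ S) (there ν∈)  = ℕ.≤-trans (bound S ν∈) (ℕ.m≤n+m (totalPositives S) _)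

-- The coefficients

ι-- : ∀ a b → ι (a -ℤ b) ≡ ι a -ℚ ι b
ι-- a b = trans (ι-+ a (-ℤ b)) (cong (λ r → ι a + r) (ι-neg b))

ι-² : ∀ a → ι (a ^ℤ 2) ≡ ι a * ι a
ι-² a = trans (cong ι (cong (a *ℤ_) (ℤ.*-identityʳ a))) (ι-* a a)

∑-upTo-extend : ∀ k {n} (f : ℕ → ℚ) → k ≤ n → (∀ j → k ≤ j → f j ≡ 0ℚ) → ∑ (upTo k) f ≡ ∑ (upTo n) f
∑-upTo-extend zero    {n}     f _         h = sym (∑-zero (upTo n) (λ {j} _ → h j z≤n))
∑-upTo-extend (suc k) {suc n} f (s≤s k≤n) h = trans (∑-upTo-suc k f)
  (trans (cong (λ r → f 0 + r) (∑-upTo-extend k (f ∘ suc) k≤n (λ j k≤j → h (suc j) (s≤s k≤j)))) (sym (∑-upTo-suc n f)))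

ε?≡ext : ∀ m → ε? m ≡ ext ε m
ε?≡ext nothing  = refl
ε?≡ext (just ν) = refl

shift-absent : ∀ c a ν → mult a ν ≡ 0 → shift a c ν ≡ 0ℚ
shift-absent c a ν eq = cong (ext c) (remove-nothing a ν eq)

shift₂ : ℕ → ℕ → List ℕ → ℚ
shift₂ a b ν = shift a (shift b ε) ν

ε?≡shift₂ : ∀ a b ν → ε[ ν - a - b ] ≡ shift₂ a b ν
ε?≡shift₂ a b ν = go (remove a ν)
  where
  go : ∀ m → ε? (m >>= remove b) ≡ ext (shift b ε) m
  go nothing  = refl
  go (just μ) = ε?≡ext (remove b μ)

mult-remove : ∀ a b {ν μ} → ν ↭ a ∷ μ → a ≢ b → mult b ν ≡ mult b μ
mult-remove a b {μ = μ} p a≢b = trans (mult-↭ b p) (mult-there μ a≢b)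

mult-remove-same : ∀ a {ν μ} → ν ↭ a ∷ μ → mult a ν ≡ suc (mult a μ)
mult-remove-same a {μ = μ} p = trans (mult-↭ a p) (mult-here a μ)

data RemoveView (a : ℕ) (ν : List ℕ) : Set where
  absent  : mult a ν ≡ 0 → remove a ν ≡ nothing → RemoveView a ν
  present : ∀ μ → ν ↭ a ∷ μ → remove a ν ≡ just μ → RemoveView a ν

removeView : ∀ a ν → RemoveView a ν
removeView a ν = go (mult a ν) refl
  where
  go : ∀ m → mult a ν ≡ m → RemoveView a ν
  go zero    eq = absent eq (remove-nothing a ν eq)
  go (suc m) eq with μ , rem ← remove-just a ν eq = present μ (remove-↭ a ν rem) rem

shift₂-absentˡ : ∀ a b ν → mult a ν ≡ 0 → shift₂ a b ν ≡ 0ℚ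
shift₂-absentˡ a b ν = shift-absent (shift b ε) a ν

shift₂-absentʳ : ∀ a b ν → mult b ν ≡ 0 → shift₂ a b ν ≡ 0ℚ
shift₂-absentʳ a b ν eq = go (removeView a ν)
  where
  go : RemoveView a ν → shift₂ a b ν ≡ 0ℚ
  go (absent _ rem)     = cong (ext (shift b ε)) rem
  go (present μ p rem) = trans (cong (ext (shift b ε)) rem) (shift-absent ε b μ (case (a ℕ.≟ b)))
    where
    case : Dec (a ≡ b) → mult b μ ≡ 0
    case (yes refl) = ⊥-elim (ℕ.1+n≢0 (trans (sym (mult-remove-same a p)) eq))
    case (no a≢b)   = trans (sym (mult-remove a b p a≢b)) eq

shift₂-same : ∀ a ν → mult a ν < 2 → shift₂ a a ν ≡ 0ℚ
shift₂-same a ν <2 = go (removeView a ν)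
  where
  go : RemoveView a ν → shift₂ a a ν ≡ 0ℚ
  go (absent _ rem)    = cong (ext (shift a ε)) rem
  go (present μ p rem) = trans (cong (ext (shift a ε)) rem)
    (shift-absent ε a μ (ℕ.n<1⇒n≡0 (ℕ.≤-pred (subst (_< 2) (mult-remove-same a p) <2))))

-- Both orders of removal leave the same multiset, and `ε` depends on nothing else.
shift₂-sym : ∀ a b ν → shift₂ a b ν ≡ shift₂ b a ν
shift₂-sym a b ν = go (a ℕ.≟ b) (removeView a ν) (removeView b ν)
  where
  go : Dec (a ≡ b) → RemoveView a ν → RemoveView b ν → shift₂ a b ν ≡ shift₂ b a ν
  go (yes refl) _ _ = refl
  go (no _) (absent eq _) _ = trans (shift₂-absentˡ a b ν eq) (sym (shift₂-absentʳ b a ν eq))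
  go (no _) (present _ _ _) (absent eq _) = trans (shift₂-absentʳ a b ν eq) (sym (shift₂-absentˡ b a ν eq))
  go (no a≢b) (present μ p rem) (present ρ q rem′)
    with σ , r ← remove-just b μ (trans (sym (mult-remove a b p a≢b)) (mult-remove-same b q))
       | τ , r′ ← remove-just a ρ (trans (sym (mult-remove b a q (a≢b ∘ sym))) (mult-remove-same a p)) =
    trans (trans (cong (ext (shift b ε)) rem) (cong (ext ε) r))
      (trans (ε-↭ (drop-∷ (drop-∷ perm))) (sym (trans (cong (ext (shift a ε)) rem′) (cong (ext ε) r′))))
    where
    perm : a ∷ b ∷ σ ↭ a ∷ b ∷ τ
    perm = Perm.trans (Perm.prep a (Perm.↭-sym (remove-↭ b μ r))) (Perm.trans (Perm.↭-sym p) (Perm.trans q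
      (Perm.trans (Perm.prep b (remove-↭ a ρ r′)) (Perm.swap b a Perm.refl))))

-- One range `K` serves a partition and everything obtained from it by removals, so that such sums
-- can be added termwise. The index 0 contributes nothing when all parts are positive.
parts : ℕ → (ℕ → ℚ) → List ℕ → ℚ
parts K φ ν = ∑ (upTo K) λ j → φ j * shift j ε ν

parts-single : ∀ K φ a ν → a < K → (∀ j → j ≢ a → shift j ε ν ≡ 0ℚ) → parts K φ ν ≡ φ a * shift a ε ν
parts-single K φ a ν a<K h = ∑-upTo-single K a (λ j → φ j * shift j ε ν) a<K (λ j j≢a → trans (cong (φ j *_) (h j j≢a)) (ℚ.*-zeroʳ (φ j)))

mult-0 : ∀ {ν} → All NonZero ν → mult 0 ν ≡ 0
mult-0 []                     = refl
mult-0 {suc a ∷ ν} (_ ∷ ν>0) = trans (mult-there {0} {suc a} ν (λ ())) (mult-0 ν>0)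

parts-suc : ∀ K φ ν → sum ν < K → φ 0 * shift 0 ε ν ≡ 0ℚ →
  ∑ (upTo (sum ν)) (λ j → φ (suc j) * shift (suc j) ε ν) ≡ parts K φ ν
parts-suc K φ ν <K zero₀ = begin
  ∑ (upTo (sum ν)) (f ∘ suc)          ≡⟨ ℚ.+-identityˡ _ ⟨
  0ℚ + ∑ (upTo (sum ν)) (f ∘ suc)     ≡⟨ cong (λ r → r + ∑ (upTo (sum ν)) (f ∘ suc)) zero₀ ⟨
  f 0 + ∑ (upTo (sum ν)) (f ∘ suc)    ≡⟨ ∑-upTo-suc (sum ν) f ⟨
  ∑ (upTo (suc (sum ν))) f            ≡⟨ ∑-upTo-extend (suc (sum ν)) f <K (λ j <j →
                                           trans (cong (φ j *_) (shift-absent ε j ν (mult-above j ν <j))) (ℚ.*-zeroʳ (φ j))) ⟩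
  parts K φ ν                         ∎
  where
  open ≡-Reasoning
  f : ℕ → ℚ
  f j = φ j * shift j ε ν

coeff-parts : ∀ K φ ν → sum ν < K → φ 0 ≡ 0ℚ → coeff φ ν ≡ parts K φ ν
coeff-parts K φ ν <K φ₀ = trans (cong₂ _+_ (trans (cong (_* ε ν) φ₀) (ℚ.*-zeroˡ (ε ν)))
  (parts-suc K φ ν <K (trans (cong (_* shift 0 ε ν) φ₀) (ℚ.*-zeroˡ (shift 0 ε ν))))) (ℚ.+-identityˡ _)

data NonEmpty : List ℕ → Set where
  cons : ∀ a ν → NonEmpty (a ∷ ν)

sum>0⇒nonEmpty : ∀ ν → 0 < sum ν → NonEmpty ν
sum>0⇒nonEmpty (a ∷ ν) _ = cons a ν

-- For a nonempty partition the recursion absorbs the summand `ε ν`, which raises the weight 1 of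
-- each removal of `j` to `j`.
coeffP-parts : ∀ K {ν} → NonEmpty ν → All NonZero ν → sum ν < K → coeff φP ν ≡ parts K φD ν
coeffP-parts K (cons a ν) >0 <K = trans (coeffP (a ∷ ν) >0) (trans (ℚ.+-identityˡ _) (coeff-parts K φD (a ∷ ν) <K refl))

ψ : ℕ → ℚ
ψ j = ι (+ j -ℤ + 1)

ε-parts : ∀ K {ν} → NonEmpty ν → All NonZero ν → sum ν < K → ε ν ≡ parts K ψ ν
ε-parts K (cons a ν) >0 <K = trans (ε-recursion (sum (a ∷ ν)) a ν >0 ℕ.≤-refl)
  (parts-suc K ψ (a ∷ ν) <K (trans (cong (ψ 0 *_) (shift-absent ε 0 (a ∷ ν) (mult-0 >0))) (ℚ.*-zeroʳ (ψ 0))))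

shift-ε-1∈ : ∀ j ν {m} → j ≢ 1 → mult 1 ν ≡ suc m → shift j ε ν ≡ 0ℚ
shift-ε-1∈ j ν j≢1 eq = go (removeView j ν)
  where
  go : RemoveView j ν → shift j ε ν ≡ 0ℚ
  go (absent _ rem)    = cong (ext ε) rem
  go (present μ p rem) = trans (cong (ext ε) rem) (ε-1∈ μ (trans (sym (mult-remove j 1 p j≢1)) eq))

-- A single removal leaves at least one of the two parts 1, so `ε-1∈` applies.
shift-ε-11∈ : ∀ j ν {m} → mult 1 ν ≡ suc (suc m) → shift j ε ν ≡ 0ℚ
shift-ε-11∈ j ν {m} eq = go (j ℕ.≟ 1) (removeView j ν)
  where
  go : Dec (j ≡ 1) → RemoveView j ν → shift j ε ν ≡ 0ℚ
  go (no j≢1)   _                 = shift-ε-1∈ j ν j≢1 eq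
  go (yes refl) (absent _ rem)    = cong (ext ε) rem
  go (yes refl) (present μ p rem) = trans (cong (ext ε) rem) (ε-1∈ μ (ℕ.suc-injective (trans (sym (mult-remove-same 1 p)) eq)))

-- The combined weight `2 (a² - a) - 3 a` of the terms `2 C` and `-3 P`.
φ₅ : ℕ → ℚ
φ₅ a = ι (+ 2 *ℤ (+ a) ^ℤ 2 -ℤ + 5 *ℤ + a)

φ₅-formula : ∀ a → φ₅ a ≡ ι (+ 2) * (fromℕ a * fromℕ a) -ℚ ι (+ 5) * fromℕ a
φ₅-formula a = trans (ι-- (+ 2 *ℤ (+ a) ^ℤ 2) (+ 5 *ℤ + a))
  (cong₂ _-ℚ_ (trans (ι-* (+ 2) ((+ a) ^ℤ 2)) (cong (ι (+ 2) *_) (ι-² (+ a)))) (ι-* (+ 5) (+ a)))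

θ : ℕ → ℚ
θ i = ι ((+ i -ℤ + 1) *ℤ (+ i -ℤ + 3))

ω : ℕ → ℚ
ω d = ι (+ 2 *ℤ (+ d) ^ℤ 2 -ℤ + 6 *ℤ + d +ℤ + 2)

ω-formula : ∀ d → ω d ≡ ι (+ 2) * (fromℕ d * fromℕ d) -ℚ ι (+ 6) * fromℕ d + ι (+ 2)
ω-formula d = trans (ι-+ (+ 2 *ℤ (+ d) ^ℤ 2 -ℤ + 6 *ℤ + d) (+ 2)) (cong (λ r → r + ι (+ 2)) (trans (ι-- (+ 2 *ℤ (+ d) ^ℤ 2) (+ 6 *ℤ + d))
  (cong₂ _-ℚ_ (trans (ι-* (+ 2) ((+ d) ^ℤ 2)) (cong (ι (+ 2) *_) (ι-² (+ d)))) (ι-* (+ 6) (+ d)))))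

mult-bounded : ∀ {n μ} j → All (_< n) μ → n ≤ j → mult j μ ≡ 0
mult-bounded           j []       n≤j = refl
mult-bounded {μ = b ∷ μ} j (b< ∷ p) n≤j = trans (mult-there {j} {b} μ (λ { refl → ℕ.<⇒≱ b< n≤j })) (mult-bounded j p n≤j)

mult-+-≤ : ∀ j i ν → j ≢ i → mult j ν +ℕ mult i ν ≤ length ν
mult-+-≤ j i []      j≢i = z≤n
mult-+-≤ j i (b ∷ ν) j≢i = go (b ℕ.≟ j) (b ℕ.≟ i)
  where
  go : Dec (b ≡ j) → Dec (b ≡ i) → mult j (b ∷ ν) +ℕ mult i (b ∷ ν) ≤ suc (length ν)
  go (yes refl) (yes refl) = ⊥-elim (j≢i refl)
  go (yes refl) (no b≢i)   = subst (_≤ suc (length ν)) (sym (cong₂ _+ℕ_ (mult-here b ν) (mult-there ν b≢i))) (s≤s (mult-+-≤ j i ν j≢i))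
  go (no b≢j)   (yes refl) = subst (_≤ suc (length ν)) (sym (trans (cong₂ _+ℕ_ (mult-there ν b≢j) (mult-here b ν)) (ℕ.+-suc (mult j ν) (mult b ν))))
    (s≤s (mult-+-≤ j i ν j≢i))
  go (no b≢j)   (no b≢i)   = subst (_≤ suc (length ν)) (sym (cong₂ _+ℕ_ (mult-there ν b≢j) (mult-there ν b≢i))) (ℕ.m≤n⇒m≤1+n (mult-+-≤ j i ν j≢i))

-- The coefficient formulas for a fixed partition

module _ (k : ℕ) (4≤k : 4 ≤ k) (ν : List ℕ) (partition : Partition k ν) where

  open Partition partition
  K = suc k

  ν<K : sum ν < K
  ν<K = s≤s (ℕ.≤-reflexive size)

  smaller : ∀ {a μ} → ν ↭ a ∷ μ → sum μ < K
  smaller {a} {μ} p = ℕ.≤-<-trans (subst (sum μ ≤_) (sym (sum-↭ p)) (ℕ.m≤n+m (sum μ) a)) ν<K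

  positive′ : ∀ {a μ} → ν ↭ a ∷ μ → All NonZero μ
  positive′ p with _ ∷ >0 ← All-resp-↭ p positive = >0

  -- `2 C` and `-3 P` merge into one sum over single removals. The terms with `e₁` and `e₂` are kept
  -- apart because they vanish without a part 1 or 2.
  twinCoeff-parts : twinCoeff ν ≡ parts K φ₅ ν + (shift 1 (coeff φC) ν + shift 2 (coeff φP) ν)
  twinCoeff-parts = begin
    (ι (+ 2) * coeff φC ν + shift 1 (coeff φC) ν) + (shift 2 (coeff φP) ν + - ι (+ 3) * coeff φP ν)
      ≡⟨ cong₂ (λ p q → (ι (+ 2) * p + shift 1 (coeff φC) ν) + (shift 2 (coeff φP) ν + - ι (+ 3) * q))
           (coeff-parts K φC ν ν<K refl) (coeffP-parts K (sum>0⇒nonEmpty ν (subst (0 <_) (sym size) (ℕ.≤-trans (s≤s z≤n) 4≤k))) positive ν<K) ⟩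
    (ι (+ 2) * parts K φC ν + shift 1 (coeff φC) ν) + (shift 2 (coeff φP) ν + - ι (+ 3) * parts K φD ν)
      ≡⟨ solve 4 (λ p a b q → (p :+ a) :+ (b :+ q) := (p :+ q) :+ (a :+ b)) refl (ι (+ 2) * parts K φC ν) _ _ (- ι (+ 3) * parts K φD ν) ⟩
    (ι (+ 2) * parts K φC ν + - ι (+ 3) * parts K φD ν) + (shift 1 (coeff φC) ν + shift 2 (coeff φP) ν)
      ≡⟨ cong (λ r → r + (shift 1 (coeff φC) ν + shift 2 (coeff φP) ν)) combine ⟩
    parts K φ₅ ν + (shift 1 (coeff φC) ν + shift 2 (coeff φP) ν) ∎
    where
    open ≡-Reasoning
    open Data.Rational.Solver.+-*-Solver
    combine : ι (+ 2) * parts K φC ν + - ι (+ 3) * parts K φD ν ≡ parts K φ₅ ν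
    combine = trans (cong₂ _+_ (*-distribˡ-∑ (upTo K) (ι (+ 2)) (λ j → φC j * shift j ε ν)) (*-distribˡ-∑ (upTo K) (- ι (+ 3)) (λ j → φD j * shift j ε ν)))
      (trans (sym (∑-distrib-+ (upTo K) (λ j → ι (+ 2) * (φC j * shift j ε ν)) (λ j → - ι (+ 3) * (φD j * shift j ε ν))))
      (∑-cong (upTo K) (λ j → trans
        (solve 2 (λ n s → con (ι (+ 2)) :* ((n :* n :- n) :* s) :+ con (- ι (+ 3)) :* (n :* s) := (con (ι (+ 2)) :* (n :* n) :- con (ι (+ 5)) :* n) :* s) refl (fromℕ j) (shift j ε ν))
        (cong (_* shift j ε ν) (sym (φ₅-formula j))))))

  -- Almost every removal leaves a part 1, where `ε` vanishes. The exception is to remove 1 twice in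
  -- the `e₁` term, but there the weight `j² - j` at `j = 1` is 0.
  coefficient-b : 1 < mult 1 ν → twinCoeff ν ≡ 0ℚ
  coefficient-b 1<m = trans twinCoeff-parts (cong₂ _+_
    (∑-zero (upTo K) (λ {j} _ → trans (cong (φ₅ j *_) (shift-ε-11∈ j ν m≡)) (ℚ.*-zeroʳ (φ₅ j))))
    (cong₂ _+_ (without-1 (removeView 1 ν)) (without-2 (removeView 2 ν))))
    where
    m≡ : mult 1 ν ≡ suc (suc (mult 1 ν ∸ 2))
    m≡ = sym (ℕ.m+[n∸m]≡n 1<m)
    without-1 : RemoveView 1 ν → shift 1 (coeff φC) ν ≡ 0ℚ
    without-1 (absent _ rem)    = cong (ext (coeff φC)) rem
    without-1 (present μ p rem) = trans (cong (ext (coeff φC)) rem) (trans (coeff-parts K φC μ (smaller p) refl)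
      (∑-zero (upTo K) (λ {j} _ → term j (j ℕ.≟ 1))))
      where
      term : ∀ j → Dec (j ≡ 1) → φC j * shift j ε μ ≡ 0ℚ
      term j (yes refl) = ℚ.*-zeroˡ (shift 1 ε μ)
      term j (no j≢1)   = trans (cong (φC j *_) (shift-ε-1∈ j μ j≢1 (ℕ.suc-injective (trans (sym (mult-remove-same 1 p)) m≡)))) (ℚ.*-zeroʳ (φC j))
    without-2 : RemoveView 2 ν → shift 2 (coeff φP) ν ≡ 0ℚ
    without-2 (absent _ rem)    = cong (ext (coeff φP)) rem
    without-2 (present μ p rem) = trans (cong (ext (coeff φP)) rem) (cong₂ _+_
      (trans (cong (1ℚ *_) (ε-1∈ μ μ₁)) refl)
      (∑-zero (upTo (sum μ)) (λ {j} _ → cong (1ℚ *_) (shift-ε-11∈ (suc j) μ μ₁))))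
      where
      μ₁ : mult 1 μ ≡ suc (suc (mult 1 ν ∸ 2))
      μ₁ = trans (sym (mult-remove 2 1 p (λ ()))) m≡

  supp-sum : ∀ f μ → sum μ < K → (∀ j → mult j μ ≡ 0 → f j ≡ 0ℚ) → ∑ (supp μ) f ≡ ∑ (upTo K) f
  supp-sum f μ <K vanish = trans
    (∑-filter (λ j → 1 ≤? mult j μ) (upTo (suc (sum μ))) f (λ j ≱1 → vanish j (ℕ.n<1⇒n≡0 (ℕ.≰⇒> ≱1))))
    (∑-upTo-extend (suc (sum μ)) f <K (λ j <j → vanish j (mult-above j μ <j)))

  supp-filter-sum : ∀ n f g μ → sum μ < K → (∀ j → n ≤ j → f j ≡ g j) → (∀ j → ¬ n ≤ j → g j ≡ 0ℚ) → (∀ j → mult j μ ≡ 0 → g j ≡ 0ℚ) →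
    ∑ (filter (n ≤?_) (supp μ)) f ≡ ∑ (upTo K) g
  supp-filter-sum n f g μ <K agree small vanish = trans
    (∑-cong-∈ (filter (n ≤?_) (supp μ)) (λ {j} j∈ → agree j (proj₂ (∈-filter⁻ (n ≤?_) {xs = supp μ} j∈))))
    (trans (∑-filter (n ≤?_) (supp μ) g small) (supp-sum g μ <K vanish))

  coefficient-d : mult 1 ν ≡ 0 → mult 2 ν ≡ 0 → twinCoeff ν ≡ ∑ (supp ν) (λ a → φ₅ a * ε[ ν - a ])
  coefficient-d m₁ m₂ = trans twinCoeff-parts (trans (cong₂ (λ p q → parts K φ₅ ν + (p + q)) (shift-absent (coeff φC) 1 ν m₁) (shift-absent (coeff φP) 2 ν m₂))
    (trans (ℚ.+-identityʳ (parts K φ₅ ν)) (sym (trans (supp-sum (λ a → φ₅ a * ε[ ν - a ]) ν ν<K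
        (λ j eq → trans (cong (λ m → φ₅ j * ε? m) (remove-nothing j ν eq)) (ℚ.*-zeroʳ (φ₅ j))))
      (∑-cong (upTo K) (λ j → cong (φ₅ j *_) (ε?≡ext (remove j ν))))))))

  sum-removed : ∀ {a μ} → ν ↭ a ∷ μ → a < 4 → NonEmpty μ
  sum-removed {a} {μ} p a<4 = sum>0⇒nonEmpty μ (ℕ.+-cancelˡ-< a 0 (sum μ)
    (subst (a +ℕ 0 <_) (trans (sym size) (sum-↭ p)) (subst (_< k) (sym (ℕ.+-identityʳ a)) (ℕ.<-≤-trans a<4 4≤k))))

  -- Only removals that use up the part 1 survive, giving `-3 ε(μ)`, the sum of `(j² - j) ε(μ - j)`,
  -- and `ε(μ - 2)` from the `e₂` term. Expanding `ε(μ)` by the recursion makes the weight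
  -- `(j - 1)(j - 3)`, plus 1 at `j = 2`; it vanishes for `j = 2` and `j = 3`, so the sum starts at
  -- 4.
  coefficient-c : ∀ {μ} → mult 1 ν ≡ 1 → remove 1 ν ≡ just μ → twinCoeff ν ≡ ∑ (filter (4 ≤?_) (supp μ)) (λ i → θ i * ε[ μ - i ])
  coefficient-c {μ} m₁ rem = begin
    twinCoeff ν
      ≡⟨ twinCoeff-parts ⟩
    parts K φ₅ ν + (shift 1 (coeff φC) ν + shift 2 (coeff φP) ν)
      ≡⟨ cong₂ _+_ (trans (parts-single K φ₅ 1 ν (s≤s (ℕ.≤-trans (s≤s z≤n) 4≤k)) (λ j j≢1 → shift-ε-1∈ j ν j≢1 m₁)) (cong (λ m → φ₅ 1 * ext ε m) rem))
           (cong₂ _+_ (trans (cong (ext (coeff φC)) rem) (coeff-parts K φC μ (smaller p) refl)) (without-2 (removeView 2 ν))) ⟩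
    φ₅ 1 * ε μ + (parts K φC μ + s 2)
      ≡⟨ cong₂ (λ p q → p + (parts K φC μ + q))
           (trans (cong (φ₅ 1 *_) (ε-parts K (sum-removed p (s≤s (s≤s z≤n))) (positive′ p) (smaller p))) (*-distribˡ-∑ (upTo K) (φ₅ 1) (λ j → ψ j * s j)))
           (sym (∑-upTo-single K 2 g (s≤s (ℕ.≤-trans (s≤s (s≤s z≤n)) 4≤k)) g-single)) ⟩
    ∑ (upTo K) (λ j → φ₅ 1 * (ψ j * s j)) + (parts K φC μ + ∑ (upTo K) g)
      ≡⟨ trans (cong (λ r → ∑ (upTo K) (λ j → φ₅ 1 * (ψ j * s j)) + r) (sym (∑-distrib-+ (upTo K) (λ j → φC j * s j) g)))
           (sym (∑-distrib-+ (upTo K) (λ j → φ₅ 1 * (ψ j * s j)) (λ j → φC j * s j + g j))) ⟩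
    ∑ (upTo K) (λ j → φ₅ 1 * (ψ j * s j) + (φC j * s j + g j))
      ≡⟨ ∑-cong (upTo K) pointwise ⟩
    ∑ (upTo K) target
      ≡⟨ supp-filter-sum 4 (λ i → θ i * ε[ μ - i ]) target μ (smaller p) agree small vanish ⟨
    ∑ (filter (4 ≤?_) (supp μ)) (λ i → θ i * ε[ μ - i ]) ∎
    where
    open ≡-Reasoning
    open Data.Rational.Solver.+-*-Solver
    p : ν ↭ 1 ∷ μ
    p = remove-↭ 1 ν rem
    s g target : ℕ → ℚ
    s j = shift j ε μ
    g 2 = s 2
    g _ = 0ℚ
    target j@(suc (suc (suc (suc _)))) = θ j * s j
    target _                           = 0ℚ
    μ₁ : mult 1 μ ≡ 0
    μ₁ = ℕ.suc-injective (trans (sym (mult-remove-same 1 p)) m₁)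
    s₀ : s 0 ≡ 0ℚ
    s₀ = shift-absent ε 0 μ (mult-0 (positive′ p))
    s₁ : s 1 ≡ 0ℚ
    s₁ = shift-absent ε 1 μ μ₁
    g-single : ∀ j → j ≢ 2 → g j ≡ 0ℚ
    g-single 0                   _   = refl
    g-single 1                   _   = refl
    g-single 2                   ≢2  = ⊥-elim (≢2 refl)
    g-single (suc (suc (suc j))) _   = refl
    pointwise : ∀ j → φ₅ 1 * (ψ j * s j) + (φC j * s j + g j) ≡ target j
    pointwise 0 = cong (λ r → φ₅ 1 * (ψ 0 * r) + (φC 0 * r + 0ℚ)) s₀
    pointwise 1 = cong (λ r → φ₅ 1 * (ψ 1 * r) + (φC 1 * r + 0ℚ)) s₁
    pointwise 2 = solve 1 (λ s → con (φ₅ 1) :* (con (ψ 2) :* s) :+ (con (φC 2) :* s :+ s) := con 0ℚ) refl (s 2)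
    pointwise 3 = solve 1 (λ s → con (φ₅ 1) :* (con (ψ 3) :* s) :+ (con (φC 3) :* s :+ con 0ℚ) := con 0ℚ) refl (s 3)
    pointwise j@(suc (suc (suc (suc _)))) = trans (cong (λ r → φ₅ 1 * (r * s j) + (φC j * s j + 0ℚ)) (ι-- (+ j) (+ 1)))
      (trans (solve 2 (λ n s → con (φ₅ 1) :* ((n :- con 1ℚ) :* s) :+ ((n :* n :- n) :* s :+ con 0ℚ) := (n :- con 1ℚ) :* (n :- con (ι (+ 3))) :* s)
         refl (fromℕ j) (s j))
        (cong (_* s j) (sym (trans (ι-* (+ j -ℤ + 1) (+ j -ℤ + 3)) (cong₂ _*_ (ι-- (+ j) (+ 1)) (ι-- (+ j) (+ 3)))))))
    agree : ∀ j → 4 ≤ j → θ j * ε[ μ - j ] ≡ target j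
    agree j@(suc (suc (suc (suc _)))) _ = cong (θ j *_) (ε?≡ext (remove j μ))
    agree 1 (s≤s ())
    agree 2 (s≤s (s≤s ()))
    agree 3 (s≤s (s≤s (s≤s ())))
    small : ∀ j → ¬ 4 ≤ j → target j ≡ 0ℚ
    small 0 _ = refl
    small 1 _ = refl
    small 2 _ = refl
    small 3 _ = refl
    small (suc (suc (suc (suc j)))) ≱4 = ⊥-elim (≱4 (s≤s (s≤s (s≤s (s≤s z≤n)))))
    vanish : ∀ j → mult j μ ≡ 0 → target j ≡ 0ℚ
    vanish 0 _ = refl
    vanish 1 _ = refl
    vanish 2 _ = refl
    vanish 3 _ = refl
    vanish j@(suc (suc (suc (suc _)))) eq = trans (cong (θ j *_) (shift-absent ε j μ eq)) (ℚ.*-zeroʳ (θ j))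
    without-2 : RemoveView 2 ν → shift 2 (coeff φP) ν ≡ s 2
    without-2 (absent eq rem′)    = trans (cong (ext (coeff φP)) rem′) (sym (shift-absent ε 2 μ (trans (sym (mult-remove 1 2 p (λ ()))) eq)))
    without-2 (present ρ q rem′) = begin
      shift 2 (coeff φP) ν       ≡⟨ cong (ext (coeff φP)) rem′ ⟩
      coeff φP ρ                 ≡⟨ coeffP-parts K (sum-removed q (s≤s (s≤s (s≤s z≤n)))) (positive′ q) (smaller q) ⟩
      parts K φD ρ               ≡⟨ parts-single K φD 1 ρ (s≤s (ℕ.≤-trans (s≤s z≤n) 4≤k))
                                      (λ j j≢1 → shift-ε-1∈ j ρ j≢1 (trans (sym (mult-remove 2 1 q (λ ()))) m₁)) ⟩
      φD 1 * shift 1 ε ρ         ≡⟨ ℚ.*-identityˡ (shift 1 ε ρ) ⟩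
      shift 1 ε ρ                ≡⟨ cong (ext (shift 1 ε)) rem′ ⟨
      shift₂ 2 1 ν               ≡⟨ shift₂-sym 2 1 ν ⟩
      shift₂ 1 2 ν               ≡⟨ cong (ext (shift 2 ε)) rem ⟩
      s 2                        ∎

  coefficient-c-small : mult 1 ν ≡ 1 → All (_< 4) ν → twinCoeff ν ≡ 0ℚ
  coefficient-c-small m₁ <4 with μ , rem ← remove-just 1 ν m₁ = trans (coefficient-c m₁ rem)
    (∑-zero (filter (4 ≤?_) (supp μ)) λ {j} j∈ → trans
      (cong (λ m → θ j * ε? m) (remove-nothing j μ (mult-bounded j (All.tail (All-resp-↭ (remove-↭ 1 ν rem) <4)) (proj₂ (∈-filter⁻ (4 ≤?_) {xs = supp μ} j∈)))))
      (ℚ.*-zeroʳ (θ j)))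

  -- Only the double removal of 2 survives, and its total weight `φ₅ 2 * ψ 2 + φD 2` is `-2 + 2`.
  coefficient-e : mult 1 ν ≡ 0 → mult 2 ν ≡ length ν → twinCoeff ν ≡ 0ℚ
  coefficient-e m₁ m₂ = go (removeView 2 ν)
    where
    open ≡-Reasoning
    open Data.Rational.Solver.+-*-Solver
    others : ∀ j → j ≢ 2 → mult j ν ≡ 0
    others j j≢2 = ℕ.n≤0⇒n≡0 (ℕ.+-cancelʳ-≤ (mult 2 ν) (mult j ν) 0 (subst (mult j ν +ℕ mult 2 ν ≤_) (sym m₂) (mult-+-≤ j 2 ν j≢2)))
    go : RemoveView 2 ν → twinCoeff ν ≡ 0ℚ
    go (absent eq _) with sum>0⇒nonEmpty ν (subst (0 <_) (sym size) (ℕ.≤-trans (s≤s z≤n) 4≤k))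
    ... | cons _ _ = ⊥-elim (ℕ.1+n≢0 (trans (sym m₂) eq))
    go (present μ p rem) = begin
      twinCoeff ν
        ≡⟨ twinCoeff-parts ⟩
      parts K φ₅ ν + (shift 1 (coeff φC) ν + shift 2 (coeff φP) ν)
        ≡⟨ cong₂ _+_ (trans (parts-single K φ₅ 2 ν 2<K (λ j j≢2 → shift-absent ε j ν (others j j≢2))) (cong (λ m → φ₅ 2 * ext ε m) rem))
             (cong₂ _+_ (shift-absent (coeff φC) 1 ν m₁) (trans (cong (ext (coeff φP)) rem) (coeffP-parts K nonEmpty (positive′ p) (smaller p)))) ⟩
      φ₅ 2 * ε μ + (0ℚ + parts K φD μ)
        ≡⟨ cong₂ (λ q r → φ₅ 2 * q + (0ℚ + r)) (trans (ε-parts K nonEmpty (positive′ p) (smaller p)) (parts-single K ψ 2 μ 2<K others′)) (parts-single K φD 2 μ 2<K others′) ⟩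
      φ₅ 2 * (ψ 2 * shift 2 ε μ) + (0ℚ + φD 2 * shift 2 ε μ)
        ≡⟨ solve 1 (λ s → con (φ₅ 2) :* (con (ψ 2) :* s) :+ (con 0ℚ :+ con (φD 2) :* s) := con 0ℚ) refl (shift 2 ε μ) ⟩
      0ℚ ∎
      where
      2<K = s≤s (ℕ.≤-trans (s≤s (s≤s z≤n)) 4≤k)
      nonEmpty = sum-removed p (s≤s (s≤s (s≤s z≤n)))
      others′ : ∀ j → j ≢ 2 → shift j ε μ ≡ 0ℚ
      others′ j j≢2 = shift-absent ε j μ (trans (sym (mult-remove 2 j p (j≢2 ∘ sym))) (others j j≢2))

  -- The `e₂` term already removes two parts, one of them a 2. The recursion expands each `ε(ν - a)`
  -- to the same depth, after which the pairs containing a 2 can be merged.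
  coefficient-f : mult 1 ν ≡ 0 → 1 ≤ mult 2 ν → mult 2 ν < length ν →
    twinCoeff ν ≡ ∑ (filter (λ (a , b) → (3 ≤? a) ×-dec (3 ≤? b)) (suppPairs ν)) (λ (a , b) → ε[ ν - a - b ] * φ₅ a * ψ b)
                + ∑ (filter (3 ≤?_) (supp ν)) (λ d → ε[ ν - d - 2 ] * ω d)
  coefficient-f m₁ 1≤m₂ m₂<ℓ = begin
    twinCoeff ν
      ≡⟨ twinCoeff-parts ⟩
    parts K φ₅ ν + (shift 1 (coeff φC) ν + shift 2 (coeff φP) ν)
      ≡⟨ cong₂ _+_ (∑-cong (upTo K) (λ a → cong (φ₅ a *_) (expand a)))
           (trans (cong (λ r → r + shift 2 (coeff φP) ν) (shift-absent (coeff φC) 1 ν m₁)) (trans (ℚ.+-identityˡ _) (without-2 (removeView 2 ν)))) ⟩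
    ∑ (upTo K) (λ a → φ₅ a * ∑ (upTo K) (λ b → ψ b * f a b)) + ∑ (upTo K) (λ b → φD b * f 2 b)
      ≡⟨ cong (λ r → r + ∑ (upTo K) (λ b → φD b * f 2 b)) (∑-cong (upTo K) λ a → trans (*-distribˡ-∑ (upTo K) (φ₅ a) (λ b → ψ b * f a b)) (trans (∑-cong (upTo K) (split a))
           (∑-distrib-+ (upTo K) (G a) (λ b → L a b + M a b)))) ⟩
    ∑ (upTo K) (λ a → ∑ (upTo K) (G a) + ∑ (upTo K) (λ b → L a b + M a b)) + ∑ (upTo K) (λ b → φD b * f 2 b)
      ≡⟨ cong (λ r → r + ∑ (upTo K) (λ b → φD b * f 2 b)) (∑-distrib-+ (upTo K) (λ a → ∑ (upTo K) (G a)) (λ a → ∑ (upTo K) (λ b → L a b + M a b))) ⟩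
    (ΣG + ∑ (upTo K) (λ a → ∑ (upTo K) (λ b → L a b + M a b))) + ∑ (upTo K) (λ b → φD b * f 2 b)
      ≡⟨ cong (λ r → (ΣG + r) + ∑ (upTo K) (λ b → φD b * f 2 b)) (trans (∑-cong (upTo K) (λ a → ∑-distrib-+ (upTo K) (L a) (M a)))
           (trans (∑-distrib-+ (upTo K) (λ a → ∑ (upTo K) (L a)) (λ a → ∑ (upTo K) (M a)))
             (cong₂ _+_ (∑-upTo-single K 2 (λ a → ∑ (upTo K) (L a)) 2<K (λ a a≢2 → ∑-zero (upTo K) (λ _ → L-off a a≢2)))
               (∑-cong (upTo K) (λ a → ∑-upTo-single K 2 (M a) 2<K (M-off a)))))) ⟩
    (ΣG + (∑ (upTo K) (L 2) + ∑ (upTo K) (λ a → M a 2))) + ∑ (upTo K) (λ b → φD b * f 2 b)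
      ≡⟨ ℚ.+-assoc ΣG (∑ (upTo K) (L 2) + ∑ (upTo K) (λ a → M a 2)) (∑ (upTo K) (λ b → φD b * f 2 b)) ⟩
    ΣG + ((∑ (upTo K) (L 2) + ∑ (upTo K) (λ a → M a 2)) + ∑ (upTo K) (λ b → φD b * f 2 b))
      ≡⟨ cong (λ r → ΣG + r) (trans (cong (λ r → r + ∑ (upTo K) (λ b → φD b * f 2 b)) (sym (∑-distrib-+ (upTo K) (L 2) (λ a → M a 2))))
           (trans (sym (∑-distrib-+ (upTo K) (λ d → L 2 d + M d 2) (λ d → φD d * f 2 d))) (∑-cong (upTo K) collect))) ⟩
    ΣG + ∑ (upTo K) H
      ≡⟨ cong₂ _+_ pairs-sum (sym (supp-filter-sum 3 (λ d → ε[ ν - d - 2 ] * ω d) H ν ν<K H-agree H-small H-vanish)) ⟩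
    ∑ (filter (λ (a , b) → (3 ≤? a) ×-dec (3 ≤? b)) (suppPairs ν)) (λ (a , b) → ε[ ν - a - b ] * φ₅ a * ψ b)
      + ∑ (filter (3 ≤?_) (supp ν)) (λ d → ε[ ν - d - 2 ] * ω d) ∎
    where
    open ≡-Reasoning
    open Data.Rational.Solver.+-*-Solver
    2<K : 2 < K
    2<K = s≤s (ℕ.≤-trans (s≤s (s≤s z≤n)) 4≤k)
    -- Pairs with a 0 or 1 contribute nothing. The others are divided into `G` with both entries at
    -- least 3, `L` with `a = 2`, and `M` with `a ≥ 3` and `b = 2`.
    f G L M : ℕ → ℕ → ℚ
    f a b = shift₂ a b ν
    G a@(suc (suc (suc _))) b@(suc (suc (suc _))) = f a b * φ₅ a * ψ b
    G _                     _                     = 0ℚ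
    L 2 b = φ₅ 2 * (ψ b * f 2 b)
    L _ b = 0ℚ
    M a@(suc (suc (suc _))) 2 = φ₅ a * (ψ 2 * f a 2)
    M _                     _ = 0ℚ
    H : ℕ → ℚ
    H d@(suc (suc (suc _))) = f d 2 * ω d
    H _                     = 0ℚ
    ΣG : ℚ
    ΣG = ∑ (upTo K) (λ a → ∑ (upTo K) (G a))
    m₀ : mult 0 ν ≡ 0
    m₀ = mult-0 positive
    zeroed : ∀ a b → f a b ≡ 0ℚ → φ₅ a * (ψ b * f a b) ≡ 0ℚ
    zeroed a b eq = trans (cong (λ r → φ₅ a * (ψ b * r)) eq) (trans (cong (φ₅ a *_) (ℚ.*-zeroʳ (ψ b))) (ℚ.*-zeroʳ (φ₅ a)))
    -- From `1 ≤ m₂ < ℓ` there are at least two parts, so the recursion for `ε` still applies after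
    -- one removal.
    nonEmpty : ∀ {a μ} → ν ↭ a ∷ μ → NonEmpty μ
    nonEmpty {μ = b ∷ μ} p = cons b μ
    nonEmpty {μ = []}    p = ⊥-elim (ℕ.<-irrefl refl (ℕ.≤-<-trans 1≤m₂ (subst (mult 2 ν <_) (↭-length p) m₂<ℓ)))
    expand : ∀ a → shift a ε ν ≡ ∑ (upTo K) (λ b → ψ b * f a b)
    expand a = go (removeView a ν)
      where
      go : RemoveView a ν → shift a ε ν ≡ ∑ (upTo K) (λ b → ψ b * f a b)
      go (absent eq rem)   = trans (shift-absent ε a ν eq) (sym (∑-zero (upTo K) (λ {b} _ →
        trans (cong (ψ b *_) (shift₂-absentˡ a b ν eq)) (ℚ.*-zeroʳ (ψ b)))))
      go (present μ p rem) = trans (cong (ext ε) rem) (trans (ε-parts K (nonEmpty p) (positive′ p) (smaller p))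
        (∑-cong (upTo K) (λ b → cong (λ m → ψ b * ext (shift b ε) m) (sym rem))))
    without-2 : RemoveView 2 ν → shift 2 (coeff φP) ν ≡ ∑ (upTo K) (λ b → φD b * f 2 b)
    without-2 (absent eq rem)   = ⊥-elim (ℕ.<-irrefl (sym eq) 1≤m₂)
    without-2 (present μ p rem) = trans (cong (ext (coeff φP)) rem) (trans (coeffP-parts K (nonEmpty p) (positive′ p) (smaller p))
      (∑-cong (upTo K) (λ b → cong (λ m → φD b * ext (shift b ε) m) (sym rem))))
    split : ∀ a b → φ₅ a * (ψ b * f a b) ≡ G a b + (L a b + M a b)
    split 0 b = zeroed 0 b (shift₂-absentˡ 0 b ν m₀)
    split 1 b = zeroed 1 b (shift₂-absentˡ 1 b ν m₁)
    split 2 b = solve 1 (λ l → l := con 0ℚ :+ (l :+ con 0ℚ)) refl (L 2 b)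
    split a@(suc (suc (suc _))) 0 = zeroed a 0 (shift₂-absentʳ a 0 ν m₀)
    split a@(suc (suc (suc _))) 1 = zeroed a 1 (shift₂-absentʳ a 1 ν m₁)
    split a@(suc (suc (suc _))) 2 = solve 1 (λ m → m := con 0ℚ :+ (con 0ℚ :+ m)) refl (M a 2)
    split a@(suc (suc (suc _))) b@(suc (suc (suc _))) =
      solve 3 (λ p q s → p :* (q :* s) := s :* p :* q :+ (con 0ℚ :+ con 0ℚ)) refl (φ₅ a) (ψ b) (f a b)
    L-off : ∀ a {b} → a ≢ 2 → L a b ≡ 0ℚ
    L-off 0                   _   = refl
    L-off 1                   _   = refl
    L-off 2                   ≢2  = ⊥-elim (≢2 refl)
    L-off (suc (suc (suc a))) _   = refl
    M-off : ∀ a b → b ≢ 2 → M a b ≡ 0ℚ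
    M-off 0                   _                   _  = refl
    M-off 1                   _                   _  = refl
    M-off 2                   _                   _  = refl
    M-off (suc (suc (suc a))) 0                   _  = refl
    M-off (suc (suc (suc a))) 1                   _  = refl
    M-off (suc (suc (suc a))) 2                   ≢2 = ⊥-elim (≢2 refl)
    M-off (suc (suc (suc a))) (suc (suc (suc b))) _  = refl
    -- For `d ≥ 3` the weights `-2 (d - 1)`, `2 d² - 5 d` and `d` add up to `2 d² - 6 d + 2`. At
    -- `d = 2` the second is absent and the rest is `-2 + 2`.
    collect : ∀ d → (L 2 d + M d 2) + φD d * f 2 d ≡ H d
    collect 0 = trans (cong (λ r → (φ₅ 2 * (ψ 0 * r) + 0ℚ) + φD 0 * r) (shift₂-absentʳ 2 0 ν m₀)) refl
    collect 1 = trans (cong (λ r → (φ₅ 2 * (ψ 1 * r) + 0ℚ) + φD 1 * r) (shift₂-absentʳ 2 1 ν m₁)) refl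
    collect 2 = solve 1 (λ s → (con (φ₅ 2) :* (con (ψ 2) :* s) :+ con 0ℚ) :+ con (φD 2) :* s := con 0ℚ) refl (f 2 2)
    collect d@(suc (suc (suc _))) = trans
      (cong₂ (λ q r → (φ₅ 2 * (q * f 2 d) + r * (ψ 2 * f d 2)) + φD d * f 2 d) (ι-- (+ d) (+ 1)) (φ₅-formula d))
      (trans (cong (λ r → (φ₅ 2 * ((fromℕ d -ℚ 1ℚ) * r) + (ι (+ 2) * (fromℕ d * fromℕ d) -ℚ ι (+ 5) * fromℕ d) * (ψ 2 * f d 2)) + φD d * r) (shift₂-sym 2 d ν))
      (trans (solve 2 (λ n s → (con (φ₅ 2) :* ((n :- con 1ℚ) :* s) :+ (con (ι (+ 2)) :* (n :* n) :- con (ι (+ 5)) :* n) :* (con (ψ 2) :* s)) :+ n :* s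
            := s :* (con (ι (+ 2)) :* (n :* n) :- con (ι (+ 6)) :* n :+ con (ι (+ 2)))) refl (fromℕ d) (f d 2))
        (cong (f d 2 *_) (sym (ω-formula d)))))
    H-agree : ∀ d → 3 ≤ d → ε[ ν - d - 2 ] * ω d ≡ H d
    H-agree d@(suc (suc (suc _))) _ = cong (_* ω d) (ε?≡shift₂ d 2 ν)
    H-agree 1 (s≤s ())
    H-agree 2 (s≤s (s≤s ()))
    H-small : ∀ d → ¬ 3 ≤ d → H d ≡ 0ℚ
    H-small 0                   _  = refl
    H-small 1                   _  = refl
    H-small 2                   _  = refl
    H-small (suc (suc (suc d))) ≱3 = ⊥-elim (≱3 (s≤s (s≤s (s≤s z≤n))))
    H-vanish : ∀ d → mult d ν ≡ 0 → H d ≡ 0ℚ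
    H-vanish 0                       _  = refl
    H-vanish 1                       _  = refl
    H-vanish 2                       _  = refl
    H-vanish d@(suc (suc (suc _))) eq = trans (cong (_* ω d) (shift₂-absentˡ d 2 ν eq)) (ℚ.*-zeroˡ (ω d))
    G-zero : ∀ a b → f a b ≡ 0ℚ → G a b ≡ 0ℚ
    G-zero 0 b _ = refl
    G-zero 1 b _ = refl
    G-zero 2 b _ = refl
    G-zero (suc (suc (suc a))) 0 _ = refl
    G-zero (suc (suc (suc a))) 1 _ = refl
    G-zero (suc (suc (suc a))) 2 _ = refl
    G-zero a@(suc (suc (suc _))) b@(suc (suc (suc _))) eq =
      trans (cong (λ r → r * φ₅ a * ψ b) eq) (trans (cong (_* ψ b) (ℚ.*-zeroˡ (φ₅ a))) (ℚ.*-zeroˡ (ψ b)))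
    G-agree : ∀ a b → 3 ≤ a × 3 ≤ b → ε[ ν - a - b ] * φ₅ a * ψ b ≡ G a b
    G-agree a@(suc (suc (suc _))) b@(suc (suc (suc _))) _ = cong (λ r → r * φ₅ a * ψ b) (ε?≡shift₂ a b ν)
    G-agree 1 b (s≤s () , _)
    G-agree 2 b (s≤s (s≤s ()) , _)
    G-agree (suc (suc (suc a))) 1 (_ , s≤s ())
    G-agree (suc (suc (suc a))) 2 (_ , s≤s (s≤s ()))
    G-small : ∀ a b → ¬ (3 ≤ a × 3 ≤ b) → G a b ≡ 0ℚ
    G-small 0 b _ = refl
    G-small 1 b _ = refl
    G-small 2 b _ = refl
    G-small (suc (suc (suc a))) 0 _ = refl
    G-small (suc (suc (suc a))) 1 _ = refl
    G-small (suc (suc (suc a))) 2 _ = refl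
    G-small (suc (suc (suc a))) (suc (suc (suc b))) ¬p = ⊥-elim (¬p (s≤s (s≤s (s≤s z≤n)) , s≤s (s≤s (s≤s z≤n))))
    pair? : ∀ ((a , b) : ℕ × ℕ) → Dec (a ≡ b → 2 ≤ mult a ν)
    pair? (a , b) = (a ℕ.≟ b) →-dec (2 ≤? mult a ν)
    large? : ∀ ((a , b) : ℕ × ℕ) → Dec (3 ≤ a × 3 ≤ b)
    large? (a , b) = (3 ≤? a) ×-dec (3 ≤? b)
    not-pair : ∀ a b → ¬ (a ≡ b → 2 ≤ mult a ν) → f a b ≡ 0ℚ
    not-pair a b ¬p = go (a ℕ.≟ b)
      where
      go : Dec (a ≡ b) → f a b ≡ 0ℚ
      go (yes refl) = shift₂-same a ν (ℕ.≰⇒> (λ 2≤ → ¬p (λ _ → 2≤)))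
      go (no a≢b)   = ⊥-elim (¬p (λ eq → ⊥-elim (a≢b eq)))
    pairs-sum : ΣG ≡ ∑ (filter large? (suppPairs ν)) (λ (a , b) → ε[ ν - a - b ] * φ₅ a * ψ b)
    pairs-sum = sym (begin
      ∑ (filter large? (suppPairs ν)) (λ (a , b) → ε[ ν - a - b ] * φ₅ a * ψ b)
        ≡⟨ ∑-cong-∈ (filter large? (suppPairs ν)) (λ {(a , b)} ab∈ → G-agree a b (proj₂ (∈-filter⁻ large? {xs = suppPairs ν} ab∈))) ⟩
      ∑ (filter large? (suppPairs ν)) (λ (a , b) → G a b)
        ≡⟨ ∑-filter large? (suppPairs ν) (λ (a , b) → G a b) (λ (a , b) → G-small a b) ⟩
      ∑ (suppPairs ν) (λ (a , b) → G a b)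
        ≡⟨ ∑-filter pair? (cartesianProduct (supp ν) (supp ν)) (λ (a , b) → G a b) (λ (a , b) ¬p → G-zero a b (not-pair a b ¬p)) ⟩
      ∑ (cartesianProduct (supp ν) (supp ν)) (λ (a , b) → G a b)
        ≡⟨ ∑-cartesianProductWith _,_ (supp ν) (supp ν) (λ (a , b) → G a b) ⟩
      ∑ (supp ν) (λ a → ∑ (supp ν) (G a))
        ≡⟨ ∑-cong (supp ν) (λ a → supp-sum (G a) ν ν<K (λ b eq → G-zero a b (shift₂-absentʳ a b ν eq))) ⟩
      ∑ (supp ν) (λ a → ∑ (upTo K) (G a))
        ≡⟨ supp-sum (λ a → ∑ (upTo K) (G a)) ν ν<K (λ a eq → ∑-zero (upTo K) (λ {b} _ → G-zero a b (shift₂-absentˡ a b ν eq))) ⟩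
      ΣG ∎)

-- The only possible removal is that of `k` itself, with `ε` of the empty partition equal to 1; as
-- `k ≥ 4`, there is no part 1 or 2.
coefficient-a : ∀ k → 4 ≤ k → Partition k (k ∷ []) × twinCoeff (k ∷ []) ≡ ι (+ k *ℤ (+ 2 *ℤ + k -ℤ + 5))
coefficient-a k 4≤k = p , (begin
  twinCoeff (k ∷ [])
    ≡⟨ twinCoeff-parts k 4≤k (k ∷ []) p ⟩
  parts (suc k) φ₅ (k ∷ []) + (shift 1 (coeff φC) (k ∷ []) + shift 2 (coeff φP) (k ∷ []))
    ≡⟨ cong₂ (λ q r → parts (suc k) φ₅ (k ∷ []) + (q + r))
         (shift-absent (coeff φC) 1 (k ∷ []) (mult-there [] (≢ (s≤s (s≤s z≤n))))) (shift-absent (coeff φP) 2 (k ∷ []) (mult-there [] (≢ (s≤s (s≤s (s≤s z≤n)))))) ⟩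
  parts (suc k) φ₅ (k ∷ []) + 0ℚ
    ≡⟨ ℚ.+-identityʳ _ ⟩
  parts (suc k) φ₅ (k ∷ [])
    ≡⟨ parts-single (suc k) φ₅ k (k ∷ []) ℕ.≤-refl (λ j j≢k → shift-absent ε j (k ∷ []) (mult-there [] (j≢k ∘ sym))) ⟩
  φ₅ k * shift k ε (k ∷ [])
    ≡⟨ cong (φ₅ k *_) (cong (ext ε) (remove-here k [])) ⟩
  φ₅ k * 1ℚ
    ≡⟨ ℚ.*-identityʳ (φ₅ k) ⟩
  φ₅ k
    ≡⟨ φ₅-formula k ⟩
  ι (+ 2) * (fromℕ k * fromℕ k) -ℚ ι (+ 5) * fromℕ k
    ≡⟨ solve 1 (λ n → con (ι (+ 2)) :* (n :* n) :- con (ι (+ 5)) :* n := n :* (con (ι (+ 2)) :* n :- con (ι (+ 5)))) refl (fromℕ k) ⟩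
  fromℕ k * (ι (+ 2) * fromℕ k -ℚ ι (+ 5))
    ≡⟨ trans (ι-* (+ k) (+ 2 *ℤ + k -ℤ + 5)) (cong (fromℕ k *_) (trans (ι-- (+ 2 *ℤ + k) (+ 5)) (cong (_-ℚ ι (+ 5)) (ι-* (+ 2) (+ k))))) ⟨
  ι (+ k *ℤ (+ 2 *ℤ + k -ℤ + 5)) ∎)
  where
  open ≡-Reasoning
  open Data.Rational.Solver.+-*-Solver
  p : Partition k (k ∷ [])
  p = record { sorted = [] ∷ [] ; positive = Data.Nat.>-nonZero (ℕ.≤-trans (s≤s z≤n) 4≤k) ∷ [] ; size = ℕ.+-identityʳ k }
  ≢ : ∀ {j} → j < 4 → k ≢ j
  ≢ j<4 refl = ℕ.<⇒≱ j<4 4≤k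

-- Existence of the expansion and transfer of the formulas

½𝒳Cv-expansion : ∀ v k → 4 ≤ k → ∀ α → sum α ≡ k → ½𝒳Cv v k α ≡ 𝔼 twinCoeff α
½𝒳Cv-expansion v (suc (suc (suc (suc m)))) _ α eq = trans (cong (½ *_) (X-twin m (v m) α eq))
  (trans (sym (ℚ.*-assoc ½ (ι (+ 2)) (𝔼 twinCoeff α))) (ℚ.*-identityˡ (𝔼 twinCoeff α)))
½𝒳Cv-expansion v 3 (s≤s (s≤s (s≤s ()))) α eq
½𝒳Cv-expansion v 2 (s≤s (s≤s ())) α eq
½𝒳Cv-expansion v 1 (s≤s ()) α eq

½𝒳Cv-degree : ∀ v k → Homogeneous k (½𝒳Cv v k)
½𝒳Cv-degree v 0 α _ = refl
½𝒳Cv-degree v 1 α _ = refl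
½𝒳Cv-degree v 2 α _ = refl
½𝒳Cv-degree v 3 α _ = refl
½𝒳Cv-degree v (suc (suc (suc (suc m)))) α ≢k = cong (½ *_) (X-degree (twin (cycle m) (v m)) α ≢k)

𝔼-zero : ∀ c α → (∀ ν → Partition (sum α) ν → c ν ≡ 0ℚ) → 𝔼 c α ≡ 0ℚ
𝔼-zero c α h = ∑-zero (partitions (sum α)) λ {ν} ν∈ → trans (cong (_* e[ ν ] α) (h ν (partitions-sound ν∈))) (ℚ.*-zeroˡ (e[ ν ] α))

expansion-exists : ∀ v k → ∃ λ c → c IsEExpansionOf ½𝒳Cv v k
expansion-exists v k = c , expands
  where
  -- The expansion must hold at monomials of every degree, so `twinCoeff` is cut off to the
  -- partitions of `k`; for `k < 4` the series is 0 and so are its coefficients.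
  pick : ∀ ν → Dec (4 ≤ k) → Dec (sum ν ≡ k) → ℚ
  pick ν (yes _) (yes _) = twinCoeff ν
  pick ν _       _       = 0ℚ
  c : List ℕ → ℚ
  c ν = pick ν (4 ≤? k) (sum ν ℕ.≟ k)
  c≡twinCoeff : 4 ≤ k → ∀ ν → sum ν ≡ k → c ν ≡ twinCoeff ν
  c≡twinCoeff 4≤k ν eq = go (4 ≤? k) (sum ν ℕ.≟ k)
    where
    go : ∀ p q → pick ν p q ≡ twinCoeff ν
    go (yes _)  (yes _) = refl
    go (yes _)  (no ≢k) = ⊥-elim (≢k eq)
    go (no 4≰k) _       = ⊥-elim (4≰k 4≤k)
  c≡0 : ∀ ν → ¬ (4 ≤ k × sum ν ≡ k) → c ν ≡ 0ℚ
  c≡0 ν ¬p = go (4 ≤? k) (sum ν ℕ.≟ k)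
    where
    go : ∀ p q → pick ν p q ≡ 0ℚ
    go (yes p) (yes q) = ⊥-elim (¬p (p , q))
    go (yes _) (no _)  = refl
    go (no _)  _       = refl
  low : ∀ k → ¬ 4 ≤ k → ∀ α → ½𝒳Cv v k α ≡ 0ℚ
  low 0 _ α = refl
  low 1 _ α = refl
  low 2 _ α = refl
  low 3 _ α = refl
  low (suc (suc (suc (suc k)))) 4≰k α = ⊥-elim (4≰k (s≤s (s≤s (s≤s (s≤s z≤n)))))
  expands : ∀ α → ½𝒳Cv v k α ≡ 𝔼 c α
  expands α = go (4 ≤? k) (sum α ℕ.≟ k)
    where
    go : Dec (4 ≤ k) → Dec (sum α ≡ k) → ½𝒳Cv v k α ≡ 𝔼 c α
    go (no 4≰k)  _        = trans (low k 4≰k α) (sym (𝔼-zero c α (λ ν _ → c≡0 ν (4≰k ∘ proj₁))))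
    go (yes _)   (no ≢k)  = trans (½𝒳Cv-degree v k α ≢k)
      (sym (𝔼-zero c α (λ ν p → c≡0 ν (λ (_ , eq) → ≢k (trans (sym (Partition.size p)) eq)))))
    go (yes 4≤k) (yes eq) = trans (½𝒳Cv-expansion v k 4≤k α eq)
      (𝔼-cong α (λ ν p → sym (c≡twinCoeff 4≤k ν (trans (Partition.size p) eq))))

-- As 1 occurs once and has been appended, `μ` contains no 1, so `remove` walks past `μ` to the end.
remove-∪1 : ∀ μ → mult 1 (μ ∪1) ≡ 1 → remove 1 (μ ∪1) ≡ just μ
remove-∪1 []      _  = refl
remove-∪1 (b ∷ μ) m₁ = go (b ℕ.≟ 1)
  where
  last-1 : ∀ μ → mult 1 (μ ∪1) ≢ 0
  last-1 []      ()
  last-1 (b ∷ μ) = case (b ℕ.≟ 1)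
    where
    case : Dec (b ≡ 1) → mult 1 (b ∷ μ ∪1) ≢ 0
    case (yes refl) eq = ℕ.1+n≢0 (trans (sym (mult-here 1 (μ ∪1))) eq)
    case (no b≢1)   eq = last-1 μ (trans (sym (mult-there (μ ∪1) b≢1)) eq)
  go : Dec (b ≡ 1) → remove 1 ((b ∷ μ) ∪1) ≡ just (b ∷ μ)
  go (yes refl) = ⊥-elim (last-1 μ (ℕ.suc-injective (trans (sym (mult-here 1 (μ ∪1))) m₁)))
  go (no b≢1)   = trans (remove-there (μ ∪1) b≢1) (cong (mapMaybe (b ∷_)) (remove-∪1 μ (trans (sym (mult-there (μ ∪1) b≢1)) m₁)))

corollary3p30 : (v : ∀ m → Fin (3 +ℕ m)) →
    (∀ N → ∃ λ c → c IsEExpansionOf ½𝒳Cv v N) ×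
    ((c : ℕ → List ℕ → ℚ) → (∀ N → c N IsEExpansionOf ½𝒳Cv v N) →
    ∀ k → 4 ≤ k →
    (c k (k ∷ []) ≡ ι (+ k *ℤ (+ 2 *ℤ + k -ℤ + 5))) ×
    (∀ ν → ν ⊢ k →
    (1 < mult 1 ν → c k ν ≡ 0ℚ) ×
    (mult 1 ν ≡ 1 →
    (∀ μ → ν ≡ μ ∪1 →
    c k ν ≡ ∑ (filter (4 ≤?_) (supp μ))
    (λ i → ι ((+ i -ℤ + 1) *ℤ (+ i -ℤ + 3)) * ε[ μ - i ])) ×
    (All (_< 4) ν → c k ν ≡ 0ℚ)) ×
    (mult 1 ν ≡ 0 → mult 2 ν ≡ 0 →
    c k ν ≡ ∑ (supp ν)
    (λ a → ι (+ 2 *ℤ (+ a) ^ℤ 2 -ℤ + 5 *ℤ + a) * ε[ ν - a ])) ×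
    (mult 1 ν ≡ 0 → mult 2 ν ≡ length ν → c k ν ≡ 0ℚ) ×
    (mult 1 ν ≡ 0 → 1 ≤ mult 2 ν → mult 2 ν < length ν →
    c k ν ≡ ∑ (filter (λ (a , b) → (3 ≤? a) ×-dec (3 ≤? b)) (suppPairs ν))
    (λ (a , b) → ε[ ν - a - b ] * ι (+ 2 *ℤ (+ a) ^ℤ 2 -ℤ + 5 *ℤ + a) * ι (+ b -ℤ + 1))
    + ∑ (filter (3 ≤?_) (supp ν))
    (λ d → ε[ ν - d - 2 ] * ι (+ 2 *ℤ (+ d) ^ℤ 2 -ℤ + 6 *ℤ + d +ℤ + 2)))))
corollary3p30 v = expansion-exists v , λ c expands k 4≤k →
  -- Any given expansion agrees with `twinCoeff` on the partitions of `k` by linear independence, so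
  -- every claim reduces to one about `twinCoeff`.
  let unique : ∀ {ν} → Partition k ν → c k ν ≡ twinCoeff ν
      unique = expansion-unique (c k) twinCoeff k (λ α eq → trans (sym (expands k α)) (½𝒳Cv-expansion v k 4≤k α eq))
      p , coefficient = coefficient-a k 4≤k
  in trans (unique p) coefficient , λ ν ν⊢k →
  let q = ⊢⇒Partition ν⊢k
  in (λ m₁ → trans (unique q) (coefficient-b k 4≤k ν q m₁))
   , (λ m₁ → (λ { μ refl → trans (unique q) (coefficient-c k 4≤k ν q m₁ (remove-∪1 μ m₁)) })
           , (λ <4 → trans (unique q) (coefficient-c-small k 4≤k ν q m₁ <4)))
   , (λ m₁ m₂ → trans (unique q) (coefficient-d k 4≤k ν q m₁ m₂))
   , (λ m₁ m₂ → trans (unique q) (coefficient-e k 4≤k ν q m₁ m₂))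
   , (λ m₁ 1≤m₂ m₂<ℓ → trans (unique q) (coefficient-f k 4≤k ν q m₁ 1≤m₂ m₂<ℓ))
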